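{- Let $L\subseteq\Sigma^*$ be a language. Then $L\in\mathrm{PSPACE}$ if and only if there exist a Turing machine $\mathcal M$ over $\Sigma$ and a polynomial $p$ such that $$L=L(\mathcal M)=\{w\in\Sigma^* : w\in L_{p(|w|)}(\mathcal M)\},$$ where $|w|$ is the length of $w$ and $L_n(\mathcal M)$ denotes the $n$-perturbed language of $\mathcal M$ defined in the context.
   Context: A Turing machine over a finite alphabet $\Sigma$ with blank $B\notin\Sigma$ is a tuple $(Q,q_0,F,R,\Gamma)$: $Q$ finite set of control states, $q_0\in Q$ initial state, $F\subseteq Q$ accepting and $R\subseteq Q$ rejecting states with $F\cap R=\emptyset$, and $\Gamma$ a set of transitions $(q,a)\to(q',b,\delta)$ with $q,q'\in Q$, $a,b\in\Sigma\cup\{B\}$, $\delta\in\{ -1,0,1\}$ (the symbol under the head $a$ is replaced by $b$, the state becomes $q'$, and the head moves by $\delta$); if $q\in F$ then $q'\in F$ and if $q\in R$ then $q'\in R$. The tape is bi-infinite; a configuration is a control state together with the tape content $\cdots a_{ -2}a_{ -1}a_0a_1a_2\cdots$, the head being on $a_0$. A word $w=a_1\cdots a_n$ is accepted by $\mathcal M$ if from the initial configuration (state $q_0$, tape $\cdots BBB\,a_1\cdots a_n\,BBB\cdots$, head on $a_1$) the machine eventually reaches a configuration with state in $F$; $L(\mathcal M)$ is the set of accepted words. For $n>0$, the $n$-perturbed version $\mathcal M_n$ of $\mathcal M$ is the nondeterministic machine that behaves as $\mathcal M$, except that before any transition, every tape symbol at distance more than $n$ from the head (i.e. to the left of $a_{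 -n}$ and to the right of $a_n$) may be replaced by an arbitrary symbol of $\Sigma\cup\{B\}$. $L_n(\mathcal M)$ is the set of words $w$ for which some run of $\mathcal M_n$ from the initial configuration on $w$ reaches an accepting state. -}

module Defs where

open import Data.Nat using (ℕ; zero; suc; _+_; _*_; _≤_; _<_)
open import Data.Integer as ℤ using (ℤ; +_; -[1+_]; ∣_∣)
open import Data.Fin using (Fin)
open import Data.Bool using (Bool; true; false; if_then_else_)
open import Data.Maybe using (Maybe; just; nothing)
open import Data.List using (List; []; _∷_; length)
open import Data.Product using (Σ; ∃; _×_; _,_)
open import Data.Sum using (_⊎_)
open import Relation.Binary.PropositionalEquality using (_≡_; _≢_)
open import Relation.Nullary.Decidable using (⌊_⌋)
open import Relation.Binary.Construct.Closure.ReflexiveTransitive using (Star)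
open import Function.Definitions using (Injective)

Poly : Set
Poly = List ℕ

eval : Poly → ℕ → ℕ
eval []       x = 0
eval (c ∷ cs) x = c + x * eval cs x

data Move : Set where
  left stay right : Move

moveℤ : Move → ℤ
moveℤ left  = -[1+ 0 ]
moveℤ stay  = + 0
moveℤ right = + 1

record TM (Γ : Set) : Set where
  field
    nQ      : ℕ
    q₀      : Fin nQ
    isF     : Fin nQ → Bool      -- accepting states
    isR     : Fin nQ → Bool      -- rejecting states
    disjoint : ∀ q → isF q ≡ true → isR q ≡ false
    δ       : Fin nQ → Γ → Maybe (Fin nQ × Γ × Move)
    closedF : ∀ q a q' b m → δ q a ≡ just (q' , b , m) → isF q ≡ true → isF q' ≡ true
    closedR : ∀ q a q' b m → δ q a ≡ just (q' , b , m) → isR q ≡ true → isR q' ≡ true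

open TM public

record Config {Γ : Set} (M : TM Γ) : Set where
  constructor ⟨_,_,_⟩
  field
    state : Fin (nQ M)
    tape  : ℤ → Γ
    head  : ℤ

open Config public

write : {Γ : Set} → (ℤ → Γ) → ℤ → Γ → (ℤ → Γ)
write t h b i = if ⌊ i ℤ.≟ h ⌋ then b else t i

data Step {Γ : Set} (M : TM Γ) : Config M → Config M → Set where
  step : ∀ {q t h q' b m} → δ M q (t h) ≡ just (q' , b , m) →
         Step M ⟨ q , t , h ⟩ ⟨ q' , write t h b , h ℤ.+ moveℤ m ⟩

data PStep {Γ : Set} (M : TM Γ) (n : ℕ) : Config M → Config M → Set where
  pstep : ∀ {q t t' h c} →
          (∀ i → ∣ i ℤ.- h ∣ ≤ n → t' i ≡ t i) →
          Step M ⟨ q , t' , h ⟩ c →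
          PStep M n ⟨ q , t , h ⟩ c

nth : {A : Set} → List A → ℕ → Maybe A
nth []       _       = nothing
nth (x ∷ xs) zero    = just x
nth (x ∷ xs) (suc k) = nth xs k

initTape : {A Γ : Set} → Γ → (A → Γ) → List A → ℤ → Γ
initTape blank emb w (+ k) with nth w k
... | just a  = emb a
... | nothing = blank
initTape blank emb w -[1+ k ] = blank

initConfig : {A Γ : Set} (M : TM Γ) → Γ → (A → Γ) → List A → Config M
initConfig M blank emb w = ⟨ q₀ M , initTape blank emb w , + 0 ⟩

-- The machines of the paper: alphabet Σ = Fin s, symbols Σ ∪ {B} = Maybe (Fin s),
-- blank B = nothing.

Sym : ℕ → Set
Sym s = Maybe (Fin s)

Word : ℕ → Set
Word s = List (Fin s)

init : {s : ℕ} (M : TM (Sym s)) → Word s → Config M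
init M w = initConfig M nothing just w

Accepts : {s : ℕ} (M : TM (Sym s)) → Word s → Set
Accepts M w = ∃ λ c → Star (Step M) (init M w) c × isF M (state c) ≡ true

AcceptsPerturbed : {s : ℕ} (M : TM (Sym s)) → ℕ → Word s → Set
AcceptsPerturbed M n w = ∃ λ c → Star (PStep M n) (init M w) c × isF M (state c) ≡ true

Language : ℕ → Set₁
Language s = Word s → Set

record PSPACE {s : ℕ} (L : Language s) : Set where
  field
    g       : ℕ
    blank   : Fin g
    emb     : Fin s → Fin g
    emb-inj : Injective _≡_ _≡_ emb
    emb-nb  : ∀ a → emb a ≢ blank
    M       : TM (Fin g)
    p       : Poly
    halts   : ∀ w → ∃ λ c → Star (Step M) (initConfig M blank emb w) c
                          × (isF M (state c) ≡ true ⊎ isR M (state c) ≡ true)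
    space   : ∀ w c → Star (Step M) (initConfig M blank emb w) c →
              ∣ head c ∣ ≤ eval p (length w)
    decides-sound    : ∀ w → L w → ∃ λ c → Star (Step M) (initConfig M blank emb w) c
                                          × isF M (state c) ≡ true
    decides-complete : ∀ w → (∃ λ c → Star (Step M) (initConfig M blank emb w) c
                                     × isF M (state c) ≡ true) → L w

{-# OPTIONS --safe #-}
module Submission where

-- From a space bounded decider to a robust machine: recode the tape alphabet in blocks of
-- letters and blanks, moving the input, last letter first, into blocks to its left, and then
-- simulate.  A machine that halts on every input and never leaves a stretch of polynomially many
-- cells does not notice perturbations further away than the length of that stretch.
--
-- Back: every perturbation radius n ≥ p(|w|) gives the same language, because exact runs are
-- perturbed runs and perturbed runs of radius n are runs of radius p(|w|).  The window of radius
-- n around the head evolves in a finite graph, where only the cell entering the window is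
-- arbitrary.  As in Savitch's theorem, the existence of a path of length 2^t is a formula
-- ∃ M₁ ∀ b₁ … ∃ M_t ∀ b_t (…) over windows M_i and bits b_i, whose matrix is an edge test that a
-- finite automaton performs column by column.  The machine writes such an assignment on its
-- tape, one row per level, and runs through all assignments like an odometer.

open import Defs
open import Data.Nat as ℕ using (ℕ; zero; suc; _+_; _*_; _∸_; _^_; _≤_; _<_; z≤n; s≤s)
import Data.Nat.Properties as ℕₚ
open import Data.Nat.Induction using (<-rec)
open import Data.Nat.Tactic.RingSolver using (solve-∀)
open import Data.Integer as ℤ using (ℤ; +_; -[1+_]; ∣_∣; _⊖_)
import Data.Integer.Properties as ℤₚ
open import Data.Integer.Tactic.RingSolver using () renaming (solve-∀ to solveℤ-∀)
open import Data.Fin as Fin using (Fin; zero; suc; toℕ; fromℕ; inject₁; splitAt; join; combine; remQuot)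
import Data.Fin.Properties as Finₚ
open import Data.Bool using (Bool; true; false; if_then_else_; not; _∨_)
open import Data.Maybe as Maybe using (Maybe; just; nothing)
import Data.Maybe.Properties as Maybeₚ
open import Data.List using (List; []; _∷_; length; map; _++_; _ʳ++_; replicate; reverse)
import Data.List.Properties as Listₚ
open import Data.List.Relation.Unary.All using (All; []; _∷_)
import Data.List.Relation.Unary.All.Properties as Allₚ
open import Data.Vec as Vec using (Vec; []; _∷_; lookup; toList)
import Data.Vec.Properties as Vecₚ
open import Data.Product using (Σ; ∃; _×_; _,_; proj₁; proj₂)
open import Data.Sum using (_⊎_; inj₁; inj₂)
open import Data.Unit using (⊤; tt)
open import Data.Empty using (⊥-elim)
open import Function using (id; _∘_; case_of_)
open import Function.Bundles using (_⇔_; mk⇔; Equivalence)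
open import Relation.Nullary using (yes; no; ¬_; Dec; does)
import Relation.Nullary.Decidable as Dec
open import Relation.Nullary.Decidable using (_×-dec_)
open import Relation.Binary.PropositionalEquality
open import Relation.Binary.Construct.Closure.ReflexiveTransitive as Star using (Star; ε; _◅_; _◅◅_)

-- Finite types

-- Every run is proved on a finite zipper that no rule lets the head leave. Its extent then serves
-- twice: it bounds the space, and a perturbation of at least that radius cannot reach the stretch
-- from any position of the head on it.
--
-- In the backward direction the decider has to lay out its own work space. It does not evaluate the
-- polynomial: it repeatedly replaces a length by more than its square, which overtakes any
-- polynomial after a fixed number of rounds, and overshooting only enlarges the radius. A recursive
-- reachability search would need a stack and addresses into it. A rectangular table of quantified
-- cells needs neither: flags on the cells tell which column is under inspection, and everything
-- else fits into the finite control.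
--
-- In the forward direction the only tape symbols are the letters and the blank, so there are no end
-- markers or marked letters. Blocks are wider than letters, so recoding in place would overwrite
-- unread input, whereas the blank tape to the left already reads as a row of blank blocks.

record Finite (A : Set) : Set where
  field
    size    : ℕ
    enc     : A → Fin size
    dec     : Fin size → A
    dec-enc : ∀ a → dec (enc a) ≡ a

open Finite

-- A left inverse of `enc` is all that coding states and the pigeonhole argument ask for, so `size`
-- may overcount and finiteness passes to retracts.
retract : {A B : Set} → Finite B → (f : A → B) (g : B → A) → (∀ a → g (f a) ≡ a) → Finite A
retract F f g gf = record
  { size = size F ; enc = enc F ∘ f ; dec = g ∘ dec F
  ; dec-enc = λ a → trans (cong g (dec-enc F (f a))) (gf a) }

finFin : (n : ℕ) → Finite (Fin n)
finFin n = record { size = n ; enc = id ; dec = id ; dec-enc = λ _ → refl }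

infixr 1 _⊎ᶠ_
infixr 2 _×ᶠ_

_⊎ᶠ_ : {A B : Set} → Finite A → Finite B → Finite (A ⊎ B)
_⊎ᶠ_ {A} {B} F G = retract base f g gf
  where
  base : Finite (Fin (size F) ⊎ Fin (size G))
  base = record
    { size = size F + size G ; enc = join (size F) (size G) ; dec = splitAt (size F)
    ; dec-enc = Finₚ.splitAt-join (size F) (size G) }
  f : A ⊎ B → Fin (size F) ⊎ Fin (size G)
  f (inj₁ a) = inj₁ (enc F a)
  f (inj₂ b) = inj₂ (enc G b)
  g : Fin (size F) ⊎ Fin (size G) → A ⊎ B
  g (inj₁ i) = inj₁ (dec F i)
  g (inj₂ j) = inj₂ (dec G j)
  gf : ∀ x → g (f x) ≡ x
  gf (inj₁ a) = cong inj₁ (dec-enc F a)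
  gf (inj₂ b) = cong inj₂ (dec-enc G b)

_×ᶠ_ : {A B : Set} → Finite A → Finite B → Finite (A × B)
_×ᶠ_ {A} {B} F G = retract base (λ (a , b) → enc F a , enc G b) (λ (i , j) → dec F i , dec G j)
    λ (a , b) → cong₂ _,_ (dec-enc F a) (dec-enc G b)
  where
  base : Finite (Fin (size F) × Fin (size G))
  base = record
    { size = size F * size G ; enc = λ (i , j) → combine i j ; dec = remQuot (size G)
    ; dec-enc = λ (i , j) → Finₚ.remQuot-combine i j }

fin⊤ : Finite ⊤
fin⊤ = record { size = 1 ; enc = λ _ → zero ; dec = λ _ → tt ; dec-enc = λ _ → refl }

finBool : Finite Bool
finBool = retract (fin⊤ ⊎ᶠ fin⊤) f g gf
  where
  f : Bool → ⊤ ⊎ ⊤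
  f true  = inj₁ tt
  f false = inj₂ tt
  g : ⊤ ⊎ ⊤ → Bool
  g (inj₁ _) = true
  g (inj₂ _) = false
  gf : ∀ b → g (f b) ≡ b
  gf true  = refl
  gf false = refl

finMaybe : {A : Set} → Finite A → Finite (Maybe A)
finMaybe {A} F = retract (F ⊎ᶠ fin⊤) f g gf
  where
  f : Maybe A → A ⊎ ⊤
  f (just a) = inj₁ a
  f nothing  = inj₂ tt
  g : A ⊎ ⊤ → Maybe A
  g (inj₁ a) = just a
  g (inj₂ _) = nothing
  gf : ∀ m → g (f m) ≡ m
  gf (just a) = refl
  gf nothing  = refl

finMove : Finite Move
finMove = retract (finMaybe finBool) f g gf
  where
  f : Move → Maybe Bool
  f left  = just true
  f stay  = nothing
  f right = just false
  g : Maybe Bool → Move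
  g (just true)  = left
  g (just false) = right
  g nothing      = stay
  gf : ∀ m → g (f m) ≡ m
  gf left  = refl
  gf stay  = refl
  gf right = refl

-- Machines on finite stretches of tape

-- inj₂ v is the halting state with verdict v.
Rule : Set → Set → Set
Rule Q A = Q → A → Maybe ((Q ⊎ Bool) × A × Move)

-- A finite stretch of tape: the part to the left of the head, nearest cell first, and the
-- rest, starting with the scanned cell.
infix 4 _⦂_∣_
record Zipper (S A : Set) : Set where
  constructor _⦂_∣_
  field
    control : S
    lhs     : List A
    rhs     : List A

extent : {S A : Set} → Zipper S A → ℕ
extent (q ⦂ ls ∣ rs) = length ls + length rs

module Zippers {Q A : Set} (next : Rule Q A) where

  infix 3 _⟶_ _⟶*_
  -- No rule enlarges the stretch: a left move at its left end is undefined, and past its right end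
  -- nothing is scanned. A run that reaches a verdict is therefore also a certificate of
  -- confinement.
  data _⟶_ : Zipper (Q ⊎ Bool) A → Zipper (Q ⊎ Bool) A → Set where
    goL : ∀ {q a q' b l ls rs} → next q a ≡ just (q' , b , left) →
          (inj₁ q ⦂ l ∷ ls ∣ a ∷ rs) ⟶ (q' ⦂ ls ∣ l ∷ b ∷ rs)
    goS : ∀ {q a q' b ls rs} → next q a ≡ just (q' , b , stay) →
          (inj₁ q ⦂ ls ∣ a ∷ rs) ⟶ (q' ⦂ ls ∣ b ∷ rs)
    goR : ∀ {q a q' b ls rs} → next q a ≡ just (q' , b , right) →
          (inj₁ q ⦂ ls ∣ a ∷ rs) ⟶ (q' ⦂ b ∷ ls ∣ rs)

  _⟶*_ : Zipper (Q ⊎ Bool) A → Zipper (Q ⊎ Bool) A → Set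
  _⟶*_ = Star _⟶_

  extent-⟶ : ∀ {z z'} → z ⟶ z' → extent z' ≡ extent z
  extent-⟶ (goL {ls = ls} {rs} _) = ℕₚ.+-suc (length ls) (suc (length rs))
  extent-⟶ (goS _) = refl
  extent-⟶ (goR {ls = ls} {rs} _) = sym (ℕₚ.+-suc (length ls) (length rs))

  -- The head stands on the nearest cell of ls.
  facing : Q ⊎ Bool → List A → List A → Zipper (Q ⊎ Bool) A
  facing q []       rs = q ⦂ [] ∣ rs
  facing q (l ∷ ls) rs = q ⦂ ls ∣ l ∷ rs

  -- The cells on the left are nonempty because of the accumulator `y ∷ ys`, but the nearest one
  -- appears only after `xs` has been consumed. Hence a single move needs a recursion.
  turn-left : ∀ {q a q' b} (xs : List A) {y ys rs} → next q a ≡ just (q' , b , left) →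
              (inj₁ q ⦂ xs ʳ++ (y ∷ ys) ∣ a ∷ rs) ⟶* facing q' (xs ʳ++ (y ∷ ys)) (b ∷ rs)
  turn-left []       n = goL n ◅ ε
  turn-left (x ∷ xs) n = turn-left xs n

  -- A one-way pass of the head acts as a finite transducer with states `S`. Lists run from left to
  -- right throughout, so a left pass meets the last entry first and its state is a right fold.
  module Pass {C S : Set} (e : C → A) (f : S → Q) (τ : S → C → S) (ω : S → C → C) where

    stateR stateL : S → List C → S
    outR   outL   : S → List C → List C
    stateR σ []       = σ
    stateR σ (c ∷ cs) = stateR (τ σ c) cs
    stateL σ []       = σ
    stateL σ (c ∷ cs) = τ (stateL σ cs) c
    outR σ []       = []
    outR σ (c ∷ cs) = ω σ c ∷ outR (τ σ c) cs
    outL σ []       = []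
    outL σ (c ∷ cs) = ω (stateL σ cs) c ∷ outL σ cs

    passR : (∀ σ c → next (f σ) (e c) ≡ just (inj₁ (f (τ σ c)) , e (ω σ c) , right)) → ∀ σ cs {ls rs} →
            (inj₁ (f σ) ⦂ ls ∣ map e cs ++ rs) ⟶* (inj₁ (f (stateR σ cs)) ⦂ map e (outR σ cs) ʳ++ ls ∣ rs)
    passR n σ []       = ε
    passR n σ (c ∷ cs) = goR (n σ c) ◅ passR n (τ σ c) cs

    passL : (∀ σ c → next (f σ) (e c) ≡ just (inj₁ (f (τ σ c)) , e (ω σ c) , left)) → ∀ σ cs {l ls rs} →
            facing (inj₁ (f σ)) (map e cs ʳ++ (l ∷ ls)) rs ⟶*
            facing (inj₁ (f (stateL σ cs))) (l ∷ ls) (map e (outL σ cs) ++ rs)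
    passL n σ []       = ε
    passL n σ (c ∷ cs) = passL n σ cs ◅◅ goL (n (stateL σ cs) c) ◅ ε

  walkR : {C : Set} (e : C → A) {q : Q} → (∀ c → next q (e c) ≡ just (inj₁ q , e c , right)) → ∀ cs {ls rs} →
          (inj₁ q ⦂ ls ∣ map e cs ++ rs) ⟶* (inj₁ q ⦂ map e cs ʳ++ ls ∣ rs)
  walkR e n []       = ε
  walkR e n (c ∷ cs) = goR (n c) ◅ walkR e n cs

  walkL : {C : Set} (e : C → A) {q : Q} → (∀ c → next q (e c) ≡ just (inj₁ q , e c , left)) → ∀ cs {l ls rs} →
          facing (inj₁ q) (map e cs ʳ++ (l ∷ ls)) rs ⟶* facing (inj₁ q) (l ∷ ls) (map e cs ++ rs)
  walkL e n []       = ε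
  walkL e n (c ∷ cs) = walkL e n cs ◅◅ goL (n c) ◅ ε

  infixr 5 _◂_
  infixl 6 _▸_
  _▸_ : ∀ {z z' z''} → z ⟶* z' → z' ≡ z'' → z ⟶* z''
  run ▸ refl = run
  _◂_ : ∀ {z z' z''} → z ≡ z' → z' ⟶* z'' → z ⟶* z''
  refl ◂ run = run

  first-left : ∀ {C : Set} (e : C → A) {q a q' b} → next q a ≡ just (q' , b , left) → ∀ ys {l ls rs} →
               (inj₁ q ⦂ map e ys ++ l ∷ ls ∣ a ∷ rs) ⟶ facing q' (map e ys ++ l ∷ ls) (b ∷ rs)
  first-left e n []       = goL n
  first-left e n (y ∷ ys) = goL n

  -- Here cs is listed from right to left.
  sweepR : {C : Set} (e : C → A) {q : Q} → (∀ c → next q (e c) ≡ just (inj₁ q , e c , right)) → ∀ cs {ls rs} →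
           (inj₁ q ⦂ ls ∣ map e cs ʳ++ rs) ⟶* (inj₁ q ⦂ map e cs ++ ls ∣ rs)
  sweepR e n []       = ε
  sweepR e n (c ∷ cs) = sweepR e n cs ◅◅ goR (n c) ◅ ε

  sweepL : {C : Set} (e : C → A) {q : Q} → (∀ c → next q (e c) ≡ just (inj₁ q , e c , left)) → ∀ cs {l ls rs} →
           facing (inj₁ q) (map e cs ++ l ∷ ls) rs ⟶* facing (inj₁ q) (l ∷ ls) (map e cs ʳ++ rs)
  sweepL e n []       = ε
  sweepL e n (c ∷ cs) = first-left e (n c) cs ◅ sweepL e n cs

write-same : ∀ {Γ : Set} (t : ℤ → Γ) h b → write t h b h ≡ b
write-same t h b with h ℤ.≟ h
... | yes _  = refl
... | no h≢h = ⊥-elim (h≢h refl)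

write-other : ∀ {Γ : Set} (t : ℤ → Γ) h b {i} → i ≢ h → write t h b i ≡ t i
write-other t h b {i} i≢h with i ℤ.≟ h
... | yes e = ⊥-elim (i≢h e)
... | no _  = refl

h+i-h : ∀ h i → (h ℤ.+ i) ℤ.- h ≡ i
h+i-h h i = trans (cong (ℤ._- h) (ℤₚ.+-comm h i))
  (trans (ℤₚ.+-assoc i h (ℤ.- h)) (trans (cong (λ k → i ℤ.+ k) (ℤₚ.+-inverseʳ h)) (ℤₚ.+-identityʳ i)))

Step-deterministic : {Γ : Set} {M : TM Γ} {c c₁ c₂ : Config M} → Step M c c₁ → Step M c c₂ → c₁ ≡ c₂
Step-deterministic (step e₁) (step e₂) with refl ← trans (sym e₁) e₂ = refl

module Tapes {A Γ : Set} (encA : A → Γ) where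

  RepR RepL : (ℤ → Γ) → ℤ → List A → Set
  RepR t h []       = ⊤
  RepR t h (a ∷ rs) = t h ≡ encA a × RepR t (h ℤ.+ + 1) rs
  RepL t h []       = ⊤
  RepL t h (a ∷ ls) = t (h ℤ.+ -[1+ 0 ]) ≡ encA a × RepL t (h ℤ.+ -[1+ 0 ]) ls

  h<h+1 : ∀ h → h ℤ.< h ℤ.+ + 1
  h<h+1 h = subst (ℤ._< h ℤ.+ + 1) (ℤₚ.+-identityʳ h) (ℤₚ.+-monoʳ-< h (ℤ.+<+ (s≤s z≤n)))

  h-1<h : ∀ h → h ℤ.+ -[1+ 0 ] ℤ.< h
  h-1<h h = subst (h ℤ.+ -[1+ 0 ] ℤ.<_) (ℤₚ.+-identityʳ h) (ℤₚ.+-monoʳ-< h ℤ.-<+)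

  h-1+1 : ∀ h → (h ℤ.+ -[1+ 0 ]) ℤ.+ + 1 ≡ h
  h-1+1 h = trans (ℤₚ.+-assoc h -[1+ 0 ] (+ 1)) (ℤₚ.+-identityʳ h)

  h+1-1 : ∀ h → (h ℤ.+ + 1) ℤ.+ -[1+ 0 ] ≡ h
  h+1-1 h = trans (ℤₚ.+-assoc h (+ 1) -[1+ 0 ]) (ℤₚ.+-identityʳ h)

  RepR-write : ∀ t {h b} h' rs → h ℤ.< h' → RepR t h' rs → RepR (write t h b) h' rs
  RepR-write t h' []       lt r       = tt
  RepR-write t {h} {b} h' (a ∷ rs) lt (e , r) =
    trans (write-other t h b (λ e → ℤₚ.<-irrefl (sym e) lt)) e ,
    RepR-write t (h' ℤ.+ + 1) rs (ℤₚ.<-trans lt (h<h+1 h')) r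

  RepL-write : ∀ t {h b} h' ls → h' ℤ.≤ h → RepL t h' ls → RepL (write t h b) h' ls
  RepL-write t h' []       le r       = tt
  RepL-write t {h} {b} h' (a ∷ ls) le (e , r) =
    trans (write-other t h b (λ e → ℤₚ.<-irrefl e lt)) e ,
    RepL-write t (h' ℤ.+ -[1+ 0 ]) ls (ℤₚ.<⇒≤ lt) r
    where lt = ℤₚ.<-≤-trans (h-1<h h') le

  moved-left : ∀ t h {a b l ls rs} → RepL t h (l ∷ ls) → RepR t h (a ∷ rs) →
               RepL (write t h (encA b)) (h ℤ.+ -[1+ 0 ]) ls × RepR (write t h (encA b)) (h ℤ.+ -[1+ 0 ]) (l ∷ b ∷ rs)
  moved-left t h {ls = ls} {rs} (e , l) (_ , r) =
    RepL-write t _ ls (ℤₚ.<⇒≤ (h-1<h h)) l ,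
    trans (write-other t h _ (λ q → ℤₚ.<-irrefl q (h-1<h h))) e ,
    subst (λ i → write t h _ i ≡ _) (sym (h-1+1 h)) (write-same t h _) ,
    subst (λ i → RepR (write t h _) (i ℤ.+ + 1) rs) (sym (h-1+1 h)) (RepR-write t _ rs (h<h+1 h) r)

  moved-stay : ∀ t h {a b ls rs} → RepL t h ls → RepR t h (a ∷ rs) →
               RepL (write t h (encA b)) (h ℤ.+ + 0) ls × RepR (write t h (encA b)) (h ℤ.+ + 0) (b ∷ rs)
  moved-stay t h {ls = ls} {rs} l (_ , r) =
    subst (λ i → RepL (write t h _) i ls) (sym (ℤₚ.+-identityʳ h)) (RepL-write t h ls ℤₚ.≤-refl l) ,
    subst (λ i → RepR (write t h _) i (_ ∷ rs)) (sym (ℤₚ.+-identityʳ h))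
      (write-same t h _ , RepR-write t _ rs (h<h+1 h) r)

  moved-right : ∀ t h {a b ls rs} → RepL t h ls → RepR t h (a ∷ rs) →
                RepL (write t h (encA b)) (h ℤ.+ + 1) (b ∷ ls) × RepR (write t h (encA b)) (h ℤ.+ + 1) rs
  moved-right t h {ls = ls} {rs} l (_ , r) =
    (subst (λ i → write t h _ i ≡ _) (sym (h+1-1 h)) (write-same t h _) ,
     subst (λ i → RepL (write t h _) i ls) (sym (h+1-1 h)) (RepL-write t h ls ℤₚ.≤-refl l)) ,
    RepR-write t _ rs (h<h+1 h) r

  ⊖-suc : ∀ m n → suc m ⊖ n ≡ (m ⊖ n) ℤ.+ + 1
  ⊖-suc m n = trans (cong (_⊖ n) (ℕₚ.+-comm 1 m)) (sym (ℤₚ.distribˡ-⊖-+-pos 1 m n))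

  ⊖-pred : ∀ m n → m ⊖ n ≡ (suc m ⊖ n) ℤ.+ -[1+ 0 ]
  ⊖-pred m n = sym (trans (cong (ℤ._+ -[1+ 0 ]) (⊖-suc m n)) (h+1-1 (m ⊖ n)))

  +-assoc-suc : ∀ h j → (h ℤ.+ + j) ℤ.+ + 1 ≡ h ℤ.+ + suc j
  +-assoc-suc h j = trans (ℤₚ.+-assoc h (+ j) (+ 1)) (cong (λ k → h ℤ.+ + k) (ℕₚ.+-comm j 1))

  +-assoc-pred : ∀ h j → (h ℤ.+ (ℤ.- + j)) ℤ.+ -[1+ 0 ] ≡ h ℤ.+ (ℤ.- + suc j)
  +-assoc-pred h j = trans (ℤₚ.+-assoc h _ -[1+ 0 ]) (cong (λ k → h ℤ.+ k)
    (trans (sym (ℤₚ.neg-distrib-+ (+ j) (+ 1))) (cong (λ k → ℤ.- + k) (ℕₚ.+-comm j 1))))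

  module _ {n : ℕ} {t t' : ℤ → Γ} {h : ℤ} (agree : ∀ i → ∣ i ℤ.- h ∣ ≤ n → t' i ≡ t i) where

    RepR-agree : ∀ j rs → j + length rs ≤ n → RepR t (h ℤ.+ + j) rs → RepR t' (h ℤ.+ + j) rs
    RepR-agree j []       le r       = tt
    RepR-agree j (a ∷ rs) le (e , r) =
      trans (agree _ (subst (λ i → ∣ i ∣ ≤ n) (sym (h+i-h h (+ j))) (ℕₚ.≤-trans (ℕₚ.m≤m+n j _) le))) e ,
      subst (λ i → RepR t' i rs) (sym (+-assoc-suc h j))
        (RepR-agree (suc j) rs (subst (_≤ n) (ℕₚ.+-suc j (length rs)) le)
          (subst (λ i → RepR t i rs) (+-assoc-suc h j) r))

    RepL-agree : ∀ j ls → j + length ls ≤ n → RepL t (h ℤ.+ (ℤ.- + j)) ls → RepL t' (h ℤ.+ (ℤ.- + j)) ls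
    RepL-agree j []       le r       = tt
    RepL-agree j (a ∷ ls) le (e , r) =
      trans (agree _ (subst (λ i → ∣ i ∣ ≤ n) (sym (trans (cong (ℤ._- h) (+-assoc-pred h j)) (h+i-h h (ℤ.- + suc j))))
        (ℕₚ.≤-trans (s≤s (ℕₚ.m≤m+n j _)) le'))) e ,
      subst (λ i → RepL t' i ls) (sym (+-assoc-pred h j))
        (RepL-agree (suc j) ls le' (subst (λ i → RepL t i ls) (+-assoc-pred h j) r))
      where le' = subst (_≤ n) (ℕₚ.+-suc j (length ls)) le

  RepR-nth : ∀ {t} j rs → (∀ i {a} → nth rs i ≡ just a → t (+ (j + i)) ≡ encA a) → RepR t (+ j) rs
  RepR-nth j []       h = tt
  RepR-nth {t} j (a ∷ rs) h =
    trans (cong (λ i → t (+ i)) (sym (ℕₚ.+-identityʳ j))) (h 0 refl) ,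
    subst (λ i → RepR t (+ i) rs) (ℕₚ.+-comm 1 j)
      (RepR-nth (suc j) rs (λ i e → trans (cong (λ k → t (+ k)) (sym (ℕₚ.+-suc j i))) (h (suc i) e)))

  module _ {B : Set} (b : A) (e : B → A) (w : List B) where

    initTape-nth : ∀ w n i {a} → nth (map e w ++ replicate n b) i ≡ just a →
                   initTape (encA b) (encA ∘ e) w (+ i) ≡ encA a
    initTape-nth []      (suc n) zero    refl = refl
    initTape-nth []      (suc n) (suc i) p    = initTape-nth [] n i p
    initTape-nth (x ∷ w) n       zero    refl = refl
    initTape-nth (x ∷ w) n       (suc i) p    = initTape-nth w n i p

    initTape-RepR : ∀ n → RepR (initTape (encA b) (encA ∘ e) w) (+ 0) (map e w ++ replicate n b)
    initTape-RepR n = RepR-nth 0 _ (initTape-nth w n)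

    initTape-RepL : ∀ j n → RepL (initTape (encA b) (encA ∘ e) w) (ℤ.- + j) (replicate n b)
    initTape-RepL j zero    = tt
    initTape-RepL j (suc n) = subst (λ i → initTape (encA b) (encA ∘ e) w i ≡ encA b) (sym eq) refl ,
      subst (λ i → RepL (initTape (encA b) (encA ∘ e) w) i (replicate n b)) (sym eq) (initTape-RepL (suc j) n)
      where
      eq : (ℤ.- + j) ℤ.+ -[1+ 0 ] ≡ -[1+ j ]
      eq = trans (sym (ℤₚ.neg-distrib-+ (+ j) (+ 1))) (cong (λ k → ℤ.- + k) (ℕₚ.+-comm j 1))

-- From rules to Turing machines, and their immunity to distant perturbations

module Compile {Q A Γ : Set} (finQ : Finite Q) (next : Rule Q A) (start : Q)
               (encA : A → Γ) (decA : Γ → A) (dec-encA : ∀ a → decA (encA a) ≡ a) where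

  open Zippers next
  open Tapes encA public

  finS : Finite (Q ⊎ Bool)
  finS = finQ ⊎ᶠ finBool

  accepting rejecting : Q ⊎ Bool → Bool
  accepting (inj₁ _) = false
  accepting (inj₂ v) = v
  rejecting (inj₁ _) = false
  rejecting (inj₂ v) = not v

  emit : (Q ⊎ Bool) × A × Move → Fin (size finS) × Γ × Move
  emit (q , b , m) = enc finS q , encA b , m

  -- Verdict states have no transition. This makes the closure conditions of `TM` vacuous and lets
  -- no run continue past a verdict.
  trans-δ : Q ⊎ Bool → A → Maybe (Fin (size finS) × Γ × Move)
  trans-δ (inj₁ q) a = Maybe.map emit (next q a)
  trans-δ (inj₂ _) a = nothing

  machine : TM Γ
  machine = record
    { nQ = size finS ; q₀ = enc finS (inj₁ start)
    ; isF = accepting ∘ dec finS ; isR = rejecting ∘ dec finS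
    ; disjoint = λ q → disj (dec finS q)
    ; δ = λ q γ → trans-δ (dec finS q) (decA γ)
    ; closedF = λ q a q' b m → closed accepting (dec finS q) (λ _ → refl) {decA a}
    ; closedR = λ q a q' b m → closed rejecting (dec finS q) (λ _ → refl) {decA a} }
    where
    disj : ∀ q → accepting q ≡ true → rejecting q ≡ false
    disj (inj₂ true) _ = refl
    closed : ∀ (f : Q ⊎ Bool → Bool) q → (∀ q → f (inj₁ q) ≡ false) → ∀ {a q' b m} →
             trans-δ q a ≡ just (q' , b , m) → f q ≡ true → f (dec finS q') ≡ true
    closed f (inj₁ q) e _ p with () ← trans (sym p) (e q)

  -- The left end of the stretch lies at the integer `- o`. Recording this ties the head position to
  -- the zipper, from which `bounded` reads off the space.
  record Rep (o : ℕ) (z : Zipper (Q ⊎ Bool) A) (c : Config machine) : Set where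
    constructor rep
    field
      ctl : state c ≡ enc finS (Zipper.control z)
      pos : head c ≡ length (Zipper.lhs z) ⊖ o
      onL : RepL (tape c) (head c) (Zipper.lhs z)
      onR : RepR (tape c) (head c) (Zipper.rhs z)

  open Rep

  step-δ : ∀ {c o q a b q' m ls rs} → Rep o (inj₁ q ⦂ ls ∣ a ∷ rs) c →
           next q a ≡ just (q' , b , m) → δ machine (state c) (tape c (head c)) ≡ just (emit (q' , b , m))
  step-δ {q = q} {a} (rep refl _ _ (e , _)) n =
    trans (cong₂ trans-δ (dec-enc finS (inj₁ q)) (trans (cong decA e) (dec-encA a)))
          (cong (Maybe.map emit) n)

  Rep-step : ∀ {o z z' c} → Rep o z c → z ⟶ z' → ∃ λ c' → Step machine c c' × Rep o z' c'
  Rep-step {o} {c = ⟨ _ , t , h ⟩} R@(rep refl p l r) (goL {ls = ls} n) =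
    let (l′ , r′) = moved-left t h l r in
    _ , step (step-δ R n) , rep refl (trans (cong (ℤ._+ -[1+ 0 ]) p) (sym (⊖-pred (length ls) o))) l′ r′
  Rep-step {o} {c = ⟨ _ , t , h ⟩} R@(rep refl p l r) (goS n) =
    let (l′ , r′) = moved-stay t h l r in
    _ , step (step-δ R n) , rep refl (trans (ℤₚ.+-identityʳ h) p) l′ r′
  Rep-step {o} {c = ⟨ _ , t , h ⟩} R@(rep refl p l r) (goR {ls = ls} n) =
    let (l′ , r′) = moved-right t h l r in
    _ , step (step-δ R n) , rep refl (trans (cong (ℤ._+ + 1) p) (sym (⊖-suc (length ls) o))) l′ r′

  halted : ∀ {o v ls rs c c'} → Rep o (inj₂ v ⦂ ls ∣ rs) c → ¬ Step machine c c'
  halted {v = v} (rep refl _ _ _) (step {t = t} {h} e)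
    with () ← trans (sym (cong (λ q → trans-δ q (decA (t h))) (dec-enc finS (inj₂ v)))) e

  -- The head is on the stretch, so each of its cells is at distance at most the extent and escapes
  -- the perturbation.
  Rep-agree : ∀ {o z q t t' h n} → Rep o z ⟨ q , t , h ⟩ → extent z ≤ n →
              (∀ i → ∣ i ℤ.- h ∣ ≤ n → t' i ≡ t i) → Rep o z ⟨ q , t' , h ⟩
  Rep-agree {z = _ ⦂ ls ∣ rs} {t = t} {t'} {h} (rep c p l r) le agree = rep c p
    (subst (λ i → RepL t' i ls) (ℤₚ.+-identityʳ h)
      (RepL-agree {t = t} agree 0 ls (ℕₚ.≤-trans (ℕₚ.m≤m+n (length ls) _) le)
        (subst (λ i → RepL t i ls) (sym (ℤₚ.+-identityʳ h)) l)))
    (subst (λ i → RepR t' i rs) (ℤₚ.+-identityʳ h)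
      (RepR-agree {t = t} agree 0 rs (ℕₚ.≤-trans (ℕₚ.m≤n+m (length rs) (length ls)) le)
        (subst (λ i → RepR t i rs) (sym (ℤₚ.+-identityʳ h)) r)))

  Rep-start : ∀ {ls rs t} → RepL t (+ 0) ls → RepR t (+ 0) rs →
              Rep (length ls) (inj₁ start ⦂ ls ∣ rs) ⟨ q₀ machine , t , + 0 ⟩
  Rep-start {ls} l r = rep refl (sym (ℤₚ.n⊖n≡0 (length ls))) l r

  module Outcome {o z v ls rs} (run : z ⟶* (inj₂ v ⦂ ls ∣ rs)) {c : Config machine} (R : Rep o z c) where

    reaches : ∃ λ c' → Star (Step machine) c c' × isF machine (state c') ≡ v × isR machine (state c') ≡ not v
    reaches = go run R
      where
      go : ∀ {z c} → z ⟶* (inj₂ v ⦂ ls ∣ rs) → Rep o z c →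
           ∃ λ c' → Star (Step machine) c c' × isF machine (state c') ≡ v × isR machine (state c') ≡ not v
      go ε (rep refl _ _ _) = _ , ε , cong accepting (dec-enc finS (inj₂ v)) , cong rejecting (dec-enc finS (inj₂ v))
      go (s ◅ run) R with c₁ , st , R₁ ← Rep-step R s with c' , sts , p ← go run R₁ = c' , st ◅ sts , p

    -- The perturbed tape still represents the same zipper, and the step on it is deterministic. By
    -- induction a perturbed run can only follow the given zipper run, and it cannot go on after the
    -- verdict.
    tracked : ∀ {n} → extent z ≤ n → ∀ {c'} → Star (PStep machine n) c c' →
              ∃ λ z' → Rep o z' c' × z' ⟶* (inj₂ v ⦂ ls ∣ rs) × extent z' ≡ extent z
    tracked = go run R
      where
      go : ∀ {z c n} → z ⟶* (inj₂ v ⦂ ls ∣ rs) → Rep o z c → extent z ≤ n → ∀ {c'} → Star (PStep machine n) c c' →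
           ∃ λ z' → Rep o z' c' × z' ⟶* (inj₂ v ⦂ ls ∣ rs) × extent z' ≡ extent z
      go run R le ε = _ , R , run , refl
      go ε R le (pstep agree st ◅ _) = ⊥-elim (halted (Rep-agree R le agree) st)
      go {n = n} (s ◅ run) R le (pstep agree st ◅ sts)
        with c₁ , st₁ , R₁ ← Rep-step (Rep-agree R le agree) s
        with refl ← Step-deterministic st st₁
        with z' , R' , run' , e ← go run R₁ (subst (_≤ n) (sym (extent-⟶ s)) le) sts
        = z' , R' , run' , trans e (extent-⟶ s)

    -- Controls of the form `inj₁ _` are not accepting, so a tracked configuration that accepts must
    -- be the end of the zipper run.
    accepts⇒ : ∀ {n} → extent z ≤ n → ∀ {c'} → Star (PStep machine n) c c' →
               isF machine (state c') ≡ true → v ≡ true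
    accepts⇒ le sts acc with z' , rep e _ _ _ , run' , _ ← tracked le sts = go run' (trans (sym decoded) acc)
      where
      decoded = trans (cong (accepting ∘ dec finS) e) (cong accepting (dec-enc finS (Zipper.control z')))
      go : ∀ {z'} → z' ⟶* (inj₂ v ⦂ ls ∣ rs) → accepting (Zipper.control z') ≡ true → v ≡ true
      go ε       e = e
      go (goL _ ◅ _) ()
      go (goS _ ◅ _) ()
      go (goR _ ◅ _) ()

    bounded : o ≤ extent z → ∀ {c'} → Star (PStep machine (extent z)) c c' → ∣ head c' ∣ ≤ extent z
    bounded o≤ sts with (_ ⦂ ls' ∣ rs') , rep _ refl _ _ , _ , e ← tracked ℕₚ.≤-refl sts =
      ℕₚ.≤-trans (ℤₚ.∣m⊝n∣≤m⊔n (length ls') o)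
        (ℕₚ.⊔-lub (subst (length ls' ≤_) e (ℕₚ.m≤m+n (length ls') (length rs'))) o≤)

Step⇒PStep : {Γ : Set} {M : TM Γ} {n : ℕ} {c c' : Config M} → Step M c c' → PStep M n c c'
Step⇒PStep st@(step _) = pstep (λ _ _ → refl) st

-- Paths in finite graphs

finVec : {A : Set} → Finite A → (n : ℕ) → Finite (Vec A n)
finVec F zero    = retract fin⊤ (λ _ → tt) (λ _ → []) λ { [] → refl }
finVec F (suc n) = retract (F ×ᶠ finVec F n) (λ { (x ∷ xs) → x , xs }) (λ (x , xs) → x ∷ xs) λ { (x ∷ xs) → refl }

size-finVec : {A : Set} (F : Finite A) (n : ℕ) → size (finVec F n) ≡ size F ^ n
size-finVec F zero    = refl
size-finVec F (suc n) = cong (size F *_) (size-finVec F n)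

enc-injective : {A : Set} (F : Finite A) {x y : A} → enc F x ≡ enc F y → x ≡ y
enc-injective F {x} {y} e = trans (sym (dec-enc F x)) (trans (cong (dec F) e) (dec-enc F y))

data Path {X : Set} (E : X → X → Set) : ℕ → X → X → Set where
  []  : ∀ {x} → Path E 0 x x
  _∷_ : ∀ {n x y z} → E x y → Path E n y z → Path E (suc n) x z

module _ {X : Set} {E : X → X → Set} where

  concat : ∀ {m n x y z} → Path E m x y → Path E n y z → Path E (m + n) x z
  concat []      q = q
  concat (e ∷ p) q = e ∷ concat p q

  split : ∀ m {n x z} → Path E (m + n) x z → ∃ λ y → Path E m x y × Path E n y z
  split zero    p       = _ , [] , p
  split (suc m) (e ∷ p) with y , p₁ , p₂ ← split m p = y , e ∷ p₁ , p₂

  vertex : ∀ {n x z} → Path E n x z → Fin (suc n) → X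
  vertex {x = x} p       zero    = x
  vertex         (e ∷ p) (suc i) = vertex p i

  upto : ∀ {n x z} (p : Path E n x z) i → Path E (toℕ i) x (vertex p i)
  upto p       zero    = []
  upto (e ∷ p) (suc i) = e ∷ upto p i

  onward : ∀ {n x z} (p : Path E n x z) i → Path E (n ∸ toℕ i) (vertex p i) z
  onward p       zero    = p
  onward (e ∷ p) (suc i) = onward p i

  idle : ∀ {x} n → E x x → Path E n x x
  idle zero    e = []
  idle (suc n) e = e ∷ idle n e

  -- The doubling formula speaks of lengths that are exactly powers of two; a loop at the target
  -- absorbs the difference.
  prolong : ∀ {m n x z} → m ≤ n → E z z → Path E m x z → Path E n x z
  prolong {m} {n} {x} {z} le e p = subst (λ k → Path E k x z) (ℕₚ.m+[n∸m]≡n le) (concat p (idle (n ∸ m) e))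

  -- A path with at least `size F` edges visits more vertices than there are codes. Two of them
  -- coincide, and cutting out the part between gives a shorter path for the induction.
  shorten : (F : Finite X) → ∀ n {x z} → Path E n x z → ∃ λ m → Path E m x z × m < size F
  shorten F = <-rec (λ n → ∀ {x z} → Path E n x z → ∃ λ m → Path E m x z × m < size F) go
    where
    go : ∀ n → (∀ {k} → k < n → ∀ {x z} → Path E k x z → ∃ λ m → Path E m x z × m < size F) →
         ∀ {x z} → Path E n x z → ∃ λ m → Path E m x z × m < size F
    go n rec {x} {z} p with n ℕ.<? size F
    ... | yes lt = n , p , lt
    ... | no n≮
      with i , j , i<j , e ← Finₚ.pigeonhole (s≤s (ℕₚ.≮⇒≥ n≮)) (λ i → enc F (vertex p i))
      = rec lt (concat (upto p i) (subst (λ v → Path E (n ∸ toℕ j) v z) (sym (enc-injective F e)) (onward p j)))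
      where
      lt : toℕ i + (n ∸ toℕ j) < n
      lt = ℕₚ.<-≤-trans (ℕₚ.+-monoˡ-< (n ∸ toℕ j) i<j) (ℕₚ.≤-reflexive (ℕₚ.m+[n∸m]≡n (Finₚ.toℕ≤pred[n] j)))

-- Evaluation of a quantified formula on a tape

module Columns {P V : Set} (stepP : P → V → V → P) (out : P → Bool) where

  runP : P → (n : ℕ) → (Fin n → V) → (Fin n → V) → P
  runP p zero    x y = p
  runP p (suc n) x y = runP (stepP p (x zero) (y zero)) n (x ∘ suc) (y ∘ suc)

  runP-cong : ∀ p n {x y x' y' : Fin n → V} → (∀ i → (x i , y i) ≡ (x' i , y' i)) → runP p n x y ≡ runP p n x' y'
  runP-cong p zero    e = refl
  runP-cong p (suc n) e = trans (cong (λ (a , b) → runP (stepP p a b) n _ _) (e zero)) (runP-cong _ n (λ i → e (suc i)))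

  Edge : P → (n : ℕ) → Vec V n → Vec V n → Set
  Edge p n X Y = out (runP p n (lookup X) (lookup Y)) ≡ true

module Search (s k c d : ℕ) {P : Set} (finP : Finite P) (p₀ : P)
              (stepP : P → Fin (suc d) → Fin (suc d) → P) (out : P → Bool)
              (ini : Sym s → Fin (suc d)) (goal : Fin (suc d)) where

  open Columns stepP out

  V : Set
  V = Fin (suc d)

  top : V
  top = fromℕ d

  -- A symbol together with part of a unary budget. Each row after the first costs one ticket, so
  -- `n` cells with `c` tickets each pay for a table of `1 + n * c` rows.
  Ticket : Set
  Ticket = Sym s × Fin (suc c)

  -- The flags mark the cells not yet visited by the current loop.
  data Cell : Set where
    raw  : Fin s → Cell
    blk  : Ticket → Bool → Cell
    var  : V → Bool → Cell
    csep : Cell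
    qsep : V → Cell

  Counter : Set
  Counter = Fin (suc k)

  -- A round of relab … rew appends to n cells, used as unary counters, a table of 1 + n c rows of
  -- n + 1 cells: inner counts the cells of a row, outer the rows.  All rounds but the last only
  -- serve to reach the required width.
  data Q : Set where
    relab : Counter → Q
    turn  : Bool → Counter → Q
    inner : Counter → Bool → Q
    appV  : Counter → Q
    outer : Counter → Bool → Q
    rew   : Counter → Q
    scan₀ : P → Maybe V → Q
    scan  : P → V × V → Maybe V → Q
    done  : P → Q
    back  : P → Q
    odo   : Bool → Bool → Q

  abstract
    finCell : Finite Cell
    finCell = retract (finFin s ⊎ᶠ ((finMaybe (finFin s) ×ᶠ finFin (suc c)) ×ᶠ finBool) ⊎ᶠ
                       (finFin (suc d) ×ᶠ finBool) ⊎ᶠ fin⊤ ⊎ᶠ finFin (suc d)) f g gf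
      where
      Code : Set
      Code = Fin s ⊎ (Ticket × Bool) ⊎ (V × Bool) ⊎ ⊤ ⊎ V
      f : Cell → Code
      f (raw a)   = inj₁ a
      f (blk t b) = inj₂ (inj₁ (t , b))
      f (var v b) = inj₂ (inj₂ (inj₁ (v , b)))
      f csep      = inj₂ (inj₂ (inj₂ (inj₁ tt)))
      f (qsep v)  = inj₂ (inj₂ (inj₂ (inj₂ v)))
      g : Code → Cell
      g (inj₁ a)                      = raw a
      g (inj₂ (inj₁ (t , b)))         = blk t b
      g (inj₂ (inj₂ (inj₁ (v , b))))  = var v b
      g (inj₂ (inj₂ (inj₂ (inj₁ _)))) = csep
      g (inj₂ (inj₂ (inj₂ (inj₂ v)))) = qsep v
      gf : ∀ x → g (f x) ≡ x
      gf (raw a)   = refl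
      gf (blk t b) = refl
      gf (var v b) = refl
      gf csep      = refl
      gf (qsep v)  = refl

  abstract
    finQ : Finite Q
    finQ = retract (((C ⊎ᶠ (finBool ×ᶠ C) ⊎ᶠ (C ×ᶠ finBool)) ⊎ᶠ C ⊎ᶠ (C ×ᶠ finBool) ⊎ᶠ C) ⊎ᶠ
                    (finP ×ᶠ finMaybe W) ⊎ᶠ (finP ×ᶠ (W ×ᶠ W) ×ᶠ finMaybe W) ⊎ᶠ finP ⊎ᶠ finP ⊎ᶠ
                    (finBool ×ᶠ finBool)) f g gf
      where
      C : Finite Counter
      C = finFin (suc k)
      W : Finite V
      W = finFin (suc d)
      Code : Set
      Code = ((Counter ⊎ (Bool × Counter) ⊎ (Counter × Bool)) ⊎ Counter ⊎ (Counter × Bool) ⊎ Counter) ⊎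
             (P × Maybe V) ⊎ (P × (V × V) × Maybe V) ⊎ P ⊎ P ⊎ (Bool × Bool)
      f : Q → Code
      f (relab j)     = inj₁ (inj₁ (inj₁ j))
      f (turn b j)    = inj₁ (inj₁ (inj₂ (inj₁ (b , j))))
      f (inner j b)   = inj₁ (inj₁ (inj₂ (inj₂ (j , b))))
      f (appV j)      = inj₁ (inj₂ (inj₁ j))
      f (outer j b)   = inj₁ (inj₂ (inj₂ (inj₁ (j , b))))
      f (rew j)       = inj₁ (inj₂ (inj₂ (inj₂ j)))
      f (scan₀ p m)   = inj₂ (inj₁ (p , m))
      f (scan p xy m) = inj₂ (inj₂ (inj₁ (p , xy , m)))
      f (done p)      = inj₂ (inj₂ (inj₂ (inj₁ p)))
      f (back p)      = inj₂ (inj₂ (inj₂ (inj₂ (inj₁ p))))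
      f (odo v b)     = inj₂ (inj₂ (inj₂ (inj₂ (inj₂ (v , b)))))
      g : Code → Q
      g (inj₁ (inj₁ (inj₁ j)))                         = relab j
      g (inj₁ (inj₁ (inj₂ (inj₁ (b , j)))))            = turn b j
      g (inj₁ (inj₁ (inj₂ (inj₂ (j , b)))))            = inner j b
      g (inj₁ (inj₂ (inj₁ j)))                         = appV j
      g (inj₁ (inj₂ (inj₂ (inj₁ (j , b)))))            = outer j b
      g (inj₁ (inj₂ (inj₂ (inj₂ j))))                  = rew j
      g (inj₂ (inj₁ (p , m)))                          = scan₀ p m
      g (inj₂ (inj₂ (inj₁ (p , xy , m))))              = scan p xy m
      g (inj₂ (inj₂ (inj₂ (inj₁ p))))                  = done p
      g (inj₂ (inj₂ (inj₂ (inj₂ (inj₁ p)))))           = back p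
      g (inj₂ (inj₂ (inj₂ (inj₂ (inj₂ (v , b))))))     = odo v b
      gf : ∀ x → g (f x) ≡ x
      gf (relab j)     = refl
      gf (turn b j)    = refl
      gf (inner j b)   = refl
      gf (appV j)      = refl
      gf (outer j b)   = refl
      gf (rew j)       = refl
      gf (scan₀ p m)   = refl
      gf (scan p xy m) = refl
      gf (done p)      = refl
      gf (back p)      = refl
      gf (odo v b)     = refl

  -- Cells of an earlier table count as blanks, so relabelling them pads the input with blanks while
  -- the width grows.
  symOf : Cell → Sym s
  symOf (raw a)         = just a
  symOf (blk (x , _) _) = x
  symOf _               = nothing

  relabel : Cell → Cell
  relabel x = blk (symOf x , fromℕ c) true

  inner-τ : Bool → Cell → Bool
  inner-τ false (blk _ true) = true
  inner-τ b     _            = b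

  inner-ω : Bool → Cell → Cell
  inner-ω false (blk t true) = blk t false
  inner-ω _     x            = x

  outer-τ : Bool → Cell → Bool
  outer-τ false (blk (_ , suc o) _) = true
  outer-τ b     _                   = b

  outer-ω : Bool → Cell → Cell
  outer-ω false (blk (x , suc o) _) = blk (x , inject₁ o) true
  outer-ω b     (blk t _)           = blk t true
  outer-ω b     x                   = x

  -- For bit `zero` the midpoint replaces the source, which leaves the second half of the path;
  -- otherwise it replaces the target. A bit is a value of `V` tested only for being `zero`, so the
  -- odometer can count through both kinds of quantified cell alike.
  upd : V → V → V × V → V × V
  upd zero    m (x , y) = m , y
  upd (suc _) m (x , y) = x , m

  -- The wrap from `zero` to `top` makes one write serve both purposes: advancing a cell, and
  -- resetting an exhausted one while the carry moves on.
  lower : V → V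
  lower zero    = top
  lower (suc v) = inject₁ v

  -- odo v b: v is the value of the formula to the right of the head, unless b holds, in which
  -- case the assignment has already been advanced.  An ∃-cell is advanced when v is false and
  -- a ∀-cell when v is true.
  odo-τ : Bool → Bool → Cell → Bool
  odo-τ false false (var (suc _) _) = true
  odo-τ true  false (qsep (suc _))  = true
  odo-τ _     b     _               = b

  odo-ω : Bool → Bool → Cell → Cell
  odo-ω _     _     (blk t _)  = blk t true
  odo-ω _     true  (var v _)  = var v true
  odo-ω false false (var v _)  = var (lower v) true
  odo-ω true  false (var v _)  = var top true
  odo-ω true  false (qsep v)   = qsep (lower v)
  odo-ω false false (qsep v)   = qsep top
  odo-ω _     _     x          = x

  afterRewind : Counter → Q
  afterRewind zero    = scan₀ p₀ nothing
  afterRewind (suc j) = relab (inject₁ j)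

  A : Set
  A = Maybe Cell

  next : Rule Q A
  next (relab j)   (just x) = just (inj₁ (relab j) , just (relabel x) , right)
  next (relab j)   nothing  = just (inj₁ (turn true j) , just csep , right)
  next (turn b j)  (just x) = nothing
  next (turn b j)  nothing  = just (inj₁ (if b then inner j false else rew j) , nothing , left)
  next (inner j b) (just x) = just (inj₁ (inner j (inner-τ b x)) , just (inner-ω b x) , left)
  next (inner j b) nothing  = just (inj₁ (if b then appV j else outer j false) , nothing , right)
  next (appV j)    (just x) = just (inj₁ (appV j) , just x , right)
  next (appV j)    nothing  = just (inj₁ (turn true j) , just (var top true) , right)
  next (outer j b) (just x) = just (inj₁ (outer j (outer-τ b x)) , just (outer-ω b x) , right)
  next (outer j b) nothing  = just (inj₁ (turn b j) , just (qsep top) , right)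
  next (rew j)     (just x) = just (inj₁ (rew j) , just x , left)
  next (rew j)     nothing  = just (inj₁ (afterRewind j) , nothing , right)
  next (scan₀ p m) (just (blk t b)) with m | b
  ... | nothing | true = just (inj₁ (scan₀ p (just (ini (proj₁ t)))) , just (blk t false) , right)
  ... | _       | _    = just (inj₁ (scan₀ p m) , just (blk t b) , right)
  next (scan₀ p (just x)) (just csep) = just (inj₁ (scan p (x , goal) nothing) , just csep , right)
  next (scan₀ p nothing)  (just csep) = just (inj₁ (done p) , just csep , right)
  next (scan₀ p m)  _ = nothing
  next (scan p xy m) (just (var v b)) with m | b
  ... | nothing | true = just (inj₁ (scan p xy (just v)) , just (var v false) , right)
  ... | _       | _    = just (inj₁ (scan p xy m) , just (var v b) , right)
  next (scan p xy (just m)) (just (qsep v)) = just (inj₁ (scan p (upd v m xy) nothing) , just (qsep v) , right)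
  next (scan p (x , y) m) nothing = just (inj₁ (back (stepP p x y)) , nothing , left)
  next (scan p xy m) _ = nothing
  next (done p)  (just x) = just (inj₁ (done p) , just x , right)
  next (done p)  nothing  = just (inj₁ (odo (out p) false) , nothing , left)
  next (back p)  (just x) = just (inj₁ (back p) , just x , left)
  next (back p)  nothing  = just (inj₁ (scan₀ p nothing) , nothing , right)
  next (odo v b) (just x) = just (inj₁ (odo v (odo-τ v b x)) , just (odo-ω v b x) , left)
  next (odo v true)  nothing = just (inj₁ (scan₀ p₀ nothing) , nothing , right)
  next (odo v false) nothing = just (inj₂ v , nothing , stay)

  open Zippers next public

  -- Correctness of the table construction

  blanks : ℕ → List A
  blanks n = replicate n nothing

  -- The blank on the left and the one surplus blank on the right are the end markers at which every
  -- sweep turns.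
  home atEnd : Q → List Cell → ℕ → Zipper (Q ⊎ Bool) A
  home  q xs n = inj₁ q ⦂ nothing ∷ [] ∣ map just xs ++ blanks (suc n)
  atEnd q xs n = facing (inj₁ q) (map just xs ʳ++ (nothing ∷ [])) (blanks (suc n))

  -- One function describes both loops. Building lowers flags from the right, so the raised prefix
  -- shrinks (`b = true`); evaluation lowers them from the left, so the lowered prefix grows
  -- (`b = false`).
  flags : {X : Set} {n : ℕ} → (X → Bool → Cell) → Bool → ℕ → Vec X n → List Cell
  flags g b j       []       = []
  flags g b zero    (x ∷ xs) = g x (not b) ∷ flags g b zero xs
  flags g b (suc j) (x ∷ xs) = g x b ∷ flags g b j xs

  snoc-ʳ++ : {X Y : Set} (f : X → Y) (xs : List X) {y : X} {zs : List Y} →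
             map f (xs ++ y ∷ []) ʳ++ zs ≡ f y ∷ (map f xs ʳ++ zs)
  snoc-ʳ++ f xs {y} = trans (cong (_ʳ++ _) (Listₚ.map-++ f xs (y ∷ []))) (Listₚ.++-ʳ++ (map f xs))

  append : ∀ {q b j x} xs {n} → next q nothing ≡ just (inj₁ (turn b j) , just x , right) →
           (inj₁ q ⦂ map just xs ʳ++ (nothing ∷ []) ∣ blanks (suc (suc n))) ⟶*
           atEnd (if b then inner j false else rew j) (xs ++ x ∷ []) n
  append {b = b} {j} {x} xs {n} e = goR e ◅
    subst (λ ls → (inj₁ (turn b j) ⦂ ls ∣ blanks (suc n)) ⟶* atEnd (if b then inner j false else rew j) (xs ++ x ∷ []) n)
      (snoc-ʳ++ just xs) (turn-left (map just (xs ++ x ∷ [])) refl)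

  data Appended : Cell → Set where
    var  : ∀ v b → Appended (var v b)
    csep : Appended csep
    qsep : ∀ v → Appended (qsep v)

  freshRow : ℕ → List Cell
  freshRow n = replicate n (var top true) ++ qsep top ∷ []

  freshRows : ℕ → ℕ → List Cell
  freshRows zero    n = []
  freshRows (suc t) n = freshRow n ++ freshRows t n

  freshRow-appended : ∀ n → All Appended (freshRow n)
  freshRow-appended zero    = qsep top ∷ []
  freshRow-appended (suc n) = var top true ∷ freshRow-appended n

  grid : ℕ → ℕ
  grid n = suc (suc (n * c) * suc n)

  built : ∀ {n} → Vec Ticket n → List Cell
  built {n} ts = flags blk true n ts ++ csep ∷ freshRows (suc (n * c)) n

  module Build (j : Counter) where

    module I = Pass just (inner j) inner-τ inner-ω
    module O = Pass just (outer j) outer-τ outer-ω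

    inner-appended : ∀ {ys} → All Appended ys → I.stateL false ys ≡ false × I.outL false ys ≡ ys
    inner-appended []       = refl , refl
    inner-appended (p ∷ ps) with e₁ , e₂ ← inner-appended ps rewrite e₁ | e₂ with p
    ... | var v b = refl , refl
    ... | csep    = refl , refl
    ... | qsep v  = refl , refl

    inner-zero : ∀ {n ys} (ts : Vec Ticket n) → All Appended ys →
                 I.stateL false (flags blk true 0 ts ++ ys) ≡ false ×
                 I.outL false (flags blk true 0 ts ++ ys) ≡ flags blk true 0 ts ++ ys
    inner-zero []       ps = inner-appended ps
    inner-zero (t ∷ ts) ps with e₁ , e₂ ← inner-zero ts ps rewrite e₁ | e₂ = refl , refl

    inner-suc : ∀ {n ys a} (ts : Vec Ticket n) → a < n → All Appended ys →
                I.stateL false (flags blk true (suc a) ts ++ ys) ≡ true ×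
                I.outL false (flags blk true (suc a) ts ++ ys) ≡ flags blk true a ts ++ ys
    inner-suc {a = zero}  (t ∷ ts) lt ps with e₁ , e₂ ← inner-zero ts ps rewrite e₁ | e₂ = refl , refl
    inner-suc {a = suc a} (t ∷ ts) (s≤s lt) ps with e₁ , e₂ ← inner-suc ts lt ps rewrite e₁ | e₂ = refl , refl

    tickets : ∀ {n} → Vec Ticket n → ℕ
    tickets []             = 0
    tickets ((_ , o) ∷ ts) = toℕ o + tickets ts

    outer-appended : ∀ {b ys} → All Appended ys → O.stateR b ys ≡ b × O.outR b ys ≡ ys
    outer-appended [] = refl , refl
    outer-appended {false} (var v b ∷ ps) with e₁ , e₂ ← outer-appended ps = e₁ , cong (_ ∷_) e₂
    outer-appended {true}  (var v b ∷ ps) with e₁ , e₂ ← outer-appended ps = e₁ , cong (_ ∷_) e₂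
    outer-appended {false} (csep ∷ ps)    with e₁ , e₂ ← outer-appended ps = e₁ , cong (_ ∷_) e₂
    outer-appended {true}  (csep ∷ ps)    with e₁ , e₂ ← outer-appended ps = e₁ , cong (_ ∷_) e₂
    outer-appended {false} (qsep v ∷ ps)  with e₁ , e₂ ← outer-appended ps = e₁ , cong (_ ∷_) e₂
    outer-appended {true}  (qsep v ∷ ps)  with e₁ , e₂ ← outer-appended ps = e₁ , cong (_ ∷_) e₂

    outer-true : ∀ {n ys} (ts : Vec Ticket n) → All Appended ys →
                 O.stateR true (flags blk true 0 ts ++ ys) ≡ true ×
                 O.outR true (flags blk true 0 ts ++ ys) ≡ flags blk true n ts ++ ys
    outer-true []       ps = outer-appended ps
    outer-true (t ∷ ts) ps with e₁ , e₂ ← outer-true ts ps = e₁ , cong (_ ∷_) e₂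

    outer-zero : ∀ {n ys} (ts : Vec Ticket n) → All Appended ys → tickets ts ≡ 0 →
                 O.stateR false (flags blk true 0 ts ++ ys) ≡ false ×
                 O.outR false (flags blk true 0 ts ++ ys) ≡ flags blk true n ts ++ ys
    outer-zero []                ps e = outer-appended ps
    outer-zero ((x , zero) ∷ ts) ps e with e₁ , e₂ ← outer-zero ts ps e = e₁ , cong (_ ∷_) e₂

    -- The ticket comes from the leftmost cell that has one left; which cell that is does not matter
    -- later, so the new vector is existential and only its symbols and its total are tracked.
    outer-suc : ∀ {n ys N} (ts : Vec Ticket n) → All Appended ys → tickets ts ≡ suc N →
                ∃ λ ts' → Vec.map proj₁ ts' ≡ Vec.map proj₁ ts × tickets ts' ≡ N ×
                O.stateR false (flags blk true 0 ts ++ ys) ≡ true ×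
                O.outR false (flags blk true 0 ts ++ ys) ≡ flags blk true n ts' ++ ys
    outer-suc ((x , zero) ∷ ts) ps e
      with ts' , e₀ , e₁ , e₂ , e₃ ← outer-suc ts ps e
      = (x , zero) ∷ ts' , cong (x ∷_) e₀ , e₁ , e₂ , cong (_ ∷_) e₃
    outer-suc ((x , suc o) ∷ ts) ps e
      with e₁ , e₂ ← outer-true ts ps
      = (x , inject₁ o) ∷ ts , refl ,
        trans (cong (_+ tickets ts) (Finₚ.toℕ-inject₁ o)) (ℕₚ.suc-injective e) , e₁ , cong (_ ∷_) e₂

    inner-pass : ∀ xs n → atEnd (inner j false) xs n ⟶*
                 (inj₁ (if I.stateL false xs then appV j else outer j false) ⦂ nothing ∷ [] ∣
                  map just (I.outL false xs) ++ blanks (suc n))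
    inner-pass xs n = I.passL (λ _ _ → refl) false xs ◅◅ goR refl ◅ ε

    append-var : ∀ {n ys a m} (ts : Vec Ticket n) → a < n → All Appended ys →
                 atEnd (inner j false) (flags blk true (suc a) ts ++ ys) (suc m) ⟶*
                 atEnd (inner j false) (flags blk true a ts ++ (ys ++ var top true ∷ [])) m
    append-var {ys = ys} {a} {m} ts lt ps
      with e₁ , e₂ ← inner-suc ts lt ps
      with run ← inner-pass (flags blk true (suc a) ts ++ ys) (suc m)
      rewrite e₁ | e₂ = run ◅◅ walkR just (λ _ → refl) (flags blk true a ts ++ ys) ◅◅
        append (flags blk true a ts ++ ys) refl ▸
        cong (λ xs → atEnd (inner j false) xs m) (Listₚ.++-assoc (flags blk true a ts) ys _)

    append-vars : ∀ {n ys} a {m} (ts : Vec Ticket n) → a ≤ n → All Appended ys →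
                  atEnd (inner j false) (flags blk true a ts ++ ys) (a + m) ⟶*
                  atEnd (inner j false) (flags blk true 0 ts ++ (ys ++ replicate a (var top true))) m
    append-vars {ys = ys} zero {m} ts le ps =
      ε ▸ cong (λ ys' → atEnd (inner j false) (flags blk true 0 ts ++ ys') m) (sym (Listₚ.++-identityʳ ys))
    append-vars {ys = ys} (suc a) {m} ts le ps =
      append-var ts le ps ◅◅ append-vars a ts (ℕₚ.<⇒≤ le) (Allₚ.++⁺ ps (var top true ∷ [])) ▸
      cong (λ ys' → atEnd (inner j false) (flags blk true 0 ts ++ ys') m) (Listₚ.++-assoc ys _ _)

    append-row : ∀ {n ys m b} (ts ts' : Vec Ticket n) → All Appended ys →
                 O.stateR false (flags blk true 0 ts ++ (ys ++ replicate n (var top true))) ≡ b →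
                 O.outR false (flags blk true 0 ts ++ (ys ++ replicate n (var top true))) ≡
                 flags blk true n ts' ++ (ys ++ replicate n (var top true)) →
                 atEnd (inner j false) (flags blk true n ts ++ ys) (suc n + m) ⟶*
                 atEnd (if b then inner j false else rew j) (flags blk true n ts' ++ (ys ++ freshRow n)) m
    append-row {n} {ys} {m} {b} ts ts' ps e₁ e₂
      with ps' ← Allₚ.++⁺ ps (Allₚ.replicate⁺ n (var top true))
      with e₃ , e₄ ← inner-zero ts ps'
      with run ← inner-pass (flags blk true 0 ts ++ (ys ++ replicate n (var top true))) (suc m)
      with pass ← O.passR (λ _ _ → refl) false (flags blk true 0 ts ++ (ys ++ replicate n (var top true)))
                    {nothing ∷ []} {blanks (suc (suc m))}
      rewrite e₁ | e₂ | e₃ | e₄ =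
        (cong (atEnd (inner j false) (flags blk true n ts ++ ys)) (sym (ℕₚ.+-suc n m)) ◂ append-vars n ts ℕₚ.≤-refl ps) ◅◅ run ◅◅ pass ◅◅
        append (flags blk true n ts' ++ (ys ++ replicate n (var top true))) refl ▸
        cong (λ xs → atEnd (if b then inner j false else rew j) xs m)
          (trans (Listₚ.++-assoc (flags blk true n ts') _ _) (cong (flags blk true n ts' ++_) (Listₚ.++-assoc ys _ _)))

    -- Induction on the tickets left. A row is written before the pass looks for a ticket, so with
    -- none left there is still one row, hence `suc N`.
    append-rows : ∀ {n ys} N {m} (ts : Vec Ticket n) → tickets ts ≡ N → All Appended ys →
                  ∃ λ ts' → Vec.map proj₁ ts' ≡ Vec.map proj₁ ts ×
                  (atEnd (inner j false) (flags blk true n ts ++ ys) (suc N * suc n + m) ⟶*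
                   atEnd (rew j) (flags blk true n ts' ++ (ys ++ freshRows (suc N) n)) m)
    append-rows {n} {ys} zero {m} ts e ps
      with e₁ , e₂ ← outer-zero ts (Allₚ.++⁺ ps (Allₚ.replicate⁺ n (var top true))) e
      = ts , refl , ((cong (λ i → atEnd (inner j false) (flags blk true n ts ++ ys) (i + m)) (ℕₚ.+-identityʳ (suc n)) ◂
          append-row ts ts ps e₁ e₂) ▸
          cong (λ zs → atEnd (rew j) (flags blk true n ts ++ (ys ++ zs)) m) (sym (Listₚ.++-identityʳ (freshRow n))))
    append-rows {n} {ys} (suc N) {m} ts e ps
      with ts₁ , s₁ , e₀ , e₁ , e₂ ← outer-suc ts (Allₚ.++⁺ ps (Allₚ.replicate⁺ n (var top true))) e
      with ts₂ , s₂ , run ← append-rows N {m} ts₁ e₀ (Allₚ.++⁺ ps (freshRow-appended n))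
      = ts₂ , trans s₂ s₁ , ((cong (atEnd (inner j false) (flags blk true n ts ++ ys)) (ℕₚ.+-assoc (suc n) (suc N * suc n) m) ◂
          append-row ts ts₁ ps e₁ e₂) ◅◅ run ▸
          cong (λ zs → atEnd (rew j) (flags blk true n ts₂ ++ zs) m) (Listₚ.++-assoc ys (freshRow n) _))

    module R = Pass {S = ⊤} just (λ _ → relab j) (λ _ _ → tt) (λ _ → relabel)

    issue : (xs : List Cell) → Vec Ticket (length xs)
    issue []       = []
    issue (x ∷ xs) = (symOf x , fromℕ c) ∷ issue xs

    issue-out : ∀ σ xs → R.outR σ xs ≡ flags blk true (length xs) (issue xs)
    issue-out σ []       = refl
    issue-out σ (x ∷ xs) = cong (relabel x ∷_) (issue-out tt xs)

    issue-tickets : ∀ xs → tickets (issue xs) ≡ length xs * c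
    issue-tickets []       = refl
    issue-tickets (x ∷ xs) = cong₂ _+_ (Finₚ.toℕ-fromℕ c) (issue-tickets xs)

    issue-sym : ∀ xs → toList (Vec.map proj₁ (issue xs)) ≡ map symOf xs
    issue-sym []       = refl
    issue-sym (x ∷ xs) = cong (symOf x ∷_) (issue-sym xs)

    round : ∀ xs m → ∃ λ (ts : Vec Ticket (length xs)) → toList (Vec.map proj₁ ts) ≡ map symOf xs ×
            (home (relab j) xs (grid (length xs) + m) ⟶* home (afterRewind j) (built ts) m)
    round xs m
      with ts , e , run ← append-rows (length xs * c) {m} (issue xs) (issue-tickets xs) (csep ∷ [])
      = ts , trans (cong toList e) (issue-sym xs) ,
        (R.passR (λ _ _ → refl) tt xs ▸
          cong (λ ys → (inj₁ (relab j) ⦂ map just ys ʳ++ (nothing ∷ []) ∣ blanks (suc (grid (length xs) + m)))) (issue-out tt xs)) ◅◅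
        append (flags blk true (length xs) (issue xs)) refl ◅◅ run ◅◅
        walkL just (λ _ → refl) (built ts) ◅◅ goR refl ◅ ε

  width room : ℕ → ℕ → ℕ
  width zero    n = n
  width (suc i) n = width i (n + grid n)
  room zero    n = grid n
  room (suc i) n = grid n + room i (n + grid n)

  length-flags : {X : Set} {n : ℕ} (g : X → Bool → Cell) (b : Bool) (j : ℕ) (xs : Vec X n) → length (flags g b j xs) ≡ n
  length-flags g b j       []       = refl
  length-flags g b zero    (x ∷ xs) = cong suc (length-flags g b zero xs)
  length-flags g b (suc j) (x ∷ xs) = cong suc (length-flags g b j xs)

  length-freshRows : ∀ t n → length (freshRows t n) ≡ t * suc n
  length-freshRows zero    n = refl
  length-freshRows (suc t) n = trans (Listₚ.length-++ (freshRow n)) (cong₂ _+_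
    (trans (Listₚ.length-++ (replicate n (var top true)))
      (trans (cong (_+ 1) (Listₚ.length-replicate n)) (ℕₚ.+-comm n 1)))
    (length-freshRows t n))

  length-built : ∀ {n} (ts : Vec Ticket n) → length (built ts) ≡ n + grid n
  length-built {n} ts = trans (Listₚ.length-++ (flags blk true n ts))
    (cong₂ _+_ (length-flags blk true n ts) (cong suc (length-freshRows (suc (n * c)) n)))

  sym-flags : ∀ {n} b j (ts : Vec Ticket n) → map symOf (flags blk b j ts) ≡ toList (Vec.map proj₁ ts)
  sym-flags b j       []       = refl
  sym-flags b zero    (t ∷ ts) = cong (_ ∷_) (sym-flags b zero ts)
  sym-flags b (suc j) (t ∷ ts) = cong (_ ∷_) (sym-flags b j ts)

  sym-appended : ∀ {ys} → All Appended ys → map symOf ys ≡ replicate (length ys) nothing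
  sym-appended []            = refl
  sym-appended (var v b ∷ p) = cong (nothing ∷_) (sym-appended p)
  sym-appended (csep ∷ p)    = cong (nothing ∷_) (sym-appended p)
  sym-appended (qsep v ∷ p)  = cong (nothing ∷_) (sym-appended p)

  freshRows-appended : ∀ t n → All Appended (freshRows t n)
  freshRows-appended zero    n = []
  freshRows-appended (suc t) n = Allₚ.++⁺ (freshRow-appended n) (freshRows-appended t n)

  replicate-++ : {X : Set} {x : X} (m : ℕ) {n : ℕ} → replicate (m + n) x ≡ replicate m x ++ replicate n x
  replicate-++ zero    = refl
  replicate-++ (suc m) = cong (_ ∷_) (replicate-++ m)

  Padded : Word s → List (Sym s) → Set
  Padded w xs = ∃ λ r → xs ≡ map just w ++ replicate r nothing

  Padded-++ : ∀ {w xs r} → Padded w xs → Padded w (xs ++ replicate r nothing)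
  Padded-++ {w} {r = r} (r' , refl) = r' + r , trans (Listₚ.++-assoc (map just w) _ _)
    (cong (map just w ++_) (sym (replicate-++ r')))

  Padded-built : ∀ {w n} {ts : Vec Ticket n} → Padded w (toList (Vec.map proj₁ ts)) → Padded w (map symOf (built ts))
  Padded-built {w} {n} {ts} p = subst (Padded w)
    (sym (trans (Listₚ.map-++ symOf (flags blk true n ts) _)
      (cong₂ _++_ (sym-flags true n ts) (sym-appended (csep ∷ freshRows-appended (suc (n * c)) n)))))
    (Padded-++ p)

  rounds : ∀ i (j : Counter) → toℕ j ≡ i → ∀ {n w} xs m → length xs ≡ n → Padded w (map symOf xs) →
           ∃ λ (ts : Vec Ticket (width i n)) → Padded w (toList (Vec.map proj₁ ts)) ×
           (home (relab j) xs (room i n + m) ⟶* home (scan₀ p₀ nothing) (built ts) m)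
  rounds zero zero e xs m refl p with ts , e' , run ← Build.round zero xs m
    = ts , subst (Padded _) (sym e') p , run
  rounds (suc i) (suc j) e {n} xs m refl p
    with ts , e' , run ← Build.round (suc j) xs (room i (n + grid n) + m)
    with ts' , p' , run' ← rounds i (inject₁ j) (trans (Finₚ.toℕ-inject₁ j) (ℕₚ.suc-injective e)) (built ts) m
           (length-built ts) (Padded-built {ts = ts} (subst (Padded _) (sym e') p))
    = ts' , p' , ((cong (home (relab (suc j)) xs) (ℕₚ.+-assoc (grid n) (room i (n + grid n)) m) ◂ run) ◅◅ run')

  -- Evaluating one assignment, column by column

  Rows : ℕ → Set
  Rows n = List (Vec V n × V)

  rowCells : ∀ {n} → ℕ → Rows n → List Cell
  rowCells j []              = []
  rowCells j ((es , b) ∷ rs) = flags var false j es ++ qsep b ∷ rowCells j rs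

  sheet : ∀ {n} → ℕ → Vec Ticket n → Rows n → List Cell
  sheet j ts rows = flags blk false j ts ++ csep ∷ rowCells j rows

  -- Substituting midpoints acts on each column separately. Following a single column through all
  -- levels takes just one pair of values, which fits into the control state of `scan`.
  column : ∀ {n} → Fin n → Rows n → V × V → V × V
  column i []                xy = xy
  column i ((es , b) ∷ rows) xy = column i rows (upd b (lookup es i) xy)

  seq-rhs : ∀ xs {ys} {rs : List A} → map just (xs ++ ys) ++ rs ≡ map just xs ++ (map just ys ++ rs)
  seq-rhs xs {ys} {rs} = trans (cong (_++ rs) (Listₚ.map-++ just xs ys)) (Listₚ.++-assoc (map just xs) _ _)

  seq-lhs : ∀ xs {ys} {ls : List A} → map just (xs ++ ys) ʳ++ ls ≡ map just ys ʳ++ (map just xs ʳ++ ls)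
  seq-lhs xs {ys} {ls} = trans (cong (_ʳ++ ls) (Listₚ.map-++ just xs ys)) (Listₚ.++-ʳ++ (map just xs))

  -- In every row the machine reads the leftmost unvisited cell and lowers its flag. All rows thus
  -- advance by exactly one cell per sweep and stay aligned without a column counter.
  module Pick {X : Set} (g : X → Bool → Cell) (q : Maybe V → Q) (val : X → V)
    (pick : ∀ x → next (q nothing) (just (g x true)) ≡ just (inj₁ (q (just (val x))) , just (g x false) , right))
    (skip : ∀ x → next (q nothing) (just (g x false)) ≡ just (inj₁ (q nothing) , just (g x false) , right))
    (keep : ∀ v x → next (q (just v)) (just (g x true)) ≡ just (inj₁ (q (just v)) , just (g x true) , right)) where

    rest : ∀ {n} v (xs : Vec X n) {ls rs} → (inj₁ (q (just v)) ⦂ ls ∣ map just (flags g false 0 xs) ++ rs) ⟶*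
                                      (inj₁ (q (just v)) ⦂ map just (flags g false 0 xs) ʳ++ ls ∣ rs)
    rest v []       = ε
    rest v (x ∷ xs) = goR (keep v x) ◅ rest v xs

    row : ∀ {n} (i : Fin n) (xs : Vec X n) {ls rs} →
          (inj₁ (q nothing) ⦂ ls ∣ map just (flags g false (toℕ i) xs) ++ rs) ⟶*
          (inj₁ (q (just (val (lookup xs i)))) ⦂ map just (flags g false (suc (toℕ i)) xs) ʳ++ ls ∣ rs)
    row zero    (x ∷ xs) = goR (pick x) ◅ rest (val x) xs
    row (suc i) (x ∷ xs) = goR (skip x) ◅ row i xs

    exhausted : ∀ {n} (xs : Vec X n) {ls rs} →
          (inj₁ (q nothing) ⦂ ls ∣ map just (flags g false n xs) ++ rs) ⟶*
          (inj₁ (q nothing) ⦂ map just (flags g false n xs) ʳ++ ls ∣ rs)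
    exhausted []       = ε
    exhausted (x ∷ xs) = goR (skip x) ◅ exhausted xs

  module Pick₀ (p : P) = Pick blk (scan₀ p) (λ t → ini (proj₁ t)) (λ _ → refl) (λ _ → refl) (λ _ _ → refl)
  module Pick₁ (p : P) (xy : V × V) = Pick var (scan p xy) id (λ _ → refl) (λ _ → refl) (λ _ _ → refl)

  scan-rows : ∀ {n} p (i : Fin n) (rows : Rows n) xy {ls rs} →
              (inj₁ (scan p xy nothing) ⦂ ls ∣ map just (rowCells (toℕ i) rows) ++ rs) ⟶*
              (inj₁ (scan p (column i rows xy) nothing) ⦂ map just (rowCells (suc (toℕ i)) rows) ʳ++ ls ∣ rs)
  scan-rows p i []                xy = ε
  scan-rows p i ((es , b) ∷ rows) xy {ls} {rs} =
    cong (_ ⦂ ls ∣_) (seq-rhs (flags var false (toℕ i) es)) ◂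
    Pick₁.row p xy i es ◅◅ goR refl ◅ scan-rows p i rows (upd b (lookup es i) xy) ▸
    cong (_ ⦂_∣ rs) (sym (seq-lhs (flags var false (suc (toℕ i)) es)))

  start : ∀ {n} → Vec Ticket n → Fin n → V × V
  start ts i = ini (proj₁ (lookup ts i)) , goal

  sweep : ∀ {n} p (i : Fin n) (ts : Vec Ticket n) (rows : Rows n) m →
          let (x , y) = column i rows (start ts i) in
          home (scan₀ p nothing) (sheet (toℕ i) ts rows) m ⟶*
          home (scan₀ (stepP p x y) nothing) (sheet (suc (toℕ i)) ts rows) m
  sweep p i ts rows m =
    cong (_ ⦂ _ ∣_) (seq-rhs (flags blk false (toℕ i) ts)) ◂
    Pick₀.row p i ts ◅◅ goR refl ◅ scan-rows p i rows (start ts i) ◅◅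
    ((cong (inj₁ (scan p (column i rows (start ts i)) nothing) ⦂_∣ blanks (suc m))
      (sym (seq-lhs (flags blk false (suc (toℕ i)) ts))) ◂
    turn-left (map just (sheet (suc (toℕ i)) ts rows)) refl) ◅◅
    walkL just (λ _ → refl) (sheet (suc (toℕ i)) ts rows) ◅◅ goR refl ◅ ε)

  finish : ∀ {n} p (ts : Vec Ticket n) (rows : Rows n) m →
           home (scan₀ p nothing) (sheet n ts rows) m ⟶* atEnd (odo (out p) false) (sheet n ts rows) m
  finish {n} p ts rows m =
    cong (_ ⦂ _ ∣_) (seq-rhs (flags blk false n ts)) ◂
    Pick₀.exhausted p ts ◅◅ goR refl ◅ walkR just (λ _ → refl) (rowCells n rows) ◅◅
    ((cong (inj₁ (done p) ⦂_∣ blanks (suc m)) (sym (seq-lhs (flags blk false n ts))) ◂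
    turn-left (map just (sheet n ts rows)) refl))

  verdict : ∀ {n} → Vec Ticket n → Rows n → Bool
  verdict {n} ts rows = out (runP p₀ n (λ i → proj₁ (column i rows (start ts i))) (λ i → proj₂ (column i rows (start ts i))))

  -- The map `f` embeds the `r` remaining columns behind the `j` finished ones, which matches the
  -- recursion of `runP` on shifted functions.
  sweeps : ∀ {n} p r j (f : Fin r → Fin n) → (∀ i → toℕ (f i) ≡ j + toℕ i) → j + r ≡ n →
           ∀ (ts : Vec Ticket n) (rows : Rows n) m →
           home (scan₀ p nothing) (sheet j ts rows) m ⟶*
           atEnd (odo (out (runP p r (λ i → proj₁ (column (f i) rows (start ts (f i))))
                                     (λ i → proj₂ (column (f i) rows (start ts (f i)))))) false) (sheet n ts rows) m
  sweeps {n} p zero j f e e' ts rows m =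
    cong (λ j → home (scan₀ p nothing) (sheet j ts rows) m) (trans (sym (ℕₚ.+-identityʳ j)) e') ◂ finish p ts rows m
  sweeps p (suc r) j f e e' ts rows m =
    (cong (λ j → home (scan₀ p nothing) (sheet j ts rows) m) (sym e₀) ◂ sweep p (f zero) ts rows m) ◅◅
    (cong (λ j → home (scan₀ _ nothing) (sheet (suc j) ts rows) m) e₀ ◂
     sweeps _ r (suc j) (f ∘ suc) (λ i → trans (e (suc i)) (ℕₚ.+-suc j (toℕ i)))
       (trans (sym (ℕₚ.+-suc j r)) e') ts rows m)
    where e₀ = trans (e zero) (ℕₚ.+-identityʳ j)

  evaluate : ∀ {n} (ts : Vec Ticket n) (rows : Rows n) m →
             home (scan₀ p₀ nothing) (sheet 0 ts rows) m ⟶* atEnd (odo (verdict ts rows) false) (sheet n ts rows) m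
  evaluate {n} ts rows m = sweeps p₀ n 0 id (λ _ → refl) refl ts rows m

  -- The odometer through all assignments

  data Kind : Set where
    ex al : Kind

  Item : Set
  Item = Kind × V

  qcell : Bool → Item → Cell
  qcell b (ex , v) = var v b
  qcell b (al , v) = qsep v

  shape : ℕ → ℕ → List Kind
  shape zero    n = []
  shape (suc t) n = replicate n ex ++ al ∷ shape t n

  reset : List Kind → List Item
  reset = map (_, top)

  Sem : List Kind → (List Item → Set) → Set
  Sem []        f = f []
  Sem (ex ∷ ks) f = ∃ λ v → Sem ks (λ xs → f ((ex , v) ∷ xs))
  Sem (al ∷ ks) f = ∀ v → Sem ks (λ xs → f ((al , v) ∷ xs))

  flat : ∀ {n} → Rows n → List Item
  flat []                = []
  flat ((es , b) ∷ rows) = map (ex ,_) (toList es) ++ (al , b) ∷ flat rows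

  -- Total on arbitrary lists, with `top` filling in, so that `φ` is a predicate on all item lists.
  -- On lists of the right shape `readRows-flat` recovers the rows.
  readRow : (n : ℕ) → List Item → Vec V n × List Item
  readRow zero    xs       = [] , xs
  readRow (suc n) []       = Vec.replicate _ top , []
  readRow (suc n) (x ∷ xs) with es , xs' ← readRow n xs = proj₂ x ∷ es , xs'

  readRows : (t n : ℕ) → List Item → Rows n
  readRows zero    n xs = []
  readRows (suc t) n xs with readRow n xs
  ... | es , []      = (es , top) ∷ readRows t n []
  ... | es , x ∷ xs' = (es , proj₂ x) ∷ readRows t n xs'

  readRow-++ : ∀ {n} (es : Vec V n) xs → readRow n (map (ex ,_) (toList es) ++ xs) ≡ (es , xs)
  readRow-++ []       xs = refl
  readRow-++ (e ∷ es) xs rewrite readRow-++ es xs = refl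

  readRows-flat : ∀ {n} (rows : Rows n) → readRows (length rows) n (flat rows) ≡ rows
  readRows-flat []                = refl
  readRows-flat ((es , b) ∷ rows) rewrite readRow-++ es ((al , b) ∷ flat rows) = cong (_ ∷_) (readRows-flat rows)

  parseRow : ∀ n (xs : List Item) {ks} → map proj₁ xs ≡ replicate n ex ++ al ∷ ks →
             ∃ λ (es : Vec V n) → ∃ λ (b : V) → ∃ λ (xs' : List Item) → xs ≡ map (ex ,_) (toList es) ++ (al , b) ∷ xs' × map proj₁ xs' ≡ ks
  parseRow zero    ((.al , b) ∷ xs) refl = [] , b , xs , refl , refl
  parseRow (suc n) ((k , v) ∷ xs) e
    with refl , e' ← Listₚ.∷-injective e
    with es , b , xs' , refl , e'' ← parseRow n xs e' = v ∷ es , b , xs' , refl , e''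

  parse : ∀ t n xs → map proj₁ xs ≡ shape t n → ∃ λ (rows : Rows n) → length rows ≡ t × flat rows ≡ xs
  parse zero    n []  e = [] , refl , refl
  parse (suc t) n xs  e
    with es , b , xs' , refl , e' ← parseRow n xs e
    with rows , refl , refl ← parse t n xs' e' = (es , b) ∷ rows , refl , refl

  flags-fresh : ∀ {n} (es : Vec V n) → flags var false 0 es ≡ map (qcell true) (map (ex ,_) (toList es))
  flags-fresh []       = refl
  flags-fresh (e ∷ es) = cong (_ ∷_) (flags-fresh es)

  flags-done : ∀ {n} (es : Vec V n) → flags var false n es ≡ map (qcell false) (map (ex ,_) (toList es))
  flags-done []       = refl
  flags-done (e ∷ es) = cong (_ ∷_) (flags-done es)

  rowCells-fresh : ∀ {n} (rows : Rows n) → rowCells 0 rows ≡ map (qcell true) (flat rows)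
  rowCells-fresh []                = refl
  rowCells-fresh ((es , b) ∷ rows) = trans (cong₂ (λ xs ys → xs ++ qsep b ∷ ys) (flags-fresh es) (rowCells-fresh rows))
    (sym (Listₚ.map-++ (qcell true) (map (ex ,_) (toList es)) _))

  rowCells-done : ∀ {n} (rows : Rows n) → rowCells n rows ≡ map (qcell false) (flat rows)
  rowCells-done []                = refl
  rowCells-done ((es , b) ∷ rows) = trans (cong₂ (λ xs ys → xs ++ qsep b ∷ ys) (flags-done es) (rowCells-done rows))
    (sym (Listₚ.map-++ (qcell false) (map (ex ,_) (toList es)) _))

  map-ʳ++-ʳ++ : {X Y : Set} (f : X → Y) (xs : List X) {ys : List X} {zs : List Y} →
                map f (xs ʳ++ ys) ʳ++ zs ≡ map f ys ʳ++ (map f xs ++ zs)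
  map-ʳ++-ʳ++ f []       = refl
  map-ʳ++-ʳ++ f (x ∷ xs) = map-ʳ++-ʳ++ f xs

  reset-shape : ∀ t n → map (qcell true) (reset (shape t n)) ≡ freshRows t n
  reset-shape zero    n = refl
  reset-shape (suc t) n = go n
    where
    go : ∀ r → map (qcell true) (reset (replicate r ex ++ al ∷ shape t n)) ≡ freshRow r ++ freshRows t n
    go zero    = cong (_ ∷_) (reset-shape t n)
    go (suc r) = cong (_ ∷_) (go r)

  flags-all : {X : Set} {n : ℕ} (g : X → Bool → Cell) (xs : Vec X n) → flags g true n xs ≡ flags g false 0 xs
  flags-all g []       = refl
  flags-all g (x ∷ xs) = cong (_ ∷_) (flags-all g xs)

  module Odometer {n : ℕ} (t m : ℕ) (ts : Vec Ticket n) where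

    φ : List Item → Set
    φ xs = verdict ts (readRows t n xs) ≡ true

    fresh : List Item → List Cell
    fresh xs = flags blk false 0 ts ++ csep ∷ map (qcell true) xs

    used : Item → A
    used x = just (qcell false x)

    -- What lies to the left of the quantified cells, once all cells have been visited.
    left-part : List A
    left-part = just csep ∷ (map just (flags blk false n ts) ʳ++ (nothing ∷ []))

    right-part : List Item → List A
    right-part ys = map just (map (qcell true) ys) ++ blanks (suc m)

    -- xs is the part of the assignment to the left of the head, nearest cell first.
    before : Q → List Item → List Item → Zipper (Q ⊎ Bool) A
    before q xs ys = facing (inj₁ q) (map used xs ++ left-part) (right-part ys)

    retreat : ∀ {v b q' y} x xs ys → next (odo v b) (used x) ≡ just (inj₁ q' , just (qcell true y) , left) →
              before (odo v b) (x ∷ xs) ys ⟶* before q' xs (y ∷ ys)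
    retreat x []       ys e = goL e ◅ ε
    retreat x (_ ∷ xs) ys e = goL e ◅ ε

    retreat-stopped : ∀ v xs ys → before (odo v true) xs ys ⟶* before (odo v true) [] (xs ʳ++ ys)
    retreat-stopped v []       ys = ε
    retreat-stopped v (x ∷ xs) ys = retreat x xs ys (go v x) ◅◅ retreat-stopped v xs (x ∷ ys)
      where
      go : ∀ v x → next (odo v true) (used x) ≡ just (inj₁ (odo v true) , just (qcell true x) , left)
      go true  (ex , u) = refl
      go false (ex , u) = refl
      go true  (al , u) = refl
      go false (al , u) = refl

    odo-blk : ∀ v b (x : Ticket) f → next (odo v b) (just (blk x f)) ≡ just (inj₁ (odo v b) , just (blk x true) , left)
    odo-blk true  true  x f = refl
    odo-blk true  false x f = refl
    odo-blk false true  x f = refl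
    odo-blk false false x f = refl

    odo-csep : ∀ v b → next (odo v b) (just csep) ≡ just (inj₁ (odo v b) , just csep , left)
    odo-csep true  true  = refl
    odo-csep true  false = refl
    odo-csep false true  = refl
    odo-csep false false = refl

    retreat-blk : ∀ {n} v b (ts : Vec Ticket n) {l ls rs} →
                  facing (inj₁ (odo v b)) (map just (flags blk false n ts) ʳ++ (l ∷ ls)) rs ⟶*
                  facing (inj₁ (odo v b)) (l ∷ ls) (map just (flags blk false 0 ts) ++ rs)
    retreat-blk v b []       = ε
    retreat-blk v b (x ∷ ts) = retreat-blk v b ts ◅◅ goL (odo-blk v b x false) ◅ ε

    facing-blk : ∀ {n} v b (ts : Vec Ticket n) {rs} →
                 facing (inj₁ (odo v b)) (just csep ∷ (map just (flags blk false n ts) ʳ++ (nothing ∷ []))) rs ⟶*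
                 facing (inj₁ (odo v b)) (map just (flags blk false n ts) ʳ++ (nothing ∷ [])) (just csep ∷ rs)
    facing-blk {n} v b ts = go (map just (flags blk false n ts)) (nothing ∷ []) (λ ())
      where
      go : ∀ xs ys {rs} → ys ≢ [] → facing (inj₁ (odo v b)) (just csep ∷ (xs ʳ++ ys)) rs ⟶*
                         facing (inj₁ (odo v b)) (xs ʳ++ ys) (just csep ∷ rs)
      go []       []       p = ⊥-elim (p refl)
      go []       (y ∷ ys) p = goL (odo-csep v b) ◅ ε
      go (x ∷ xs) ys       p = go xs (x ∷ ys) (λ ())

    leave : ∀ v b ys → before (odo v b) [] ys ⟶* facing (inj₁ (odo v b)) (nothing ∷ []) (map just (fresh ys) ++ blanks (suc m))
    leave v b ys = facing-blk v b ts ◅◅ retreat-blk v b ts ▸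
      cong (facing (inj₁ (odo v b)) (nothing ∷ [])) (sym (seq-rhs (flags blk false 0 ts)))

    restart : ∀ v xs ys → before (odo v true) xs ys ⟶* home (scan₀ p₀ nothing) (fresh (xs ʳ++ ys)) m
    restart v xs ys = retreat-stopped v xs ys ◅◅ leave v true (xs ʳ++ ys) ◅◅ goR refl ◅ ε

    -- The contract for a subformula with quantifier prefix `ks`, under the choices `xs` for the
    -- outer variables. Started afresh, the machine returns to the nearest outer cell carrying the
    -- truth value, with all cells of `ks` back at `top` and ready for the next outer choice.
    Reaches : List Kind → List Item → List Item → Set → Set
    Reaches ks xs ys S = Σ (Dec S) λ D →
      home (scan₀ p₀ nothing) (fresh (xs ʳ++ ys)) m ⟶* before (odo (does D) false) xs (reset ks)

    is-true? : ∀ b → Σ (Dec (b ≡ true)) λ D → b ≡ does D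
    is-true? true  = yes refl , refl
    is-true? false = no (λ ()) , refl

    all-used : ∀ xs (rows : Rows n) → flat rows ≡ xs ʳ++ [] →
               map just (sheet n ts rows) ʳ++ (nothing ∷ []) ≡ map used xs ++ left-part
    all-used xs rows e = begin
      map just (sheet n ts rows) ʳ++ (nothing ∷ [])           ≡⟨ seq-lhs (flags blk false n ts) ⟩
      map just (rowCells n rows) ʳ++ left-part                ≡⟨ cong (λ ys → map just ys ʳ++ left-part) (rowCells-done rows) ⟩
      map just (map (qcell false) (flat rows)) ʳ++ left-part  ≡⟨ cong (_ʳ++ left-part) (sym (Listₚ.map-∘ (flat rows))) ⟩
      map used (flat rows) ʳ++ left-part                      ≡⟨ cong (λ ys → map used ys ʳ++ left-part) e ⟩
      map used (xs ʳ++ []) ʳ++ left-part                      ≡⟨ map-ʳ++-ʳ++ used xs ⟩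
      map used xs ++ left-part                                ∎
      where open ≡-Reasoning

    search-[] : ∀ xs → map proj₁ xs ʳ++ [] ≡ shape t n → Reaches [] xs [] (φ (xs ʳ++ []))
    search-[] xs e
      with rows , refl , e' ← parse t n (xs ʳ++ []) (trans (Listₚ.map-ʳ++ proj₁ xs) e)
      with D , v≡ ← is-true? (verdict ts (readRows t n (xs ʳ++ [])))
      = D , (cong (λ cs → home (scan₀ p₀ nothing) (flags blk false 0 ts ++ csep ∷ cs) m)
               (trans (cong (map (qcell true)) (sym e')) (sym (rowCells-fresh rows))) ◂ evaluate ts rows m) ▸
        cong₂ (λ v ls → facing (inj₁ (odo v false)) ls (blanks (suc m)))
          (trans (cong (verdict ts) (trans (sym (readRows-flat rows)) (cong (readRows t n) e'))) v≡)
          (all-used xs rows e')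

    extend : ∀ {i v} {R : V → Set} → toℕ v ≡ suc i → R v → (∀ u → suc i < toℕ u → R u) → ∀ u → i < toℕ u → R u
    extend {R = R} e r greater u lt with ℕₚ.m≤n⇒m<n∨m≡n lt
    ... | inj₁ lt' = greater u lt'
    ... | inj₂ eq  = subst R (Finₚ.toℕ-injective (trans e eq)) r

    -- Recursion on the prefix, and for its first cell on the value, downwards from `top`. The
    -- hypothesis `greater` says that all larger values have failed for an existential cell, or
    -- succeeded for a universal one. A decisive value ends the loop early; an inconclusive one is
    -- lowered and the evaluation restarts from the left.
    search : ∀ ks xs → map proj₁ xs ʳ++ ks ≡ shape t n → Reaches ks xs (reset ks) (Sem ks (λ ys → φ (xs ʳ++ ys)))
    search []        xs e = search-[] xs e
    search (ex ∷ ks) xs e = go d top (Finₚ.toℕ-fromℕ d) (λ v lt → ⊥-elim (ℕₚ.<-irrefl refl (ℕₚ.<-≤-trans lt (Finₚ.toℕ≤pred[n] v))))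
      where
      S : V → Set
      S v = Sem ks (λ ys → φ (xs ʳ++ ((ex , v) ∷ ys)))
      go : ∀ i v → toℕ v ≡ i → (∀ u → i < toℕ u → ¬ S u) → Reaches (ex ∷ ks) xs ((ex , v) ∷ reset ks) (∃ S)
      go i v e' greater with search ks ((ex , v) ∷ xs) e
      go i v e' greater | yes p , run = yes (v , p) , run ◅◅ retreat _ xs _ refl
      go zero zero e' greater | no ¬p , run = no none , run ◅◅ retreat _ xs _ refl
        where
        none : ¬ ∃ S
        none (zero  , p) = ¬p p
        none (suc u , p) = greater (suc u) (s≤s z≤n) p
      go (suc i) (suc v) e' greater | no ¬p , run
        with D , run' ← go i (inject₁ v) (trans (Finₚ.toℕ-inject₁ v) (ℕₚ.suc-injective e')) (extend e' ¬p greater)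
        = D , run ◅◅ retreat {y = ex , inject₁ v} _ xs _ refl ◅◅ restart false xs _ ◅◅ run'
    search (al ∷ ks) xs e = go d top (Finₚ.toℕ-fromℕ d) (λ v lt → ⊥-elim (ℕₚ.<-irrefl refl (ℕₚ.<-≤-trans lt (Finₚ.toℕ≤pred[n] v))))
      where
      S : V → Set
      S v = Sem ks (λ ys → φ (xs ʳ++ ((al , v) ∷ ys)))
      go : ∀ i v → toℕ v ≡ i → (∀ u → i < toℕ u → S u) → Reaches (al ∷ ks) xs ((al , v) ∷ reset ks) (∀ u → S u)
      go i v e' greater with search ks ((al , v) ∷ xs) e
      go i v e' greater | no ¬p , run = no (λ p → ¬p (p v)) , run ◅◅ retreat _ xs _ refl
      go zero zero e' greater | yes p , run = yes every , run ◅◅ retreat _ xs _ refl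
        where
        every : ∀ u → S u
        every zero    = p
        every (suc u) = greater (suc u) (s≤s z≤n)
      go (suc i) (suc v) e' greater | yes p , run
        with D , run' ← go i (inject₁ v) (trans (Finₚ.toℕ-inject₁ v) (ℕₚ.suc-injective e')) (extend e' p greater)
        = D , run ◅◅ retreat {y = al , inject₁ v} _ xs _ refl ◅◅ restart true xs _ ◅◅ run'

    decide : Σ (Dec (Sem (shape t n) φ)) λ D → ∃ λ ls → ∃ λ rs →
             home (scan₀ p₀ nothing) (fresh (reset (shape t n))) m ⟶* (inj₂ (does D) ⦂ ls ∣ rs)
    decide with D , run ← search (shape t n) [] refl = D , _ , _ , run ◅◅ leave (does D) false _ ◅◅ goS refl ◅ ε

  -- The quantified formula as reachability in a power of two steps

  halve : ∀ {n} → V → Vec V n → Vec V n × Vec V n → Vec V n × Vec V n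
  halve zero    M (X , Y) = M , Y
  halve (suc _) M (X , Y) = X , M

  -- The universal bit lets both halves share one recursive occurrence. The formula therefore grows
  -- by one row per level, where writing out both halves would double it.
  Reach : ∀ {n} → ℕ → Vec V n × Vec V n → Set
  Reach zero    (X , Y) = Edge p₀ _ X Y
  Reach (suc t) XY      = ∃ λ M → ∀ b → Reach t (halve b M XY)

  ends : ∀ {n} → Rows n → Vec V n × Vec V n → Vec V n × Vec V n
  ends []                XY = XY
  ends ((es , b) ∷ rows) XY = ends rows (halve b es XY)

  lookup₂ : ∀ {n} → Fin n → Vec V n × Vec V n → V × V
  lookup₂ i (X , Y) = lookup X i , lookup Y i

  lookup-ends : ∀ {n} i (rows : Rows n) XY → column i rows (lookup₂ i XY) ≡ lookup₂ i (ends rows XY)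
  lookup-ends i []                   XY = refl
  lookup-ends i ((es , zero) ∷ rows)  XY = lookup-ends i rows (halve zero es XY)
  lookup-ends i ((es , suc b) ∷ rows) XY = lookup-ends i rows (halve (suc b) es XY)

  terminals : ∀ {n} → Vec Ticket n → Vec V n × Vec V n
  terminals {n} ts = Vec.map (ini ∘ proj₁) ts , Vec.replicate n goal

  verdict-ends : ∀ {n} (ts : Vec Ticket n) rows →
                 verdict ts rows ≡ true ⇔ Reach 0 (ends rows (terminals ts))
  verdict-ends {n} ts rows = mk⇔ (trans (sym e)) (trans e)
    where
    e : verdict ts rows ≡ out (runP p₀ n (lookup (proj₁ (ends rows (terminals ts)))) (lookup (proj₂ (ends rows (terminals ts)))))
    e = cong out (runP-cong p₀ n (λ i → trans
      (cong (column i rows) (cong₂ _,_ (sym (Vecₚ.lookup-map i _ ts)) (sym (Vecₚ.lookup-replicate i goal))))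
      (lookup-ends i rows (terminals ts))))

  Sem-row : ∀ n {ks} f → Sem (replicate n ex ++ ks) f ⇔
            (∃ λ (es : Vec V n) → Sem ks (λ ys → f (map (ex ,_) (toList es) ++ ys)))
  Sem-row zero    f = mk⇔ (λ h → [] , h) (λ { ([] , h) → h })
  Sem-row (suc n) f = mk⇔
    (λ (v , h) → let (es , h') = Equivalence.to (Sem-row n _) h in v ∷ es , h')
    (λ { (v ∷ es , h) → v , Equivalence.from (Sem-row n _) (es , h) })

  Sem-Reach : ∀ {n} t {f} {XY : Vec V n × Vec V n} →
              (∀ rows → length rows ≡ t → f (flat rows) ⇔ Reach 0 (ends rows XY)) →
              Sem (shape t n) f ⇔ Reach t XY
  Sem-Reach zero        h = h [] refl
  Sem-Reach {n} (suc t) h = mk⇔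
    (λ p → let (es , q) = Equivalence.to (Sem-row n _) p in es , λ b → Equivalence.to (rec es b) (q b))
    (λ (es , q) → Equivalence.from (Sem-row n _) (es , λ b → Equivalence.from (rec es b) (q b)))
    where
    rec : ∀ es b → _
    rec es b = Sem-Reach t (λ rows e → h ((es , b) ∷ rows) (cong suc e))

  -- The element of `Fin d` supplies a nonzero value of `V`, at which the universal cell speaks
  -- about the first half.
  Reach⇒Path : Fin d → ∀ {n} t {X Y : Vec V n} → Reach t (X , Y) → Path (Edge p₀ n) (2 ^ t) X Y
  Reach⇒Path one zero    e       = e ∷ []
  Reach⇒Path one (suc t) (M , h) = concat (Reach⇒Path one t (h (suc one)))
    (subst (λ r → Path _ r M _) (sym (ℕₚ.+-identityʳ (2 ^ t))) (Reach⇒Path one t (h zero)))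

  Path⇒Reach : ∀ {n} t {X Y : Vec V n} → Path (Edge p₀ n) (2 ^ t) X Y → Reach t (X , Y)
  Path⇒Reach zero    (e ∷ []) = e
  Path⇒Reach (suc t) p with M , p₁ , p₂ ← split (2 ^ t) p = M , λ where
    zero    → Path⇒Reach t (subst (λ r → Path _ r M _) (ℕₚ.+-identityʳ (2 ^ t)) p₂)
    (suc _) → Path⇒Reach t p₁

  Connected : ∀ {n} → Vec V n × Vec V n → Set
  Connected {n} (X , Y) = ∃ λ r → Path (Edge p₀ n) r X Y

  -- There are `suc d ^ n` windows of `n` columns. The hypothesis makes `c` halvings account for the
  -- `suc d` values of one column, and the table has `c` rows per column plus one.
  enough-levels : suc d ≤ 2 ^ c → ∀ n → suc d ^ n ≤ 2 ^ suc (n * c)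
  enough-levels le n = begin
    suc d ^ n        ≤⟨ ℕₚ.^-monoˡ-≤ n le ⟩
    (2 ^ c) ^ n      ≡⟨ ℕₚ.^-*-assoc 2 c n ⟩
    2 ^ (c * n)      ≡⟨ cong (2 ^_) (ℕₚ.*-comm c n) ⟩
    2 ^ (n * c)      ≤⟨ ℕₚ.^-monoʳ-≤ 2 (ℕₚ.n≤1+n (n * c)) ⟩
    2 ^ suc (n * c)  ∎
    where open ℕₚ.≤-Reasoning

  initial : Word s → Zipper (Q ⊎ Bool) A
  initial w = home (relab (fromℕ k)) (map raw w) (room k (length w))

  symOf-raw : ∀ w → map symOf (map raw w) ≡ map just w
  symOf-raw []      = refl
  symOf-raw (a ∷ w) = cong (just a ∷_) (symOf-raw w)

  decides : Fin d → suc d ≤ 2 ^ c → (∀ n → Edge p₀ n (Vec.replicate n goal) (Vec.replicate n goal)) → ∀ w →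
            ∃ λ (ts : Vec Ticket (width k (length w))) → Padded w (toList (Vec.map proj₁ ts)) ×
            Σ (Dec (Connected (terminals ts))) λ D → ∃ λ ls → ∃ λ rs → initial w ⟶* (inj₂ (does D) ⦂ ls ∣ rs)
  decides one le loop w
    with ts , pad , run ← rounds k (fromℕ k) (Finₚ.toℕ-fromℕ k) (map raw w) 0 (Listₚ.length-map raw w)
                            (0 , trans (symOf-raw w) (sym (Listₚ.++-identityʳ _)))
    = ts , pad , Dec.map′ to from D , ls , rs , (cong (home (relab (fromℕ k)) (map raw w)) (sym (ℕₚ.+-identityʳ _)) ◂ run) ◅◅
      (cong (λ xs → home (scan₀ p₀ nothing) xs 0)
        (cong₂ (λ xs ys → xs ++ csep ∷ ys) (flags-all blk ts) (sym (reset-shape t n))) ◂ run')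
    where
    n = width k (length w)
    t = suc (n * c)
    open Odometer t 0 ts
    D = proj₁ decide
    ls = proj₁ (proj₂ decide)
    rs = proj₁ (proj₂ (proj₂ decide))
    run' = proj₂ (proj₂ (proj₂ decide))
    equiv : Sem (shape t n) φ ⇔ Reach t (terminals ts)
    equiv = Sem-Reach t λ rows e →
      let read = trans (cong (λ r → readRows r n (flat rows)) (sym e)) (readRows-flat rows) in
      mk⇔ (λ h → Equivalence.to (verdict-ends ts rows) (trans (cong (verdict ts) (sym read)) h))
          (λ h → trans (cong (verdict ts) read) (Equivalence.from (verdict-ends ts rows) h))
    to : Sem (shape t n) φ → Connected (terminals ts)
    to h = _ , Reach⇒Path one t (Equivalence.to equiv h)
    from : Connected (terminals ts) → Sem (shape t n) φ
    -- The path is first cut below the number of windows and then padded at the goal to length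
    -- `2 ^ t`.
    from (r , p) with r' , p' , lt ← shorten (finVec (finFin (suc d)) n) r p =
      Equivalence.from equiv (Path⇒Reach t (prolong
        (ℕₚ.≤-trans (ℕₚ.<⇒≤ lt) (ℕₚ.≤-trans (ℕₚ.≤-reflexive (size-finVec (finFin (suc d)) n)) (enough-levels le n)))
        (loop n) p'))

-- Windows of the perturbed machine

module Window {s : ℕ} (M : TM (Sym s)) where

  infix 4 _≟ˢ_
  _≟ˢ_ : (a b : Sym s) → Dec (a ≡ b)
  _≟ˢ_ = Maybeₚ.≡-dec Fin._≟_

  -- Column j of a window holds the symbols at distance j to the right and to the left of the
  -- head.  The state is read off column 0, where nothing stands for acceptance.
  Pair Col : Set
  Pair = Sym s × Sym s
  Col = Maybe (Fin (nQ M)) × Pair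

  abstract
    finCol : Finite Col
    finCol = finMaybe (finFin (nQ M)) ×ᶠ (finMaybe (finFin s) ×ᶠ finMaybe (finFin s))

  d : ℕ
  d = size finCol

  -- The shift places the `d` codes in `Fin (suc d)`, the value set of `Search`. The spare value
  -- `zero` decodes to the same column as `goal`.
  encode : Col → Fin (suc d)
  encode x = suc (enc finCol x)

  decode : Fin (suc d) → Col
  decode zero    = nothing , nothing , nothing
  decode (suc i) = dec finCol i

  decode-encode : ∀ x → decode (encode x) ≡ x
  decode-encode = dec-enc finCol

  data P : Set where
    opening stuck accepted : P
    going : Move → Pair → Pair → P

  abstract
    finP : Finite P
    finP = retract (fin⊤ ⊎ᶠ fin⊤ ⊎ᶠ fin⊤ ⊎ᶠ (finMove ×ᶠ finPair ×ᶠ finPair)) f g gf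
      where
      finPair : Finite Pair
      finPair = finMaybe (finFin s) ×ᶠ finMaybe (finFin s)
      Code : Set
      Code = ⊤ ⊎ ⊤ ⊎ ⊤ ⊎ (Move × Pair × Pair)
      f : P → Code
      f opening         = inj₁ tt
      f stuck         = inj₂ (inj₁ tt)
      f accepted      = inj₂ (inj₂ (inj₁ tt))
      f (going m x y) = inj₂ (inj₂ (inj₂ (m , x , y)))
      g : Code → P
      g (inj₁ _)                         = opening
      g (inj₂ (inj₁ _))                  = stuck
      g (inj₂ (inj₂ (inj₁ _)))           = accepted
      g (inj₂ (inj₂ (inj₂ (m , x , y)))) = going m x y
      gf : ∀ x → g (f x) ≡ x
      gf opening         = refl
      gf stuck         = refl
      gf accepted      = refl
      gf (going m x y) = refl

  -- x, y are the j-th pairs of a window and of its successor, x⁻, y⁻ the previous ones.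
  Fits : Move → (x⁻ y⁻ x y : Pair) → Set
  Fits left  (r⁻ , l⁻) (r'⁻ , l'⁻) (r , l) (r' , l') = r' ≡ r⁻ × l'⁻ ≡ l
  Fits stay  (r⁻ , l⁻) (r'⁻ , l'⁻) (r , l) (r' , l') = r' ≡ r × l' ≡ l
  Fits right (r⁻ , l⁻) (r'⁻ , l'⁻) (r , l) (r' , l') = r'⁻ ≡ r × l' ≡ l⁻

  fits? : ∀ m x⁻ y⁻ x y → Dec (Fits m x⁻ y⁻ x y)
  fits? left  (r⁻ , l⁻) (r'⁻ , l'⁻) (r , l) (r' , l') = (r' ≟ˢ r⁻) ×-dec (l'⁻ ≟ˢ l)
  fits? stay  (r⁻ , l⁻) (r'⁻ , l'⁻) (r , l) (r' , l') = (r' ≟ˢ r) ×-dec (l' ≟ˢ l)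
  fits? right (r⁻ , l⁻) (r'⁻ , l'⁻) (r , l) (r' , l') = (r'⁻ ≟ˢ r) ×-dec (l' ≟ˢ l⁻)

  -- What the later columns cannot check about the newly scanned symbol. After a left or right move
  -- it is an old neighbour and `Fits` compares it in column 1; after `stay` it is the symbol just
  -- written, which occurs in column 0 only.
  First : Move → Sym s → Sym s → Set
  First left  b b' = ⊤
  First stay  b b' = b' ≡ b
  First right b b' = ⊤

  first? : ∀ m b b' → Dec (First m b b')
  first? left  b b' = yes tt
  first? stay  b b' = b' ≟ˢ b
  first? right b b' = yes tt

  fire : Maybe (Fin (nQ M) × Sym s × Move) → Fin (nQ M) → Sym s → P
  fire nothing             q' b' = stuck
  fire (just (q'' , b , m)) q' b' with q'' Fin.≟ q' | first? m b b'
  ... | yes _ | yes _ = going m (b , b) (b' , b')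
  ... | _     | _     = stuck

  stepCol : P → Col → Col → P
  stepCol opening (nothing , _)       (nothing , _)       = accepted
  stepCol opening (just q  , _)       (nothing , _)       = if isF M q then accepted else stuck
  stepCol opening (nothing , _)       (just q' , _)       = stuck
  stepCol opening (just q  , (a , _)) (just q' , (b' , _)) = fire (δ M q a) q' b'
  stepCol stuck    _ _ = stuck
  stepCol accepted _ _ = accepted
  stepCol (going m x⁻ y⁻) (_ , x) (_ , y) = if does (fits? m x⁻ y⁻ x y) then going m x y else stuck

  stepP : P → Fin (suc d) → Fin (suc d) → P
  stepP p v v' = stepCol p (decode v) (decode v')

  out : P → Bool
  out stuck = false
  out _     = true

  ini : Sym s → Fin (suc d)
  ini a = encode (just (q₀ M) , a , nothing)

  -- All accepting windows get an edge to one fixed vertex with a loop. The target of the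
  -- reachability question is then the same in every column and takes no tape.
  goal : Fin (suc d)
  goal = encode (nothing , nothing , nothing)

  open Columns stepP out

  stuck-out : ∀ n {x y} → out (runP stuck n x y) ≡ false
  stuck-out zero    = refl
  stuck-out (suc n) = stuck-out n

  accepted-out : ∀ n {x y} → out (runP accepted n x y) ≡ true
  accepted-out zero    = refl
  accepted-out (suc n) = accepted-out n

  if-fits : ∀ {F : Set} (D : Dec F) p n {x y} → out (runP (if does D then p else stuck) n x y) ≡ true ⇔
            (F × out (runP p n x y) ≡ true)
  if-fits (yes f) p n = mk⇔ (f ,_) proj₂
  if-fits (no ¬f) p n = mk⇔ (λ h → case trans (sym h) (stuck-out n) of λ ()) (λ (f , _) → ⊥-elim (¬f f))

  pair : Fin (suc d) → Pair
  pair v = proj₂ (decode v)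

  going-suc : ∀ m x⁻ y⁻ n (x y : Fin (suc n) → Fin (suc d)) → out (runP (going m x⁻ y⁻) (suc n) x y) ≡ true ⇔
              (Fits m x⁻ y⁻ (pair (x zero)) (pair (y zero)) ×
               out (runP (going m (pair (x zero)) (pair (y zero))) n (x ∘ suc) (y ∘ suc)) ≡ true)
  going-suc m x⁻ y⁻ n x y = if-fits (fits? m x⁻ y⁻ _ _) (going m _ _) n

  fits-going : ∀ m (f g : ℕ → Pair) → (∀ j → Fits m (f j) (g j) (f (suc j)) (g (suc j))) →
               ∀ n x y → (∀ i → pair (x i) ≡ f (suc (toℕ i))) → (∀ i → pair (y i) ≡ g (suc (toℕ i))) →
               out (runP (going m (f 0) (g 0)) n x y) ≡ true
  fits-going m f g fit zero    x y ex ey = refl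
  fits-going m f g fit (suc n) x y ex ey = Equivalence.from (going-suc m (f 0) (g 0) n x y)
    (subst₂ (Fits m (f 0) (g 0)) (sym (ex zero)) (sym (ey zero)) (fit 0) ,
     subst₂ (λ a b → out (runP (going m a b) n (x ∘ suc) (y ∘ suc)) ≡ true) (sym (ex zero)) (sym (ey zero))
       (fits-going m (f ∘ suc) (g ∘ suc) (fit ∘ suc) n (x ∘ suc) (y ∘ suc) (ex ∘ suc) (ey ∘ suc)))

  pairBefore : ∀ {n} → Pair → (Fin n → Fin (suc d)) → Fin n → Pair
  pairBefore y⁻ y zero    = y⁻
  pairBefore y⁻ y (suc i) = pair (y (inject₁ i))

  -- Asymmetric on purpose: the old window comes from a tape and is given by `f`, whereas the
  -- successor is a guessed vector `y` for which a tape is still to be found.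
  going-fits : ∀ m (f : ℕ → Pair) y⁻ n x y → (∀ i → pair (x i) ≡ f (suc (toℕ i))) →
               out (runP (going m (f 0) y⁻) n x y) ≡ true →
               ∀ i → Fits m (f (toℕ i)) (pairBefore y⁻ y i) (f (suc (toℕ i))) (pair (y i))
  going-fits m f y⁻ (suc n) x y ex h i with fit , h' ← Equivalence.to (going-suc m (f 0) y⁻ n x y) h = go i
    where
    rest : ∀ i → Fits m (f (suc (toℕ i))) (pairBefore (pair (y zero)) (y ∘ suc) i) (f (suc (suc (toℕ i)))) (pair (y (suc i)))
    rest = going-fits m (f ∘ suc) (pair (y zero)) n (x ∘ suc) (y ∘ suc) (ex ∘ suc)
             (subst (λ a → out (runP (going m a (pair (y zero))) n (x ∘ suc) (y ∘ suc)) ≡ true) (ex zero) h')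
    go : ∀ i → Fits m (f (toℕ i)) (pairBefore y⁻ y i) (f (suc (toℕ i))) (pair (y i))
    go zero          = subst (λ a → Fits m (f 0) y⁻ a (pair (y zero))) (ex zero) fit
    go (suc zero)    = rest zero
    go (suc (suc i)) = rest (suc i)

  right-+ : ∀ h j → (h ℤ.+ + 1) ℤ.+ j ≡ h ℤ.+ (+ 1 ℤ.+ j)
  right-+ = solveℤ-∀
  right-- : ∀ h j → (h ℤ.+ + 1) ℤ.- (+ 1 ℤ.+ j) ≡ h ℤ.- j
  right-- = solveℤ-∀
  left-+ : ∀ h j → (h ℤ.+ -[1+ 0 ]) ℤ.+ (+ 1 ℤ.+ j) ≡ h ℤ.+ j
  left-+ = solveℤ-∀
  left-- : ∀ h j → (h ℤ.+ -[1+ 0 ]) ℤ.- j ≡ h ℤ.- (+ 1 ℤ.+ j)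
  left-- = solveℤ-∀

  fold : (ℤ → Sym s) → ℤ → ℕ → Pair
  fold u h j = u (h ℤ.+ + j) , u (h ℤ.- + j)

  fold-zero : ∀ u h → fold u h 0 ≡ (u h , u h)
  fold-zero u h = cong (λ i → u i , u i) (ℤₚ.+-identityʳ h)

  fold-fits : ∀ m u h j → Fits m (fold u h j) (fold u (h ℤ.+ moveℤ m) j) (fold u h (suc j)) (fold u (h ℤ.+ moveℤ m) (suc j))
  fold-fits left  u h j = cong u (left-+ h (+ j)) , cong u (left-- h (+ j))
  fold-fits stay  u h j = cong (λ i → u (i ℤ.+ + suc j)) (ℤₚ.+-identityʳ h) , cong (λ i → u (i ℤ.- + suc j)) (ℤₚ.+-identityʳ h)
  fold-fits right u h j = cong u (right-+ h (+ j)) , cong u (right-- h (+ j))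

  column : ∀ {n} → Vec (Fin (suc d)) n → Fin n → Col
  column X i = decode (lookup X i)

  -- The edge test reads the state in column 0 only, and there it ignores the left symbol. Leaving
  -- these entries free admits guessed windows, and the initial one, which `ini` fills with blanks
  -- on the left.
  record Shows {N : ℕ} (X : Vec (Fin (suc d)) (suc N)) (c : Config M) : Set where
    constructor shows
    field
      control : proj₁ (column X zero) ≡ just (state c)
      onRight : ∀ i → proj₁ (proj₂ (column X i)) ≡ tape c (head c ℤ.+ + toℕ i)
      onLeft  : ∀ i → proj₂ (proj₂ (column X (suc i))) ≡ tape c (head c ℤ.- + suc (toℕ i))

  window : (N : ℕ) → Config M → Vec (Fin (suc d)) (suc N)
  window N c = Vec.tabulate (λ i → encode (just (state c) , fold (tape c) (head c) (toℕ i)))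

  column-window : ∀ N c i → column (window N c) i ≡ (just (state c) , fold (tape c) (head c) (toℕ i))
  column-window N c i = trans (cong decode (Vecₚ.lookup∘tabulate (λ i → encode (just (state c) , fold (tape c) (head c) (toℕ i))) i)) (decode-encode _)

  window-shows : ∀ N c → Shows (window N c) c
  window-shows N c = shows (cong proj₁ (column-window N c zero)) (λ i → cong (proj₁ ∘ proj₂) (column-window N c i))
                           (λ i → cong (proj₂ ∘ proj₂) (column-window N c (suc i)))

  ∣h+j-h∣ : ∀ h j → ∣ (h ℤ.+ + j) ℤ.- h ∣ ≡ j
  ∣h+j-h∣ h j = cong ∣_∣ (h+i-h h (+ j))

  ∣h-j-h∣ : ∀ h j → ∣ (h ℤ.- + j) ℤ.- h ∣ ≡ j
  ∣h-j-h∣ h j = trans (cong ∣_∣ (h+i-h h (ℤ.- + j))) (ℤₚ.∣-i∣≡∣i∣ (+ j))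

  apart : ∀ {h p i j k} → ∣ p ℤ.- h ∣ ≡ k → ∣ i ℤ.- h ∣ ≤ j → j < k → i ≢ p
  apart e le lt refl = ℕₚ.<⇒≱ lt (subst (_≤ _) e le)

  off-head : ∀ {h p j} → ∣ p ℤ.- h ∣ ≡ suc j → p ≢ h
  off-head {h} e refl with () ← trans (sym e) (cong ∣_∣ (ℤₚ.+-inverseʳ h))

  module _ {N : ℕ} {X : Vec (Fin (suc d)) (suc N)} {q : Fin (nQ M)} {t : ℤ → Sym s} {h : ℤ}
           (S : Shows X ⟨ q , t , h ⟩) {t' : ℤ → Sym s}
           (agree : ∀ i → ∣ i ℤ.- h ∣ ≤ N → t' i ≡ t i) (b : Sym s) where
    open Shows S

    written : ℤ → Sym s
    written = write t' h b

    scanned : proj₁ (proj₂ (column X zero)) ≡ t' h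
    scanned = trans (onRight zero) (trans (cong t (ℤₚ.+-identityʳ h))
      (sym (agree h (subst (_≤ N) (sym (cong ∣_∣ (ℤₚ.+-inverseʳ h))) z≤n))))

    written-zero : fold written h 0 ≡ (b , b)
    written-zero = trans (fold-zero written h) (cong (λ a → a , a) (write-same t' h b))

    written-suc : ∀ i → pair (lookup X (suc i)) ≡ fold written h (suc (toℕ i))
    written-suc i = cong₂ _,_
      (trans (onRight (suc i)) (sym (trans (write-other t' h b (off-head (∣h+j-h∣ h (suc (toℕ i)))))
        (agree _ (subst (_≤ N) (sym (∣h+j-h∣ h (suc (toℕ i)))) (Finₚ.toℕ<n i))))))
      (trans (onLeft i) (sym (trans (write-other t' h b (off-head (∣h-j-h∣ h (suc (toℕ i)))))
        (agree _ (subst (_≤ N) (sym (∣h-j-h∣ h (suc (toℕ i)))) (Finₚ.toℕ<n i))))))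

  fire-going : ∀ {q' b m b'} → First m b b' → fire (just (q' , b , m)) q' b' ≡ going m (b , b) (b' , b')
  fire-going {q'} {b} {m} {b'} fst with q' Fin.≟ q' | first? m b b'
  ... | yes _ | yes _ = refl
  ... | no q≢ | _     = ⊥-elim (q≢ refl)
  ... | yes _ | no ¬f = ⊥-elim (¬f fst)

  fire-inv : ∀ e q' b' n x y → out (runP (fire e q' b') n x y) ≡ true →
             ∃ λ b → ∃ λ m → e ≡ just (q' , b , m) × First m b b' × out (runP (going m (b , b) (b' , b')) n x y) ≡ true
  fire-inv nothing              q' b' n x y h with () ← trans (sym h) (stuck-out n)
  fire-inv (just (q'' , b , m)) q' b' n x y h with q'' Fin.≟ q' | first? m b b'
  ... | yes refl | yes f = b , m , refl , f , h
  ... | yes _    | no _  with () ← trans (sym h) (stuck-out n)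
  fire-inv (just (q'' , b , m)) q' b' n x y h | no _ | _ with () ← trans (sym h) (stuck-out n)

  opening-fire : ∀ x y {q q'} → proj₁ x ≡ just q → proj₁ y ≡ just q' →
               stepCol opening x y ≡ fire (δ M q (proj₁ (proj₂ x))) q' (proj₁ (proj₂ y))
  opening-fire (_ , _) (_ , _) refl refl = refl

  first-move : ∀ m (u : ℤ → Sym s) h → First m (u h) (u (h ℤ.+ moveℤ m))
  first-move left  u h = tt
  first-move stay  u h = cong u (ℤₚ.+-identityʳ h)
  first-move right u h = tt

  step-edge : ∀ {N} {X : Vec (Fin (suc d)) (suc N)} {c c'} → Shows X c → PStep M N c c' → Edge opening (suc N) X (window N c')
  step-edge {N} {X} {⟨ q , t , h ⟩} S (pstep {t' = t'} agree (step {q' = q'} {b} {m} e)) =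
    trans (cong (λ p → out (runP p N (lookup X ∘ suc) (lookup W ∘ suc))) first-column)
      (fits-going m (fold u h) (fold u h') (fold-fits m u h) N (lookup X ∘ suc) (lookup W ∘ suc)
        (written-suc S agree b) (λ i → cong proj₂ (column-window N c' (suc i))))
    where
    u = written S agree b
    h' = h ℤ.+ moveℤ m
    c' : Config M
    c' = ⟨ q' , u , h' ⟩
    W = window N c'
    w₀ : proj₁ (proj₂ (column W zero)) ≡ u h'
    w₀ = trans (cong (proj₁ ∘ proj₂) (column-window N c' zero)) (cong u (ℤₚ.+-identityʳ h'))
    first-column : stepCol opening (column X zero) (column W zero) ≡ going m (fold u h 0) (fold u h' 0)
    first-column = begin
      stepCol opening (column X zero) (column W zero)
        ≡⟨ opening-fire _ (column W zero) (Shows.control S) (cong proj₁ (column-window N c' zero)) ⟩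
      fire (δ M q (proj₁ (proj₂ (column X zero)))) q' (proj₁ (proj₂ (column W zero)))
        ≡⟨ cong₂ (λ e a → fire e q' a) (trans (cong (δ M q) (scanned S agree b)) e) w₀ ⟩
      fire (just (q' , b , m)) q' (u h')
        ≡⟨ fire-going (subst (λ a → First m a (u h')) (write-same t' h b) (first-move m u h)) ⟩
      going m (b , b) (u h' , u h')
        ≡⟨ cong₂ (going m) (sym (written-zero S agree b)) (sym (fold-zero u h')) ⟩
      going m (fold u h 0) (fold u h' 0) ∎
      where open ≡-Reasoning

  last? : ∀ {n} (i : Fin (suc n)) → (∃ λ j → i ≡ inject₁ j) ⊎ i ≡ fromℕ n
  last? {zero}  zero = inj₂ refl
  last? {suc n} zero = inj₁ (zero , refl)
  last? {suc n} (suc i) with last? i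
  ... | inj₁ (j , refl) = inj₁ (suc j , refl)
  ... | inj₂ refl       = inj₂ refl

  -- The symbol that enters the window on its far side was put there by the perturbation.
  perturbed : Move → (ℤ → Sym s) → ℤ → ℕ → Pair → ℤ → Sym s
  perturbed left  t h N (_ , l) = write t (h ℤ.- + suc N) l
  perturbed stay  t h N _       = t
  perturbed right t h N (r , _) = write t (h ℤ.+ + suc N) r

  perturbed-agree : ∀ m t h N x i → ∣ i ℤ.- h ∣ ≤ N → perturbed m t h N x i ≡ t i
  perturbed-agree left  t h N x i le = write-other t _ _ (apart (∣h-j-h∣ h (suc N)) le ℕₚ.≤-refl)
  perturbed-agree stay  t h N x i le = refl
  perturbed-agree right t h N x i le = write-other t _ _ (apart (∣h+j-h∣ h (suc N)) le ℕₚ.≤-refl)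

  -- The fit at the same or the next column forces every entry of `Y` except the far one on the side
  -- towards which the head moves; `last?` singles that one out, and `perturbed` has written it on
  -- the tape. At least two columns are present because column 1 is what ties the scanned symbol to
  -- the tape after a left or right move.
  successor-shows : ∀ {N} {Y : Vec (Fin (suc d)) (suc (suc N))} {q'} m t h b →
    let u = write (perturbed m t h (suc N) (pair (lookup Y (fromℕ (suc N))))) h b
        b' = proj₁ (proj₂ (column Y zero)) in
    proj₁ (column Y zero) ≡ just q' → First m b b' →
    (∀ i → Fits m (fold u h (toℕ i)) (pairBefore (b' , b') (lookup Y ∘ suc) i) (fold u h (suc (toℕ i))) (pair (lookup Y (suc i)))) →
    Shows Y ⟨ q' , u , h ℤ.+ moveℤ m ⟩
  successor-shows {N} {Y} left t h b qY _ fits = shows qY onR onL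
    where
    u = write (perturbed left t h (suc N) (pair (lookup Y (fromℕ (suc N))))) h b
    onR : ∀ i → proj₁ (proj₂ (column Y i)) ≡ u ((h ℤ.+ -[1+ 0 ]) ℤ.+ + toℕ i)
    onR zero    = trans (proj₂ (fits zero)) (sym (cong u (left-- h (+ 0)) ))
    onR (suc i) = trans (proj₁ (fits i)) (sym (cong u (left-+ h (+ toℕ i))))
    onL : ∀ i → proj₂ (proj₂ (column Y (suc i))) ≡ u ((h ℤ.+ -[1+ 0 ]) ℤ.- + suc (toℕ i))
    onL i with last? i
    ... | inj₁ (j , refl) = trans (proj₂ (fits (suc j))) (sym (cong u (trans (left-- h (+ suc (toℕ (inject₁ j)))) (cong (λ k → h ℤ.- + suc (suc k)) (Finₚ.toℕ-inject₁ j)))))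
    ... | inj₂ refl = sym (trans (cong u (trans (left-- h (+ suc (toℕ (fromℕ N)))) (cong (λ k → h ℤ.- + suc (suc k)) (Finₚ.toℕ-fromℕ N))))
                        (trans (write-other (perturbed left t h (suc N) (pair (lookup Y (fromℕ (suc N))))) h b (off-head (∣h-j-h∣ h (suc (suc N))))) (write-same t (h ℤ.- + suc (suc N)) _)))
  successor-shows {N} {Y} stay t h b qY first fits = shows qY onR onL
    where
    u = write (perturbed stay t h (suc N) (pair (lookup Y (fromℕ (suc N))))) h b
    onR : ∀ i → proj₁ (proj₂ (column Y i)) ≡ u ((h ℤ.+ + 0) ℤ.+ + toℕ i)
    onR zero    = trans first (sym (trans (cong u (trans (ℤₚ.+-identityʳ _) (ℤₚ.+-identityʳ h))) (write-same t h b)))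
    onR (suc i) = trans (proj₁ (fits i)) (sym (cong (λ k → write t h b (k ℤ.+ + suc (toℕ i))) (ℤₚ.+-identityʳ h)))
    onL : ∀ i → proj₂ (proj₂ (column Y (suc i))) ≡ u ((h ℤ.+ + 0) ℤ.- + suc (toℕ i))
    onL i = trans (proj₂ (fits i)) (sym (cong (λ k → write t h b (k ℤ.- + suc (toℕ i))) (ℤₚ.+-identityʳ h)))
  successor-shows {N} {Y} right t h b qY _ fits = shows qY onR onL
    where
    u = write (perturbed right t h (suc N) (pair (lookup Y (fromℕ (suc N))))) h b
    onR : ∀ i → proj₁ (proj₂ (column Y i)) ≡ u ((h ℤ.+ + 1) ℤ.+ + toℕ i)
    onR i with last? i
    ... | inj₁ (zero , refl)  = trans (proj₁ (fits zero)) (sym (cong u (right-+ h (+ 0))))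
    ... | inj₁ (suc j , refl) = trans (proj₁ (fits (suc j))) (sym (cong u (trans (right-+ h (+ suc (toℕ (inject₁ j)))) (cong (λ k → h ℤ.+ + suc (suc k)) (Finₚ.toℕ-inject₁ j)))))
    ... | inj₂ refl = sym (trans (cong u (trans (right-+ h (+ suc (toℕ (fromℕ N)))) (cong (λ k → h ℤ.+ + suc (suc k)) (Finₚ.toℕ-fromℕ N))))
                        (trans (write-other (perturbed right t h (suc N) (pair (lookup Y (fromℕ (suc N))))) h b (off-head (∣h+j-h∣ h (suc (suc N))))) (write-same t (h ℤ.+ + suc (suc N)) _)))
    onL : ∀ i → proj₂ (proj₂ (column Y (suc i))) ≡ u ((h ℤ.+ + 1) ℤ.- + suc (toℕ i))
    onL i = trans (proj₂ (fits i)) (sym (cong u (right-- h (+ toℕ i))))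

  edge-step : ∀ {N} {X Y : Vec (Fin (suc d)) (suc (suc N))} {c q'} → Shows X c → Edge opening (suc (suc N)) X Y →
              proj₁ (column Y zero) ≡ just q' → ∃ λ c' → PStep M (suc N) c c' × Shows Y c'
  edge-step {N} {X} {Y} {⟨ q , t , h ⟩} {q'} S E qY
    with b , m , e , fst , run ← fire-inv (δ M q (proj₁ (proj₂ (column X zero)))) q' (proj₁ (proj₂ (column Y zero))) (suc N) (lookup X ∘ suc) (lookup Y ∘ suc)
           (trans (cong (λ p → out (runP p (suc N) (lookup X ∘ suc) (lookup Y ∘ suc))) (sym (opening-fire _ (column Y zero) (Shows.control S) qY))) E)
    = let b' = proj₁ (proj₂ (column Y zero))
          agree = perturbed-agree m t h (suc N) (pair (lookup Y (fromℕ (suc N))))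
          u = written S agree b
      in
      _ , pstep agree (step (trans (cong (δ M q) (sym (scanned S agree b))) e)) ,
      successor-shows {Y = Y} m t h b qY fst
        (going-fits m (fold u h) (b' , b') (suc N) (lookup X ∘ suc) (lookup Y ∘ suc) (written-suc S agree b)
          (subst (λ a → out (runP (going m a (b' , b')) (suc N) (lookup X ∘ suc) (lookup Y ∘ suc)) ≡ true)
            (sym (written-zero S agree b)) run))

  final-edge : ∀ N x y (X Y : Fin N → Fin (suc d)) {q} → proj₁ x ≡ just q → proj₁ y ≡ nothing →
               out (runP (stepCol opening x y) N X Y) ≡ isF M q
  final-edge N (_ , _) (_ , _) X Y {q = q} refl refl with isF M q
  ... | true  = accepted-out N
  ... | false = stuck-out N

  loop-edge : ∀ N x y (X Y : Fin N → Fin (suc d)) → proj₁ x ≡ nothing → proj₁ y ≡ nothing →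
              out (runP (stepCol opening x y) N X Y) ≡ true
  loop-edge N (_ , _) (_ , _) X Y refl refl = accepted-out N

  goals : ∀ n → Vec (Fin (suc d)) n
  goals n = Vec.replicate n goal

  goal-control : ∀ N → proj₁ (column (goals (suc N)) zero) ≡ nothing
  goal-control N = cong proj₁ (decode-encode _)

  goal-loop : ∀ n → Edge opening n (goals n) (goals n)
  goal-loop zero    = refl
  goal-loop (suc N) = loop-edge N (column (goals (suc N)) zero) _ (lookup (goals (suc N)) ∘ suc) (lookup (goals (suc N)) ∘ suc) (goal-control N) (goal-control N)

  perturbed⇒path : ∀ {N c c'} {X : Vec (Fin (suc d)) (suc N)} → Shows X c → Star (PStep M N) c c' → isF M (state c') ≡ true →
                   ∃ λ r → Path (Edge opening (suc N)) r X (goals (suc N))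
  perturbed⇒path {N} {X = X} S ε acc =
    1 , trans (final-edge N (column X zero) (column (goals (suc N)) zero) (lookup X ∘ suc) (lookup (goals (suc N)) ∘ suc) (Shows.control S) (goal-control N)) acc ∷ []
  perturbed⇒path {N} S (st ◅ sts) acc
    with r , p ← perturbed⇒path (window-shows N _) sts acc = suc r , step-edge S st ∷ p

  -- The path ends in a window without state, so some edge loses the state, and that edge exists
  -- only at an accepting one. The steps before it form the run.
  path⇒perturbed : ∀ {N r c} {X : Vec (Fin (suc d)) (suc (suc N))} → Shows X c →
                   Path (Edge opening (suc (suc N))) r X (goals (suc (suc N))) →
                   ∃ λ c' → Star (PStep M (suc N)) c c' × isF M (state c') ≡ true
  path⇒perturbed {N} S [] with () ← trans (sym (Shows.control S)) (goal-control (suc N))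
  path⇒perturbed {N} {c = c} {X} S (_∷_ {y = Y} e p) with proj₁ (column Y zero) in eq
  ... | nothing = c , ε , trans (sym (final-edge (suc N) (column X zero) (column Y zero) (lookup X ∘ suc) (lookup Y ∘ suc) (Shows.control S) eq)) e
  ... | just q' with c₁ , st , S₁ ← edge-step S e eq with c' , sts , acc ← path⇒perturbed S₁ p = c' , st ◅ sts , acc

-- Polynomial bounds

Polynomial : (ℕ → ℕ) → Set
Polynomial f = ∃ λ p → ∀ m → eval p m ≡ f m

constᴾ : ∀ c → Polynomial (λ _ → c)
constᴾ c = c ∷ [] , λ m → trans (cong (λ x → c + x) (ℕₚ.*-zeroʳ m)) (ℕₚ.+-identityʳ c)

idᴾ : Polynomial id
idᴾ = 0 ∷ 1 ∷ [] , λ m → trans (cong (λ x → m * (1 + x)) (ℕₚ.*-zeroʳ m)) (ℕₚ.*-identityʳ m)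

sumᴾ : Poly → Poly → Poly
sumᴾ []      q       = q
sumᴾ (a ∷ p) []      = a ∷ p
sumᴾ (a ∷ p) (b ∷ q) = a + b ∷ sumᴾ p q

eval-sum : ∀ p q m → eval (sumᴾ p q) m ≡ eval p m + eval q m
eval-sum []      q       m = refl
eval-sum (a ∷ p) []      m = sym (ℕₚ.+-identityʳ _)
eval-sum (a ∷ p) (b ∷ q) m = trans (cong (λ x → a + b + m * x) (eval-sum p q m)) (lem a b m (eval p m) (eval q m))
  where
  lem : ∀ a b m x y → a + b + m * (x + y) ≡ (a + m * x) + (b + m * y)
  lem = solve-∀

scaleᴾ : ℕ → Poly → Poly
scaleᴾ c = map (c *_)

eval-scale : ∀ c p m → eval (scaleᴾ c p) m ≡ c * eval p m
eval-scale c []      m = sym (ℕₚ.*-zeroʳ c)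
eval-scale c (a ∷ p) m = trans (cong (λ x → c * a + m * x) (eval-scale c p m)) (lem c a m (eval p m))
  where
  lem : ∀ c a m x → c * a + m * (c * x) ≡ c * (a + m * x)
  lem = solve-∀

productᴾ : Poly → Poly → Poly
productᴾ []      q = []
productᴾ (a ∷ p) q = sumᴾ (scaleᴾ a q) (0 ∷ productᴾ p q)

eval-product : ∀ p q m → eval (productᴾ p q) m ≡ eval p m * eval q m
eval-product []      q m = refl
eval-product (a ∷ p) q m = begin
  eval (sumᴾ (scaleᴾ a q) (0 ∷ productᴾ p q)) m   ≡⟨ eval-sum (scaleᴾ a q) _ m ⟩
  eval (scaleᴾ a q) m + m * eval (productᴾ p q) m ≡⟨ cong₂ (λ x y → x + m * y) (eval-scale a q m) (eval-product p q m) ⟩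
  a * eval q m + m * (eval p m * eval q m)        ≡⟨ lem a m (eval p m) (eval q m) ⟩
  (a + m * eval p m) * eval q m                   ∎
  where
  open ≡-Reasoning
  lem : ∀ a m x y → a * y + m * (x * y) ≡ (a + m * x) * y
  lem = solve-∀

infixl 6 _+ᴾ_
infixl 7 _*ᴾ_

_+ᴾ_ : ∀ {f g} → Polynomial f → Polynomial g → Polynomial (λ m → f m + g m)
(p , e) +ᴾ (q , e') = sumᴾ p q , λ m → trans (eval-sum p q m) (cong₂ _+_ (e m) (e' m))

_*ᴾ_ : ∀ {f g} → Polynomial f → Polynomial g → Polynomial (λ m → f m * g m)
(p , e) *ᴾ (q , e') = productᴾ p q , λ m → trans (eval-product p q m) (cong₂ _*_ (e m) (e' m))

n<2^n : ∀ n → n < 2 ^ n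
n<2^n zero    = s≤s z≤n
n<2^n (suc n) = begin-strict
  1 + n              <⟨ ℕₚ.+-mono-≤-< (ℕₚ.m^n>0 2 n) (n<2^n n) ⟩
  2 ^ n + 2 ^ n      ≡⟨ cong (λ x → 2 ^ n + x) (sym (ℕₚ.+-identityʳ (2 ^ n))) ⟩
  2 ^ suc n          ∎
  where open ℕₚ.≤-Reasoning

PStep-weaken : {Γ : Set} {M : TM Γ} {m n : ℕ} {c c' : Config M} → m ≤ n → PStep M n c c' → PStep M m c c'
PStep-weaken le (pstep agree st) = pstep (λ i le' → agree i (ℕₚ.≤-trans le' le)) st

-- A space bounded decider from a robust machine

module Forget {s : ℕ} (M : TM (Sym s)) (p : Poly) {L : Language s}
  (exact : ∀ w → L w ⇔ Accepts M w) (robust : ∀ w → L w ⇔ AcceptsPerturbed M (eval p (length w)) w) where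

  open Window M

  -- Rounds that suffice to dominate the polynomial in Horner form: a round more than squares the
  -- width, which pays for one multiplication by the argument, and each unit of a coefficient costs
  -- one further round.
  rank : Poly → ℕ
  rank []      = 1
  rank (a ∷ p) = a + suc (rank p)

  k c : ℕ
  k = rank p
  c = suc d

  open Search s k c d finP opening stepP out ini goal using
    (Q; A; finQ; finCell; next; relab; raw; initial; width; room; grid; Ticket; Padded; Connected; terminals; blanks; decides)
  open Columns stepP out

  robust′ : ∀ w {n} → eval p (length w) ≤ n → L w ⇔ AcceptsPerturbed M n w
  robust′ w le = mk⇔
    (λ l → let (x , run , acc) = Equivalence.to (exact w) l in x , Star.map Step⇒PStep run , acc)
    (λ (x , run , acc) → Equivalence.from (robust w) (x , Star.map (PStep-weaken le) run , acc))

  -- The definition performs the first round first; the estimates need the last round split off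
  -- instead.
  width-suc : ∀ i n → width (suc i) n ≡ width i n + grid (width i n)
  width-suc zero    n = refl
  width-suc (suc i) n = width-suc i (n + grid n)

  grow : ∀ n → suc (n * n + n) ≤ n + grid n
  grow n = begin
    suc (n * n + n)               ≡⟨ lem₁ n ⟩
    n + suc (n * n)               ≤⟨ ℕₚ.+-monoʳ-≤ n (s≤s (ℕₚ.*-mono-≤ (ℕₚ.m≤n⇒m≤1+n (ℕₚ.m≤m*n n c)) (ℕₚ.n≤1+n n))) ⟩
    n + suc (suc (n * c) * suc n) ∎
    where
    open ℕₚ.≤-Reasoning
    lem₁ : ∀ n → suc (n * n + n) ≡ n + suc (n * n)
    lem₁ = solve-∀

  width-suc-≥ : ∀ i n → suc (width i n * width i n + width i n) ≤ width (suc i) n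
  width-suc-≥ i n = subst (suc (width i n * width i n + width i n) ≤_) (sym (width-suc i n)) (grow (width i n))

  width-+ : ∀ a i n → a + width i n ≤ width (a + i) n
  width-+ zero    i n = ℕₚ.≤-refl
  width-+ (suc a) i n = ℕₚ.≤-trans (s≤s (ℕₚ.≤-trans (width-+ a i n) (ℕₚ.m≤n+m _ _))) (width-suc-≥ (a + i) n)

  width-≥ : ∀ i n → n ≤ width i n
  width-≥ zero    n = ℕₚ.≤-refl
  width-≥ (suc i) n = ℕₚ.≤-trans (width-≥ i n) (ℕₚ.≤-trans (ℕₚ.m≤n⇒m≤1+n (ℕₚ.m≤n+m _ _)) (width-suc-≥ i n))

  -- With a surplus of 2 the window has at least the two columns that `path⇒perturbed` requires, and
  -- its radius, one less than its width, is at least `eval p m`.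
  rank-width : ∀ p m → 2 + eval p m ≤ width (rank p) m
  rank-width []      m = subst (2 ≤_) (ℕₚ.+-comm (grid m) m) (s≤s (s≤s z≤n))
  rank-width (a ∷ p) m = begin
    2 + (a + m * eval p m)  ≡⟨ lem a (m * eval p m) ⟩
    a + (2 + m * eval p m)  ≤⟨ ℕₚ.+-monoʳ-≤ a (begin
      2 + m * eval p m        ≡⟨ ℕₚ.+-comm 2 _ ⟩
      m * eval p m + 2        ≤⟨ ℕₚ.+-mono-≤ (ℕₚ.*-mono-≤ (width-≥ (rank p) m) (ℕₚ.≤-trans (ℕₚ.m≤n+m _ 2) (rank-width p m)))
                                             (ℕₚ.≤-trans (ℕₚ.m≤m+n 2 _) (rank-width p m)) ⟩
      W * W + W               ≤⟨ ℕₚ.n≤1+n _ ⟩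
      suc (W * W + W)         ≤⟨ width-suc-≥ (rank p) m ⟩
      width (suc (rank p)) m  ∎) ⟩
    a + width (suc (rank p)) m  ≤⟨ width-+ a (suc (rank p)) m ⟩
    width (a + suc (rank p)) m  ∎
    where
    open ℕₚ.≤-Reasoning
    W = width (rank p) m
    lem : ∀ a x → 2 + (a + x) ≡ a + (2 + x)
    lem = solve-∀

  gridᴾ : ∀ {f} → Polynomial f → Polynomial (grid ∘ f)
  gridᴾ f = constᴾ 1 +ᴾ (constᴾ 1 +ᴾ f *ᴾ constᴾ c) *ᴾ (constᴾ 1 +ᴾ f)

  roomᴾ : ∀ i {f} → Polynomial f → Polynomial (room i ∘ f)
  roomᴾ zero    f = gridᴾ f
  roomᴾ (suc i) f = gridᴾ f +ᴾ roomᴾ i (f +ᴾ gridᴾ f)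

  sizeᴾ : Polynomial (λ m → 1 + (m + (1 + room k m)))
  sizeᴾ = constᴾ 1 +ᴾ (idᴾ +ᴾ (constᴾ 1 +ᴾ roomᴾ k idᴾ))

  nth-toList : ∀ {X : Set} {n} (xs : Vec X n) i → nth (toList xs) (toℕ i) ≡ just (lookup xs i)
  nth-toList (x ∷ xs) zero    = refl
  nth-toList (x ∷ xs) (suc i) = nth-toList xs i

  nth-Padded : ∀ (w : Word s) r i {a : Sym s} → nth (map just w ++ replicate r nothing) i ≡ just a → initTape nothing just w (+ i) ≡ a
  nth-Padded []      (suc r) zero    refl = refl
  nth-Padded []      (suc r) (suc i) e    = nth-Padded [] r i e
  nth-Padded (x ∷ w) r       zero    refl = refl
  nth-Padded (x ∷ w) r       (suc i) e    = nth-Padded w r i e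

  terminals-show : ∀ {n w} (ts : Vec Ticket (suc n)) → Padded w (toList (Vec.map proj₁ ts)) →
                   Shows (proj₁ (terminals ts)) (init M w)
  terminals-show {n} {w} ts (r , e) = shows (cong proj₁ (col zero)) onR (λ i → cong (proj₂ ∘ proj₂) (col (suc i)))
    where
    col : ∀ i → column (proj₁ (terminals ts)) i ≡ (just (q₀ M) , proj₁ (lookup ts i) , nothing)
    col i = trans (cong decode (Vecₚ.lookup-map i (ini ∘ proj₁) ts)) (decode-encode _)
    onR : ∀ i → proj₁ (proj₂ (column (proj₁ (terminals ts)) i)) ≡ initTape nothing just w (+ toℕ i)
    onR i = trans (cong (proj₁ ∘ proj₂) (col i)) (sym (nth-Padded w r (toℕ i)
      (trans (cong (λ xs → nth xs (toℕ i)) (sym e)) (trans (nth-toList (Vec.map proj₁ ts) i) (cong just (Vecₚ.lookup-map i proj₁ ts))))))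

  connected : ∀ w n (ts : Vec Ticket n) → Padded w (toList (Vec.map proj₁ ts)) → 2 + eval p (length w) ≤ n →
              Connected (terminals ts) ⇔ L w
  connected w (suc (suc N)) ts pad (s≤s (s≤s le)) = mk⇔
    (λ (r , path) → Equivalence.from (robust′ w (ℕₚ.m≤n⇒m≤1+n le)) (path⇒perturbed S path))
    (λ l → let (x , run , acc) = Equivalence.to (robust′ w (ℕₚ.m≤n⇒m≤1+n le)) l in perturbed⇒path S run acc)
    where S = terminals-show ts pad

  finA : Finite A
  finA = finMaybe finCell

  open Compile finQ next (relab (fromℕ k)) (enc finA) (dec finA) (dec-enc finA)

  module Decision (w : Word s) where

    m : ℕ
    m = length w

    decision : Σ (Dec (L w)) λ D → ∃ λ ls → ∃ λ rs → Star (Zippers._⟶_ next) (initial w) (inj₂ (does D) ⦂ ls ∣ rs)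
    decision = Dec.map (connected w (width k m) (proj₁ D) (proj₁ (proj₂ D)) (rank-width p m)) (proj₁ (proj₂ (proj₂ D))) ,
               proj₂ (proj₂ (proj₂ D))
      -- Any column shows that `Fin d` is inhabited, and `c = suc d` satisfies `suc d ≤ 2 ^ c`.
      where D = decides (enc finCol (nothing , nothing , nothing)) (ℕₚ.<⇒≤ (n<2^n c)) goal-loop w

    start-rep : Rep 1 (initial w) (initConfig machine (enc finA nothing) (enc finA ∘ just ∘ raw) w)
    start-rep = Rep-start (initTape-RepL nothing (just ∘ raw) w 0 1)
      (subst (RepR _ (+ 0)) (cong (_++ blanks (suc (room k m))) (Listₚ.map-∘ w))
        (initTape-RepR nothing (just ∘ raw) w (suc (room k m))))

    open Outcome (proj₂ (proj₂ (proj₂ decision))) start-rep public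

    extent-initial : extent (initial w) ≡ eval (proj₁ sizeᴾ) m
    extent-initial = trans (cong suc (trans (Listₚ.length-++ (map just (map raw w)))
      (cong₂ _+_ (trans (Listₚ.length-map just (map raw w)) (Listₚ.length-map raw w))
        (Listₚ.length-replicate (suc (room k m)))))) (sym (proj₂ sizeᴾ m))

  pspace : PSPACE L
  pspace = record
    { g = size finA ; blank = enc finA nothing ; emb = enc finA ∘ just ∘ raw
    ; emb-inj = λ e → raw-injective (enc-injective finA {just (raw _)} {just (raw _)} e)
    ; emb-nb = λ a e → case enc-injective finA {just (raw a)} {nothing} e of λ ()
    ; M = machine ; p = proj₁ sizeᴾ
    ; halts = λ w → let (x , run , F , R) = Decision.reaches w in x , run , verdict-dec (proj₁ (Decision.decision w)) F R
    ; space = λ w x run → subst (∣ head x ∣ ≤_) (Decision.extent-initial w)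
        (Decision.bounded w (s≤s z≤n) (Star.map Step⇒PStep run))
    ; decides-sound = λ w l → let (x , run , F , _) = Decision.reaches w in x , run , trans F (Dec.dec-true (proj₁ (Decision.decision w)) l)
    ; decides-complete = λ w (x , run , acc) → holds (proj₁ (Decision.decision w))
        (Decision.accepts⇒ w ℕₚ.≤-refl (Star.map Step⇒PStep run) acc) }
    where
    raw-injective : ∀ {a b} → _≡_ {A = A} (just (raw a)) (just (raw b)) → a ≡ b
    raw-injective refl = refl
    verdict-dec : ∀ {S F R} (D : Dec S) → F ≡ does D → R ≡ not (does D) → F ≡ true ⊎ R ≡ true
    verdict-dec (yes _) e e' = inj₁ e
    verdict-dec (no _)  e e' = inj₂ e'
    holds : ∀ {S} (D : Dec S) → does D ≡ true → S
    holds (yes x) _ = x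

-- Recoding the tape alphabet

module Halting {Γ : Set} (M : TM Γ) where

  halted-as : Bool → Fin (nQ M) → Set
  halted-as true  q = isF M q ≡ true
  halted-as false q = isR M q ≡ true

  closed* : ∀ v {c c'} → Star (Step M) c c' → halted-as v (state c) → halted-as v (state c')
  closed* v     ε              h = h
  closed* true  (step e ◅ sts) h = closed* true sts (closedF M _ _ _ _ _ e h)
  closed* false (step e ◅ sts) h = closed* false sts (closedR M _ _ _ _ _ e h)

  exclusive : ∀ {q} v v' → halted-as v q → halted-as v' q → v ≡ v'
  exclusive true  true  h h' = refl
  exclusive false false h h' = refl
  exclusive {q} true  false h h' = case trans (sym h') (disjoint M q h) of λ ()
  exclusive {q} false true  h h' = case trans (sym h) (disjoint M q h') of λ ()

  compare : {c c₁ c₂ : Config M} → Star (Step M) c c₁ → Star (Step M) c c₂ →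
            Star (Step M) c₁ c₂ ⊎ Star (Step M) c₂ c₁
  compare ε          run′         = inj₁ run′
  compare run        ε            = inj₂ run
  compare (st ◅ run) (st′ ◅ run′) with refl ← Step-deterministic st st′ = compare run run′

module Blocks {s g : ℕ} (blank : Fin (suc g)) (emb : Fin (suc s) → Fin (suc g)) (emb-nb : ∀ a → emb a ≢ blank)
              (M : TM (Fin (suc g))) where

  G : Set
  G = Fin (suc g)

  A : Set
  A = Sym (suc s)

  -- Tags of the machine that works on blocks: seek₀, seek and ret carry an input letter to the
  -- far end of the blocks written so far and come back, s₀ and s₁ go to the first block.
  data Tag : Set where
    seek₀ seek   : Fin (suc s) → Tag
    ret exit s₀ s₁ : Tag
    sim          : Fin (nQ M) → Tag

  data Goal : Set where
    emit  : Tag → G → Move → Goal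
    visit : Tag → Goal

  Count Far : Set
  Count = Fin (suc (suc g))
  Far   = Fin (suc (suc g + suc g))

  data Q : Set where
    r₁ r₂ : Q
    r₃    : Fin (suc s) → Q
    rd    : Tag → G → Count → Q
    wr    : Tag → G → Move → Count → Q
    ml    : Far → Goal → Q

  abstract
    finTag : Finite Tag
    finTag = retract (F ⊎ᶠ F ⊎ᶠ fin⊤ ⊎ᶠ fin⊤ ⊎ᶠ fin⊤ ⊎ᶠ fin⊤ ⊎ᶠ finFin (nQ M)) f h hf
      where
      F : Finite (Fin (suc s))
      F = finFin (suc s)
      Code : Set
      Code = Fin (suc s) ⊎ Fin (suc s) ⊎ ⊤ ⊎ ⊤ ⊎ ⊤ ⊎ ⊤ ⊎ Fin (nQ M)
      f : Tag → Code
      f (seek₀ a) = inj₁ a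
      f (seek a)  = inj₂ (inj₁ a)
      f ret       = inj₂ (inj₂ (inj₁ tt))
      f exit      = inj₂ (inj₂ (inj₂ (inj₁ tt)))
      f s₀        = inj₂ (inj₂ (inj₂ (inj₂ (inj₁ tt))))
      f s₁        = inj₂ (inj₂ (inj₂ (inj₂ (inj₂ (inj₁ tt)))))
      f (sim q)   = inj₂ (inj₂ (inj₂ (inj₂ (inj₂ (inj₂ q)))))
      h : Code → Tag
      h (inj₁ a)                                    = seek₀ a
      h (inj₂ (inj₁ a))                             = seek a
      h (inj₂ (inj₂ (inj₁ _)))                      = ret
      h (inj₂ (inj₂ (inj₂ (inj₁ _))))               = exit
      h (inj₂ (inj₂ (inj₂ (inj₂ (inj₁ _)))))        = s₀
      h (inj₂ (inj₂ (inj₂ (inj₂ (inj₂ (inj₁ _)))))) = s₁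
      h (inj₂ (inj₂ (inj₂ (inj₂ (inj₂ (inj₂ q)))))) = sim q
      hf : ∀ x → h (f x) ≡ x
      hf (seek₀ a) = refl
      hf (seek a)  = refl
      hf ret       = refl
      hf exit      = refl
      hf s₀        = refl
      hf s₁        = refl
      hf (sim q)   = refl

    finGoal : Finite Goal
    finGoal = retract ((finTag ×ᶠ finFin (suc g) ×ᶠ finMove) ⊎ᶠ finTag) f h hf
      where
      Code : Set
      Code = (Tag × G × Move) ⊎ Tag
      f : Goal → Code
      f (emit t y m) = inj₁ (t , y , m)
      f (visit t)    = inj₂ t
      h : Code → Goal
      h (inj₁ (t , y , m)) = emit t y m
      h (inj₂ t)           = visit t
      hf : ∀ x → h (f x) ≡ x
      hf (emit t y m) = refl
      hf (visit t)    = refl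

    finQ : Finite Q
    finQ = retract (fin⊤ ⊎ᶠ fin⊤ ⊎ᶠ finFin (suc s) ⊎ᶠ (finTag ×ᶠ finFin (suc g) ×ᶠ finFin (suc (suc g))) ⊎ᶠ
                    (finTag ×ᶠ finFin (suc g) ×ᶠ finMove ×ᶠ finFin (suc (suc g))) ⊎ᶠ
                    (finFin (suc (suc g + suc g)) ×ᶠ finGoal)) f h hf
      where
      Code : Set
      Code = ⊤ ⊎ ⊤ ⊎ Fin (suc s) ⊎ (Tag × G × Count) ⊎ (Tag × G × Move × Count) ⊎ (Far × Goal)
      f : Q → Code
      f r₁           = inj₁ tt
      f r₂           = inj₂ (inj₁ tt)
      f (r₃ a)       = inj₂ (inj₂ (inj₁ a))
      f (rd t x r)   = inj₂ (inj₂ (inj₂ (inj₁ (t , x , r))))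
      f (wr t y m r) = inj₂ (inj₂ (inj₂ (inj₂ (inj₁ (t , y , m , r)))))
      f (ml r k)     = inj₂ (inj₂ (inj₂ (inj₂ (inj₂ (r , k)))))
      h : Code → Q
      h (inj₁ _)                                      = r₁
      h (inj₂ (inj₁ _))                               = r₂
      h (inj₂ (inj₂ (inj₁ a)))                        = r₃ a
      h (inj₂ (inj₂ (inj₂ (inj₁ (t , x , r)))))       = rd t x r
      h (inj₂ (inj₂ (inj₂ (inj₂ (inj₁ (t , y , m , r)))))) = wr t y m r
      h (inj₂ (inj₂ (inj₂ (inj₂ (inj₂ (r , k))))))    = ml r k
      hf : ∀ x → h (f x) ≡ x
      hf r₁           = refl
      hf r₂           = refl
      hf (r₃ a)       = refl
      hf (rd t x r)   = refl
      hf (wr t y m r) = refl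
      hf (ml r k)     = refl

  halting : Fin (nQ M) → Bool
  halting q = isF M q ∨ isR M q

  simulate : Maybe (Fin (nQ M) × G × Move) → Maybe ((Tag ⊎ Bool) × G × Move)
  simulate = Maybe.map (λ (q , y , m) → inj₁ (sim q) , y , m)

  ifBlank : {X : Set} → G → X → X → X
  ifBlank x a b = if does (x Fin.≟ blank) then a else b

  -- One blank block always separates the blocks from the unread input. `seek₀` and `s₀` step over
  -- it, so that the next blank block met is the far end of the written ones; `emb-nb` ensures that
  -- no letter is mistaken for an end.
  nextTag : Rule Tag G
  nextTag (seek₀ a) x = just (inj₁ (seek a) , x , left)
  nextTag (seek a)  x = ifBlank x (just (inj₁ ret , emb a , right)) (just (inj₁ (seek a) , x , left))
  nextTag ret       x = ifBlank x (just (inj₁ exit , x , right)) (just (inj₁ ret , x , right))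
  nextTag exit      x = nothing
  nextTag s₀        x = just (inj₁ s₁ , x , left)
  nextTag s₁        x = ifBlank x (just (inj₁ (sim (q₀ M)) , x , right)) (just (inj₁ s₁ , x , left))
  nextTag (sim q)   x = if halting q then nothing else simulate (δ M q x)

  full : Count
  full = fromℕ (suc g)

  -- Halting is tested on entering a state, before a block is read, so the simulation stops at the
  -- first halting state even if the simulated machine would continue.
  enter : Tag → Q ⊎ Bool
  enter exit    = inj₁ r₁
  enter (sim q) = if halting q then inj₂ (isF M q) else inj₁ (rd (sim q) blank full)
  enter t       = inj₁ (rd t blank full)

  -- One-hot code, except that the blank becomes a block of blanks: unvisited tape needs no recoding.
  bit : G → ℕ → A
  bit x r = ifBlank x nothing (mark (toℕ x ℕ.≟ r))
    where
    mark : {S : Set} → Dec S → A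
    mark (yes _) = just zero
    mark (no _)  = nothing

  -- The distance from the right end of the written block to the next block to be read.
  shift : Move → Far
  shift left  = fromℕ (suc g + suc g)
  shift stay  = full Fin.↑ˡ suc g
  shift right = zero

  -- `g` moves lead from the last cell of a block to its first.
  short : Far
  short = inject₁ (fromℕ g) Fin.↑ˡ suc g

  pick : G → A → G → G
  pick r nothing  x = x
  pick r (just _) x = r

  -- Reading ends one cell past the block. Whatever the simulated move is, the head first returns
  -- over the whole block in order to overwrite it.
  act : Maybe ((Tag ⊎ Bool) × G × Move) → A → Maybe ((Q ⊎ Bool) × A × Move)
  act (just (inj₁ t , y , m)) c = just (inj₁ (ml (shift stay) (emit t y m)) , c , stay)
  act _                       c = nothing

  after : Goal → Q ⊎ Bool
  after (visit t)    = enter t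
  after (emit t y m) = inj₁ (wr t y m full)

  next : Rule Q A
  next r₁               (just a) = just (inj₁ r₁ , just a , right)
  next r₁               nothing  = just (inj₁ r₂ , nothing , left)
  next r₂               (just a) = just (inj₁ (r₃ a) , nothing , left)
  next r₂               nothing  = just (inj₁ (ml short (visit s₀)) , nothing , stay)
  next (r₃ a)           (just b) = just (inj₁ (r₃ a) , just b , left)
  next (r₃ a)           nothing  = just (inj₁ (ml short (visit (seek₀ a))) , nothing , stay)
  next (rd t x (suc r)) c        = just (inj₁ (rd t (pick r c x) (inject₁ r)) , c , right)
  next (rd t x zero)    c        = act (nextTag t x) c
  next (wr t y m (suc r)) c      = just (inj₁ (wr t y m (inject₁ r)) , bit y (toℕ r) , right)
  next (wr t y m zero)  c        = just (inj₁ (ml (shift m) (visit t)) , c , stay)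
  next (ml (suc r) k)   c        = just (inj₁ (ml (inject₁ r) k) , c , left)
  next (ml zero k)      c        = just (after k , c , stay)

  -- Correctness of the block simulation and of the transfer of the input

  module Z = Zippers next
  module B = Zippers nextTag
  open Z using (goL; goS; goR)

  bits : G → ℕ → List A
  bits x zero    = []
  bits x (suc r) = bit x r ∷ bits x r

  code : G → List A
  code x = bits x (suc g)

  length-bits : ∀ x r → length (bits x r) ≡ r
  length-bits x zero    = refl
  length-bits x (suc r) = cong suc (length-bits x r)

  ifBlank-yes : ∀ {X : Set} {a b : X} → ifBlank blank a b ≡ a
  ifBlank-yes with blank Fin.≟ blank
  ... | yes _ = refl
  ... | no n  = ⊥-elim (n refl)

  ifBlank-no : ∀ {X : Set} {x} {a b : X} → x ≢ blank → ifBlank x a b ≡ b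
  ifBlank-no {x = x} n with x Fin.≟ blank
  ... | yes e = ⊥-elim (n e)
  ... | no _  = refl

  bits-blank : ∀ r → bits blank r ≡ replicate r nothing
  bits-blank zero    = refl
  bits-blank (suc r) = cong₂ _∷_ ifBlank-yes (bits-blank r)

  -- What is known of the accumulator x′ while the block of x is read: it is x, or the mark of x
  -- is still ahead.
  Pending : ℕ → G → G → Set
  Pending r x x′ = x ≡ x′ ⊎ (toℕ x < r × x ≢ blank)

  pick-pending : ∀ x x′ (r : G) → Pending (suc (toℕ r)) x x′ → Pending (toℕ r) x (pick r (bit x (toℕ r)) x′)
  pick-pending x x′ r p with x Fin.≟ blank
  pick-pending x x′ r (inj₁ e)       | yes b = inj₁ e
  pick-pending x x′ r (inj₂ (_ , n)) | yes b = ⊥-elim (n b)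
  ... | no n with toℕ x ℕ.≟ toℕ r
  ...   | yes e = inj₁ (Finₚ.toℕ-injective e)
  pick-pending x x′ r (inj₁ e)              | no n | no ≢ = inj₁ e
  pick-pending x x′ r (inj₂ (s≤s le , _)) | no n | no ≢ = inj₂ (ℕₚ.≤∧≢⇒< le ≢ , n)

  pending-start : ∀ x → Pending (suc g) x blank
  pending-start x with x Fin.≟ blank
  ... | yes e = inj₁ e
  ... | no n  = inj₂ (Finₚ.toℕ<n x , n)

  read : ∀ n (r : Count) → toℕ r ≡ n → ∀ {t x x′ ls rs} → Pending n x x′ →
         (inj₁ (rd t x′ r) ⦂ ls ∣ bits x n ++ rs) Z.⟶* (inj₁ (rd t x zero) ⦂ bits x n ʳ++ ls ∣ rs)
  read zero    zero    e (inj₁ refl)    = ε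
  read zero    zero    e (inj₂ (() , _))
  read (suc n) (suc r) refl {x = x} {x′} p =
    goR refl ◅ read (toℕ r) (inject₁ r) (Finₚ.toℕ-inject₁ r) (pick-pending x x′ r p)

  overwrite : ∀ n (r : Count) → toℕ r ≡ n → ∀ {t y m ls rs} cs → length cs ≡ n →
              (inj₁ (wr t y m r) ⦂ ls ∣ cs ++ rs) Z.⟶* (inj₁ (wr t y m zero) ⦂ bits y n ʳ++ ls ∣ rs)
  overwrite zero    zero    e    []       e′ = ε
  overwrite (suc n) (suc r) refl (c ∷ cs) e′ =
    goR refl ◅ overwrite (toℕ r) (inject₁ r) (Finₚ.toℕ-inject₁ r) cs (ℕₚ.suc-injective e′)

  walk-left : ∀ (r : Far) {k} xs {ls c rs} → toℕ r ≡ length xs →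
              (inj₁ (ml r k) ⦂ xs ++ ls ∣ c ∷ rs) Z.⟶* (after k ⦂ ls ∣ xs ʳ++ (c ∷ rs))
  walk-left r xs e = go (length xs) r xs e refl
    where
    go : ∀ n (r : Far) {k} xs {ls c rs} → toℕ r ≡ n → length xs ≡ n →
         (inj₁ (ml r k) ⦂ xs ++ ls ∣ c ∷ rs) Z.⟶* (after k ⦂ ls ∣ xs ʳ++ (c ∷ rs))
    go zero    zero    []       e e′ = goS refl ◅ ε
    go (suc n) (suc r) (x ∷ xs) e e′ =
      goL refl ◅ go n (inject₁ r) xs (trans (Finₚ.toℕ-inject₁ r) (ℕₚ.suc-injective e)) (ℕₚ.suc-injective e′)

  walk-back : ∀ (r : Far) {k} cs {ls c rs} → toℕ r ≡ length cs →
              (inj₁ (ml r k) ⦂ cs ʳ++ ls ∣ c ∷ rs) Z.⟶* (after k ⦂ ls ∣ cs ++ (c ∷ rs))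
  walk-back r {k} cs {ls} {c} {rs} e =
    cong (inj₁ (ml r k) ⦂_∣ c ∷ rs) (Listₚ.ʳ++-defn cs) Z.◂
    walk-left r (reverse cs) (trans e (sym (Listₚ.length-reverse cs))) Z.▸
    cong (after k ⦂ ls ∣_) (Listₚ.ʳ++-ʳ++ cs {ys = []})

  block : ∀ {t x t' y m ls c rs} → nextTag t x ≡ just (inj₁ t' , y , m) →
          (inj₁ (rd t blank full) ⦂ ls ∣ code x ++ c ∷ rs) Z.⟶* (inj₁ (ml (shift m) (visit t')) ⦂ code y ʳ++ ls ∣ c ∷ rs)
  block {t} {x} {t'} {y} {m} {c = c} n =
    read (suc g) full (Finₚ.toℕ-fromℕ (suc g)) (pending-start x) ◅◅
    goS (cong (λ a → act a c) n) ◅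
    walk-back (shift stay) (code x) (trans (Finₚ.toℕ-↑ˡ full (suc g)) (trans (Finₚ.toℕ-fromℕ (suc g)) (sym (length-bits x (suc g))))) ◅◅
    overwrite (suc g) full (Finₚ.toℕ-fromℕ (suc g)) (code x) (length-bits x (suc g)) ◅◅
    goS refl ◅ ε

  lhsOf : List G → List A
  lhsOf []       = []
  lhsOf (b ∷ bs) = code b ʳ++ lhsOf bs

  rhsOf : List A → List G → List A
  rhsOf R []       = R
  rhsOf R (b ∷ bs) = code b ++ rhsOf R bs

  Nonempty : List A → Set
  Nonempty xs = ∃ λ c → ∃ λ cs → xs ≡ c ∷ cs

  -- After the rightmost block has been read, the head stands on the cell behind it. A nonempty rest
  -- `R` keeps that cell within the stretch.
  module Layout {R : List A} (R≢[] : Nonempty R) where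

    rhsOf-nonempty : ∀ bs → Nonempty (rhsOf R bs)
    rhsOf-nonempty []       = R≢[]
    rhsOf-nonempty (b ∷ bs) = _ , _ , refl

    enter-rd : ∀ t x {a} → nextTag t x ≡ just a → enter t ≡ inj₁ (rd t blank full)
    enter-rd (seek₀ a) x e = refl
    enter-rd (seek a)  x e = refl
    enter-rd ret       x e = refl
    enter-rd s₀        x e = refl
    enter-rd s₁        x e = refl
    enter-rd (sim q)   x e with halting q
    ... | false = refl

    cells : Tag → List G → List G → Zipper (Q ⊎ Bool) A
    cells t ls rs = enter t ⦂ lhsOf ls ∣ rhsOf R rs

    block-step : ∀ t {t' x y m} ls rs → nextTag t x ≡ just (inj₁ t' , y , m) →
                 cells t ls (x ∷ rs) Z.⟶* (inj₁ (ml (shift m) (visit t')) ⦂ code y ʳ++ lhsOf ls ∣ rhsOf R rs)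
    block-step t {t'} {x} {y} {m} ls rs n with c , cs , e ← rhsOf-nonempty rs =
      cong₂ (λ q zs → q ⦂ lhsOf ls ∣ code x ++ zs) (enter-rd t x n) e Z.◂ block n Z.▸
      cong (inj₁ (ml (shift m) (visit t')) ⦂ code y ʳ++ lhsOf ls ∣_) (sym e)

    back-step : ∀ {t} (r : Far) cs ls rs → toℕ r ≡ length cs →
                (inj₁ (ml r (visit t)) ⦂ cs ʳ++ ls ∣ rhsOf R rs) Z.⟶* (enter t ⦂ ls ∣ cs ++ rhsOf R rs)
    back-step {t} r cs ls rs e with c , cs' , e' ← rhsOf-nonempty rs =
      cong (inj₁ (ml r (visit t)) ⦂ cs ʳ++ ls ∣_) e' Z.◂ walk-back r cs e Z.▸
      cong (λ zs → enter t ⦂ ls ∣ cs ++ zs) (sym e')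

    simulates : ∀ {t t' ls ls' rs rs'} → (inj₁ t ⦂ ls ∣ rs) B.⟶ (inj₁ t' ⦂ ls' ∣ rs') →
                cells t ls rs Z.⟶* cells t' ls' rs'
    simulates {t} {t'} (B.goL {b = y} {l} {ls} {rs} n) = block-step t (l ∷ ls) rs n ◅◅
      (cong (inj₁ (ml (shift left) (visit t')) ⦂_∣ rhsOf R rs) (sym (Listₚ.++-ʳ++ (code l))) Z.◂
       back-step (shift left) (code l ++ code y) (lhsOf ls) rs
        (trans (Finₚ.toℕ-fromℕ (suc g + suc g)) (sym (trans (Listₚ.length-++ (code l)) (cong₂ _+_ (length-bits l (suc g)) (length-bits y (suc g)))))) Z.▸
       cong (enter t' ⦂ lhsOf ls ∣_) (Listₚ.++-assoc (code l) (code y) (rhsOf R rs)))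
    simulates {t} (B.goS {b = y} {ls} {rs} n) = block-step t ls rs n ◅◅
      back-step (shift stay) (code y) (lhsOf ls) rs
        (trans (Finₚ.toℕ-↑ˡ full (suc g)) (trans (Finₚ.toℕ-fromℕ (suc g)) (sym (length-bits y (suc g)))))
    simulates {t} (B.goR {ls = ls} {rs} n) = block-step t ls rs n ◅◅ back-step zero [] _ rs refl

    simulates* : ∀ {t t' ls ls' rs rs'} → (inj₁ t ⦂ ls ∣ rs) B.⟶* (inj₁ t' ⦂ ls' ∣ rs') →
                 cells t ls rs Z.⟶* cells t' ls' rs'
    simulates* ε = ε
    simulates* (_◅_ {j = inj₁ _ ⦂ _ ∣ _} st run) = simulates st ◅◅ simulates* run
    simulates* (_◅_ {j = inj₂ _ ⦂ _ ∣ _} st (() ◅ _))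

  replicate-shift : ∀ {X : Set} n {x : X} {ys} → replicate n x ++ x ∷ ys ≡ x ∷ replicate n x ++ ys
  replicate-shift zero    = refl
  replicate-shift (suc n) = cong (_ ∷_) (replicate-shift n)

  replicate-ʳ++ : ∀ {X : Set} n {x : X} {ys} → replicate n x ʳ++ ys ≡ replicate n x ++ ys
  replicate-ʳ++ zero    = refl
  replicate-ʳ++ (suc n) = trans (replicate-ʳ++ n) (replicate-shift n)

  reverse-ʳ++ : ∀ {X : Set} (xs : List X) {ys} → reverse xs ʳ++ ys ≡ xs ++ ys
  reverse-ʳ++ xs = Listₚ.ʳ++-ʳ++ xs {ys = []}

  nothings : ∀ m {k} → replicate {A = A} (m + k) nothing ≡ replicate m nothing ++ replicate k nothing
  nothings zero    = refl
  nothings (suc m) = cong (nothing ∷_) (nothings m)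

  lhsOf-blank : ∀ bs → lhsOf (blank ∷ bs) ≡ nothing ∷ replicate g nothing ++ lhsOf bs
  lhsOf-blank bs = trans (cong (_ʳ++ lhsOf bs) (bits-blank (suc g))) (replicate-ʳ++ (suc g))

  gap : ∀ {R} → replicate g nothing ʳ++ (nothing ∷ R) ≡ rhsOf R (blank ∷ [])
  gap {R} = trans (replicate-ʳ++ g) (trans (replicate-shift g) (cong (_++ R) (sym (bits-blank (suc g)))))

  rhsOf-blanks : ∀ n → rhsOf (nothing ∷ []) (replicate n blank) ≡ nothing ∷ replicate (n * suc g) nothing
  rhsOf-blanks zero    = refl
  rhsOf-blanks (suc n) = begin
    code blank ++ rhsOf (nothing ∷ []) (replicate n blank)                 ≡⟨ cong₂ _++_ (bits-blank (suc g)) (rhsOf-blanks n) ⟩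
    replicate (suc g) nothing ++ nothing ∷ replicate (n * suc g) nothing   ≡⟨ replicate-shift (suc g) ⟩
    nothing ∷ replicate (suc g) nothing ++ replicate (n * suc g) nothing   ≡⟨ cong (nothing ∷_) (sym (nothings (suc g))) ⟩
    nothing ∷ replicate (suc g + n * suc g) nothing                        ∎
    where open ≡-Reasoning

  length-lhsOf : ∀ bs → length (lhsOf bs) ≡ length bs * suc g
  length-lhsOf []       = refl
  length-lhsOf (b ∷ bs) = trans (Listₚ.length-ʳ++ (code b)) (cong₂ _+_ (length-bits b (suc g)) (length-lhsOf bs))

  lhsOf-blanks : ∀ n → lhsOf (replicate n blank) ≡ replicate (length (lhsOf (replicate n blank))) nothing
  lhsOf-blanks zero    = refl
  lhsOf-blanks (suc n) = begin
    lhsOf (blank ∷ replicate n blank)                   ≡⟨ lhsOf-blank (replicate n blank) ⟩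
    nothing ∷ replicate g nothing ++ X                  ≡⟨ cong (λ Y → nothing ∷ replicate g nothing ++ Y) (lhsOf-blanks n) ⟩
    replicate (suc g) nothing ++ replicate (length X) nothing ≡⟨ sym (nothings (suc g)) ⟩
    replicate (suc g + length X) nothing                ≡⟨ cong (λ k → replicate k nothing) (sym (trans (cong length (lhsOf-blank (replicate n blank)))
                                                            (cong suc (trans (Listₚ.length-++ (replicate g nothing)) (cong (_+ length X) (Listₚ.length-replicate g)))))) ⟩
    replicate (length (lhsOf (blank ∷ replicate n blank))) nothing ∎
    where
    open ≡-Reasoning
    X = lhsOf (replicate n blank)

  raws : List (Fin (suc s)) → List A → List A
  raws z R = map just z ʳ++ (nothing ∷ R)

  raws-nonempty : ∀ z R → Nonempty (raws z R)
  raws-nonempty z R = go z (nothing , R , refl)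
    where
    go : ∀ z {xs} → Nonempty xs → Nonempty (map just z ʳ++ xs)
    go []      p = p
    go (a ∷ z) p = go z (just a , _ , refl)

  short-length : toℕ short ≡ length (replicate {A = A} g nothing)
  short-length = trans (Finₚ.toℕ-↑ˡ (inject₁ (fromℕ g)) (suc g)) (trans (Finₚ.toℕ-inject₁ (fromℕ g))
    (trans (Finₚ.toℕ-fromℕ g) (sym (Listₚ.length-replicate g))))

  cross-gap : ∀ {t} bs R → (inj₁ (ml short (visit t)) ⦂ replicate g nothing ++ lhsOf bs ∣ nothing ∷ R) Z.⟶*
              (enter t ⦂ lhsOf bs ∣ rhsOf R (blank ∷ []))
  cross-gap {t} bs R = walk-left short (replicate g nothing) short-length Z.▸ cong (enter t ⦂ lhsOf bs ∣_) gap

  carry : ∀ a y bs → (inj₁ (seek₀ a) ⦂ map emb y ++ blank ∷ bs ∣ blank ∷ []) B.⟶*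
                     (inj₁ exit ⦂ blank ∷ map emb y ++ emb a ∷ bs ∣ [])
  carry a y bs = B.first-left emb refl y ◅ B.sweepL emb (λ c → ifBlank-no (emb-nb c)) y ◅◅
    B.goR ifBlank-yes ◅ B.sweepR emb (λ c → ifBlank-no (emb-nb c)) y ◅◅ B.goR ifBlank-yes ◅ ε

  transfer-one : ∀ a z y bs R →
    (inj₁ r₁ ⦂ lhsOf (blank ∷ map emb y ++ blank ∷ bs) ∣ raws (a ∷ z) R) Z.⟶*
    (inj₁ r₁ ⦂ lhsOf (blank ∷ map emb y ++ emb a ∷ bs) ∣ raws z (nothing ∷ R))
  transfer-one a z y bs R =
    (cong (inj₁ r₁ ⦂_∣ raws (a ∷ z) R) (lhsOf-blank X) Z.◂
     Z.sweepR just (λ _ → refl) (a ∷ z)) ◅◅ goL refl ◅ Z.first-left just refl z ◅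
    Z.sweepL just (λ _ → refl) z ◅◅ goS refl ◅ cross-gap X (raws z (nothing ∷ R)) ◅◅
    Layout.simulates* (raws-nonempty z (nothing ∷ R)) (carry a y bs)
    where X = map emb y ++ blank ∷ bs

  -- `z` is the unread input backwards and `y` holds the letters already in blocks, nearest first.
  -- Each letter goes to the far end of `y`, so from left to right the blocks spell the word.
  transfer : ∀ z y bs R →
    (inj₁ r₁ ⦂ lhsOf (blank ∷ map emb y ++ (replicate (length z) blank ++ bs)) ∣ raws z R) Z.⟶*
    (inj₁ r₁ ⦂ lhsOf (blank ∷ map emb (y ++ z) ++ bs) ∣ nothing ∷ replicate (length z) nothing ++ R)
  transfer []      y bs R = ε Z.▸ cong (λ y → inj₁ r₁ ⦂ lhsOf (blank ∷ map emb y ++ bs) ∣ nothing ∷ R) (sym (Listₚ.++-identityʳ y))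
  transfer (a ∷ z) y bs R =
    transfer-one a z y (replicate (length z) blank ++ bs) R ◅◅
    (cong (λ xs → inj₁ r₁ ⦂ lhsOf (blank ∷ xs) ∣ raws z (nothing ∷ R)) snoc Z.◂ transfer z (y ++ a ∷ []) bs (nothing ∷ R)) Z.▸
    cong₂ (λ y xs → inj₁ r₁ ⦂ lhsOf (blank ∷ map emb y ++ bs) ∣ nothing ∷ xs) (Listₚ.++-assoc y (a ∷ []) z) (replicate-shift (length z))
    where
    snoc : map emb y ++ emb a ∷ (replicate (length z) blank ++ bs) ≡ map emb (y ++ a ∷ []) ++ (replicate (length z) blank ++ bs)
    snoc = sym (trans (cong (_++ (replicate (length z) blank ++ bs)) (Listₚ.map-++ emb y (a ∷ []))) (Listₚ.++-assoc (map emb y) (emb a ∷ []) _))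

  locate : ∀ y bs rs → (inj₁ s₀ ⦂ map emb y ++ blank ∷ bs ∣ blank ∷ rs) B.⟶*
                       (inj₁ (sim (q₀ M)) ⦂ blank ∷ bs ∣ map emb y ʳ++ (blank ∷ rs))
  locate y bs rs = B.first-left emb refl y ◅ B.sweepL emb (λ c → ifBlank-no (emb-nb c)) y ◅◅ B.goR ifBlank-yes ◅ ε

  -- By the hypothesis the erased input cells and `R` together form `J` whole blank blocks. The
  -- blank that ended the input remains as the one cell of rest that `Layout` demands.
  prepare : ∀ w N J R → replicate (length w) nothing ++ R ≡ replicate (J * suc g) nothing →
    (inj₁ r₁ ⦂ lhsOf (blank ∷ (replicate (length w) blank ++ replicate (suc N) blank)) ∣ map just w ++ nothing ∷ R) Z.⟶*
    Layout.cells {nothing ∷ []} (nothing , [] , refl) (sim (q₀ M)) (replicate (suc N) blank) (map emb w ++ replicate (suc J) blank)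
  prepare w N J R e =
    (cong₂ (λ n xs → inj₁ r₁ ⦂ lhsOf (blank ∷ (replicate n blank ++ replicate (suc N) blank)) ∣ xs)
      (sym (Listₚ.length-reverse w))
      (sym (trans (cong (_ʳ++ (nothing ∷ R)) (Listₚ.reverse-map just w)) (reverse-ʳ++ (map just w)))) Z.◂
     transfer (reverse w) [] (replicate (suc N) blank) R) ◅◅
    (cong (inj₁ r₁ ⦂_∣ _) (lhsOf-blank X) Z.◂ goL refl ◅ goS refl ◅ cross-gap X _) ◅◅
    (cong (λ xs → enter s₀ ⦂ lhsOf X ∣ code blank ++ xs)
      (trans (cong (λ n → nothing ∷ replicate n nothing ++ R) (Listₚ.length-reverse w)) (trans (cong (nothing ∷_) e) (sym (rhsOf-blanks J)))) Z.◂
     Layout.simulates* (nothing , [] , refl) (locate (reverse w) (replicate N blank) (replicate J blank)) Z.▸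
     cong (Layout.cells (nothing , [] , refl) (sim (q₀ M)) (replicate (suc N) blank))
       (trans (cong (_ʳ++ replicate (suc J) blank) (Listₚ.reverse-map emb w)) (reverse-ʳ++ (map emb w))))
    where X = map emb (reverse w) ++ replicate (suc N) blank

  -- Replaying the space bounded decider on blocks

  open Halting M

  enter-halted : ∀ v {q} → halted-as v q → enter (sim q) ≡ inj₂ v
  enter-halted true  {q} h rewrite h = refl
  enter-halted false {q} h with isF M q in e
  ... | true  = case exclusive true false e h of λ ()
  ... | false rewrite h = refl

  halting? : ∀ q → (∃ λ v → halted-as v q) ⊎ halting q ≡ false
  halting? q with isF M q in e | isR M q in e'
  ... | true  | _     = inj₁ (true , e)
  ... | false | true  = inj₁ (false , e')
  ... | false | false = inj₂ refl

  open Tapes {G} id using (RepL; RepR; moved-left; moved-stay; moved-right; ⊖-suc; ⊖-pred; initTape-RepL; initTape-RepR)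

  inner-left : ∀ {P h} (ls : List G) → ∣ h ∣ ≤ P → h ≡ length ls ⊖ suc P → ∃ λ l → ∃ λ ls' → ls ≡ l ∷ ls'
  inner-left []       le refl = ⊥-elim (ℕₚ.<-irrefl refl le)
  inner-left (l ∷ ls) le e    = l , ls , refl

  inner-right : ∀ {P h} (ls rs : List G) → ∣ h ∣ ≤ P → h ≡ length ls ⊖ suc P → suc P + suc P ≤ length ls + length rs →
                ∃ λ r → ∃ λ rs' → rs ≡ r ∷ rs'
  inner-right ls (r ∷ rs) le e    wide = r , rs , refl
  inner-right {P} ls [] le refl wide = ⊥-elim (ℕₚ.<-irrefl refl (ℕₚ.≤-trans (ℕₚ.m+n≤o⇒m≤o∸n (suc P) wide')
      (subst (_≤ P) (cong ∣_∣ (ℤₚ.⊖-≥ (ℕₚ.≤-trans (ℕₚ.m≤m+n (suc P) _) wide'))) le)))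
    where
    wide' : suc P + suc P ≤ length ls
    wide' = subst (suc P + suc P ≤_) (ℕₚ.+-identityʳ (length ls)) wide

  sim-next : ∀ {q x q' y m} → halting q ≡ false → δ M q x ≡ just (q' , y , m) → nextTag (sim q) x ≡ just (inj₁ (sim q') , y , m)
  sim-next h e rewrite h | e = refl

  Replayed : Bool → Fin (nQ M) → List G → List G → Set
  Replayed v q ls rs = ∃ λ q' → ∃ λ ls' → ∃ λ rs' →
    ((inj₁ (sim q) ⦂ ls ∣ rs) B.⟶* (inj₁ (sim q') ⦂ ls' ∣ rs')) × enter (sim q') ≡ inj₂ v

  replayed-step : ∀ {v q ls rs q₁ ls₁ rs₁} → (inj₁ (sim q) ⦂ ls ∣ rs) B.⟶ (inj₁ (sim q₁) ⦂ ls₁ ∣ rs₁) →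
                  Replayed v q₁ ls₁ rs₁ → Replayed v q ls rs
  replayed-step st (q' , ls' , rs' , run , e) = q' , ls' , rs' , st ◅ run , e

  -- The stretch begins at `- suc P` and has at least `suc P + suc P` cells. A head within distance
  -- `P` of the origin thus has a cell to its left and scans a cell, so each step has its zipper
  -- counterpart. The replay stops at the first halting state, whose verdict agrees with `v` since
  -- verdicts persist and exclude each other.
  replay : ∀ {P v c c'} → Star (Step M) c c' → halted-as v (state c') →
           (∀ c'' → Star (Step M) c c'' → ∣ head c'' ∣ ≤ P) → ∀ ls rs →
           head c ≡ length ls ⊖ suc P → suc P + suc P ≤ length ls + length rs →
           RepL (tape c) (head c) ls → RepR (tape c) (head c) rs → Replayed v (state c) ls rs
  replay {v = v} ε h bound ls rs p wide l r = _ , ls , rs , ε , enter-halted v h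
  replay {v = v} {c} sts@(_ ◅ _) h bound ls rs p wide l r with halting? (state c)
  ... | inj₁ (v' , h') = _ , ls , rs , ε , trans (enter-halted v' h') (cong inj₂ (exclusive v' v (closed* v' sts h') h))
  replay {c = c} (step _ ◅ _) h bound ls rs p wide l r | inj₂ no-halt
    with inner-left ls (bound c ε) p | inner-right ls rs (bound c ε) p wide
  replay {P} {c = ⟨ q , t , h₀ ⟩} (step {m = left} e ◅ sts) h bound (x ∷ ls) (y ∷ rs) p wide l r@(refl , _) | inj₂ no-halt | _ , _ , refl | _ , _ , refl
    with l' , r' ← moved-left t h₀ l r = replayed-step (B.goL (sim-next no-halt e))
      (replay sts h (λ c'' run → bound c'' (step e ◅ run)) ls _ (trans (cong (ℤ._+ -[1+ 0 ]) p) (sym (⊖-pred (length ls) (suc P))))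
        (ℕₚ.≤-trans wide (ℕₚ.≤-reflexive (sym (ℕₚ.+-suc (length ls) _)))) l' r')
  replay {P} {c = ⟨ q , t , h₀ ⟩} (step {m = stay} e ◅ sts) h bound ls (y ∷ rs) p wide l r@(refl , _) | inj₂ no-halt | _ , _ , refl | _ , _ , refl
    with l' , r' ← moved-stay t h₀ l r = replayed-step (B.goS (sim-next no-halt e))
      (replay sts h (λ c'' run → bound c'' (step e ◅ run)) ls _ (trans (ℤₚ.+-identityʳ _) p) wide l' r')
  replay {P} {c = ⟨ q , t , h₀ ⟩} (step {m = right} e ◅ sts) h bound ls (y ∷ rs) p wide l r@(refl , _) | inj₂ no-halt | _ , _ , refl | _ , _ , refl
    with l' , r' ← moved-right t h₀ l r = replayed-step (B.goR (sim-next no-halt e))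
      (replay sts h (λ c'' run → bound c'' (step e ◅ run)) (_ ∷ ls) rs (trans (cong (ℤ._+ + 1) p) (sym (⊖-suc (length ls) (suc P))))
        (ℕₚ.≤-trans wide (ℕₚ.≤-reflexive (ℕₚ.+-suc (length ls) _))) l' r')

  module Machine = Compile finQ next r₁ id id (λ _ → refl)
  open Machine using (machine; Rep-start) public

  -- From the origin outwards: the separating block, room for the `m` letters, and `suc P` blocks
  -- for excursions to the left of the word.
  leftBlocks : ℕ → ℕ → List G
  leftBlocks m P = blank ∷ (replicate m blank ++ replicate (suc P) blank)

  -- Chosen so that together with the `m` erased letters it fills exactly `m + P` blocks: the term
  -- `m * g` completes each letter cell to a block.
  rightBlanks : ℕ → ℕ → ℕ
  rightBlanks m P = P * suc g + m * g

  initial : List (Fin (suc s)) → ℕ → Zipper (Q ⊎ Bool) A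
  initial w P = inj₁ r₁ ⦂ lhsOf (leftBlocks (length w) P) ∣ map just w ++ replicate (suc (rightBlanks (length w) P)) nothing

  nothings-blocks : ∀ m P g → m + (P * suc g + m * g) ≡ (m + P) * suc g
  nothings-blocks = solve-∀

  wide : ∀ w P → suc P + suc P ≤ length (replicate (suc P) blank) + length (map emb w ++ replicate (suc (length w + P)) blank)
  wide w P = ℕₚ.+-mono-≤ (ℕₚ.≤-reflexive (sym (Listₚ.length-replicate (suc P))))
    (ℕₚ.≤-trans (s≤s (ℕₚ.m≤n+m P (length w))) (ℕₚ.≤-trans (ℕₚ.m≤n+m (suc (length w + P)) (length (map emb w)))
      (ℕₚ.≤-reflexive (sym (trans (Listₚ.length-++ (map emb w))
        (cong (λ k → length (map emb w) + k) (Listₚ.length-replicate (suc (length w + P)))))))))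

  simulation : ∀ w {P v c} → Star (Step M) (initConfig M blank emb w) c → halted-as v (state c) →
               (∀ c' → Star (Step M) (initConfig M blank emb w) c' → ∣ head c' ∣ ≤ P) →
               ∃ λ ls → ∃ λ rs → initial w P Z.⟶* (inj₂ v ⦂ ls ∣ rs)
  simulation w {P} {v} run h bound
    with q' , ls , rs , run' , e ← replay run h bound (replicate (suc P) blank) (map emb w ++ replicate (suc (length w + P)) blank)
           (sym (trans (cong (_⊖ suc P) (Listₚ.length-replicate (suc P))) (ℤₚ.n⊖n≡0 (suc P))))
           (wide w P) (initTape-RepL blank emb w 0 (suc P)) (initTape-RepR blank emb w (suc (length w + P)))
    = _ , _ , prepare w P (length w + P) (replicate (rightBlanks (length w) P) nothing)
        (trans (sym (nothings (length w))) (cong (λ k → replicate k nothing) (nothings-blocks (length w) P g))) ◅◅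
      (Layout.simulates* (nothing , [] , refl) run' Z.▸ cong (λ q → q ⦂ lhsOf ls ∣ rhsOf (nothing ∷ []) rs) e)

  spaceᴾ : ∀ p → Polynomial (λ m → suc (m + suc (eval p m)) * suc g + (m + suc (rightBlanks m (eval p m))))
  spaceᴾ p = (constᴾ 1 +ᴾ (idᴾ +ᴾ (constᴾ 1 +ᴾ P))) *ᴾ constᴾ (suc g) +ᴾ (idᴾ +ᴾ (constᴾ 1 +ᴾ (P *ᴾ constᴾ (suc g) +ᴾ idᴾ *ᴾ constᴾ g)))
    where
    P : Polynomial (eval p)
    P = p , λ _ → refl

  extent-initial : ∀ w p → extent (initial w (eval p (length w))) ≡ eval (proj₁ (spaceᴾ p)) (length w)
  extent-initial w p = trans (cong₂ _+_
    (trans (length-lhsOf (leftBlocks m P)) (cong (λ k → suc k * suc g)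
      (trans (Listₚ.length-++ (replicate m blank)) (cong₂ _+_ (Listₚ.length-replicate m) (Listₚ.length-replicate (suc P))))))
    (trans (Listₚ.length-++ (map just w)) (cong₂ _+_ (Listₚ.length-map just w) (Listₚ.length-replicate (suc (rightBlanks m P))))))
    (sym (proj₂ (spaceᴾ p) m))
    where
    m P : ℕ
    m = length w
    P = eval p m

  left-blank : ∀ m P → lhsOf (leftBlocks m P) ≡ replicate (length (lhsOf (leftBlocks m P))) nothing
  left-blank m P = subst (λ bs → lhsOf bs ≡ replicate (length (lhsOf bs)) nothing) (replicate-+ m) (lhsOf-blanks (suc (m + suc P)))
    where
    replicate-+ : ∀ m → blank ∷ replicate (m + suc P) blank ≡ leftBlocks m P
    replicate-+ zero    = refl
    replicate-+ (suc m) = cong (blank ∷_) (replicate-+ m)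

  initial-rep : ∀ w P → Machine.Rep (length (lhsOf (leftBlocks (length w) P))) (initial w P) (init machine w)
  initial-rep w P = Rep-start
    (subst (Tapes.RepL id (initTape nothing just w) (+ 0)) (sym (left-blank (length w) P)) (Tapes.initTape-RepL id nothing just w 0 _))
    (Tapes.initTape-RepR id nothing just w (suc (rightBlanks (length w) P)))

-- Robust machines from space bounded deciders

Robust : {s : ℕ} → Language s → Set
Robust {s} L = Σ (TM (Sym s)) (λ M → Σ Poly (λ p →
  (∀ k → 0 < eval p k)
  × (∀ w → (L w ⇔ Accepts M w))
  × (∀ w → (L w ⇔ AcceptsPerturbed M (eval p (length w)) w))))

module Verdict {s : ℕ} {L : Language s} (𝒫 : PSPACE L) where

  open PSPACE 𝒫
  open Halting M

  -- If a rejected word were in `L`, soundness would give an accepting run from the same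
  -- configuration. By determinism one of the two runs extends the other, and closure carries both
  -- verdicts to a common state.
  verdict : ∀ w → ∃ λ v → (∃ λ c → Star (Step M) (initConfig M blank emb w) c × halted-as v (state c)) × (v ≡ true ⇔ L w)
  verdict w with halts w
  ... | c , run , inj₁ acc = true , (c , run , acc) , mk⇔ (λ _ → decides-complete w (c , run , acc)) (λ _ → refl)
  ... | c , run , inj₂ rej = false , (c , run , rej) , mk⇔ (λ ()) go
    where
    go : L w → false ≡ true
    go l with c' , run' , acc ← decides-sound w l with compare run run'
    ... | inj₁ more = exclusive false true (closed* false more rej) acc
    ... | inj₂ more = exclusive false true rej (closed* true more acc)

module Forward {s : ℕ} {L : Language (suc s)} {g : ℕ} (blank : Fin (suc g)) (emb : Fin (suc s) → Fin (suc g))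
  (emb-nb : ∀ a → emb a ≢ blank) (M : TM (Fin (suc g))) (p : Poly)
  (space : ∀ w c → Star (Step M) (initConfig M blank emb w) c → ∣ head c ∣ ≤ eval p (length w))
  (verdict : ∀ w → ∃ λ v → (∃ λ c → Star (Step M) (initConfig M blank emb w) c × Halting.halted-as M v (state c)) × (v ≡ true ⇔ L w)) where

  open Blocks blank emb emb-nb M

  q : Poly
  q = proj₁ (spaceᴾ p)

  module Decision (w : Word (suc s)) where

    v : Bool
    v = proj₁ (verdict w)

    run : ∃ λ ls → ∃ λ rs → Star (Zippers._⟶_ next) (initial w (eval p (length w))) (inj₂ v ⦂ ls ∣ rs)
    run = let (c , r , h) = proj₁ (proj₂ (verdict w)) in simulation w r h (space w)

    open Machine.Outcome (proj₂ (proj₂ run)) (initial-rep w (eval p (length w))) using (reaches; accepts⇒) public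

    accepts : L w → Accepts machine w
    accepts l = let (c , r , acc , _) = reaches in c , r , trans acc (Equivalence.from (proj₂ (proj₂ (verdict w))) l)

    accepts-perturbed : AcceptsPerturbed machine (eval q (length w)) w → L w
    accepts-perturbed (c , r , acc) = Equivalence.to (proj₂ (proj₂ (verdict w)))
      (accepts⇒ (ℕₚ.≤-reflexive (extent-initial w p)) r acc)

  robust : Robust L
  robust = machine , q ,
    (λ k → subst (0 <_) (sym (proj₂ (spaceᴾ p) k)) (s≤s z≤n)) ,
    (λ w → mk⇔ (Decision.accepts w) (Decision.accepts-perturbed w ∘ weaken)) ,
    (λ w → mk⇔ (weaken ∘ Decision.accepts w) (Decision.accepts-perturbed w))
    where
    weaken : ∀ {n w} → Accepts machine w → AcceptsPerturbed machine n w
    weaken (c , r , acc) = c , Star.map Step⇒PStep r , acc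

-- Needed over the empty alphabet, which offers no letter for the block code.
constant : Bool → TM (Sym 0)
constant v = record
  { nQ = 1 ; q₀ = zero ; isF = λ _ → v ; isR = λ _ → not v ; disjoint = λ _ → disj v
  ; δ = λ _ _ → nothing ; closedF = λ _ _ _ _ _ () ; closedR = λ _ _ _ _ _ () }
  where
  disj : ∀ v → v ≡ true → not v ≡ false
  disj true _ = refl

robust-constant : {L : Language 0} (v : Bool) → (v ≡ true ⇔ L []) → Robust L
robust-constant v e = constant v , 1 ∷ [] , (λ _ → s≤s z≤n) ,
  (λ { [] → mk⇔ (λ l → _ , ε , Equivalence.from e l) (λ (_ , _ , acc) → Equivalence.to e acc) }) ,
  (λ { [] → mk⇔ (λ l → _ , ε , Equivalence.from e l) (λ (_ , _ , acc) → Equivalence.to e acc) })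

forward : ∀ {s} {L : Language s} → PSPACE L → Robust L
forward {zero}      𝒫 = let (v , _ , e) = Verdict.verdict 𝒫 [] in robust-constant v e
forward {suc s} {L} 𝒫 = go blank emb emb-nb M space (Verdict.verdict 𝒫)
  where
  open PSPACE 𝒫
  go : ∀ {g} (blank : Fin g) (emb : Fin (suc s) → Fin g) → (∀ a → emb a ≢ blank) → (M : TM (Fin g)) →
       (∀ w c → Star (Step M) (initConfig M blank emb w) c → ∣ head c ∣ ≤ eval p (length w)) →
       (∀ w → ∃ λ v → (∃ λ c → Star (Step M) (initConfig M blank emb w) c × Halting.halted-as M v (state c)) × (v ≡ true ⇔ L w)) →
       Robust L
  -- The element `blank` rules out an empty tape alphabet, so its size can be written as a
  -- successor.
  go {suc g} blank emb emb-nb M space verdict = Forward.robust blank emb emb-nb M p space verdict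

theorem17 : (s : ℕ) (L : Language s) →
    PSPACE L ⇔ Σ (TM (Sym s)) (λ M → Σ Poly (λ p →
    (∀ k → 0 < eval p k)
    × (∀ w → (L w ⇔ Accepts M w))
    × (∀ w → (L w ⇔ AcceptsPerturbed M (eval p (length w)) w))))
theorem17 s L = mk⇔ forward λ (M , p , _ , exact , robust) → Forget.pspace M p exact robust
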